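{- The generating function for the pair $(\mathsf{des},\mathsf{ides})$ on permutations is given by $$\sum_{n=0}^{\infty}\sum_{\pi\in\mathfrak{S}_n}\frac{u^{\mathsf{des}(\pi)}x^{\mathsf{ides}(\pi)}t^n}{(1-u)^{n+1}(1-x)^{n+1}}=\sum_{n=1}^{\infty}\frac{t(1-t)^{n-1}(u-1)^{ -1}}{u^n\big(1-x(1-t)^{n-1}\big)\big(1-x(1-t)^{n}\big)}+\frac{1}{(u-1)(x-1)}=\sum_{n=1}^{\infty}\sum_{k=1}^{\infty}\frac{x^{n-1}u^{k-1}}{(1-t)^{kn}}.$$
   Context: $\mathfrak{S}_n$ is the set of permutations of $\{1,\dots,n\}$; $\mathfrak{S}_0$ consists of the empty permutation, for which both statistics are $0$. $\mathsf{des}(\pi)=|\{i\in[n-1]:\pi_i>\pi_{i+1}\}|$ and $\mathsf{ides}(\pi)=\mathsf{des}(\pi^{ -1})$. The identities are between formal power series in $t$ whose coefficients are rational functions of $x$ and $u$: the coefficient of each power of $t$ in the middle expression is to be read as the rational function obtained by summing the series in powers of $u^{ -1}$, and the coefficient of each power of $t$ in the last expression as the rational function whose expansion in powers of $x$ and $u$ is displayed. -}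

module Defs where

open import Level using (0ℓ)
open import Algebra.Bundles using (CommutativeRing)
open import Algebra.Structures using (IsCommutativeRing)
import Algebra.Properties.AbelianGroup as AbelianGroupProperties
import Algebra.Properties.Ring as RingProperties
import Algebra.Properties.Semiring.Exp as Exponentiation
import Algebra.Properties.Semiring.Sum as Summation
import Algebra.Solver.Ring.NaturalCoefficients.Default as SemiringSolver
open import Data.Fin.Base as Fin using (Fin; toℕ; inject₁)
import Data.Fin.Properties as Finₚ
open import Data.Fin.Permutation as Perm
  using (Permutation′; _⟨$⟩ʳ_; insert; remove)
open import Data.Integer.Base using (ℤ; 1ℤ)
import Data.Integer.Properties as ℤₚ
open import Data.List.Base
  using (List; []; _∷_; foldr; map; length; filter; allFin; cartesianProductWith)
open import Data.List.Relation.Unary.Any using (here)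
open import Data.List.Relation.Unary.AllPairs as AllPairs using ()
open import Data.List.Relation.Unary.All using ([])
import Data.List.Membership.Propositional.Properties as ∈ₚ
import Data.List.Membership.Setoid as SetoidMembership
import Data.List.Membership.Setoid.Properties as SetoidMembershipₚ
import Data.List.Relation.Unary.Unique.Propositional.Properties as Uniqueₚ
import Data.List.Relation.Unary.Unique.Setoid as SetoidUnique
import Data.List.Relation.Unary.Unique.Setoid.Properties as SetoidUniqueₚ
open import Data.Nat.Base as ℕ using (ℕ; zero; suc; _∸_; s≤s)
import Data.Nat.Properties as ℕₚ
open import Data.Product.Base using (Σ-syntax; ∃-syntax; _×_; _,_; proj₁; proj₂)
open import Function.Base using (_∘_)
open import Relation.Binary.Bundles using (Setoid)
open import Relation.Binary.PropositionalEquality as ≡ using (_≡_)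
import Relation.Binary.Reasoning.Setoid as SetoidReasoning
open import Relation.Nullary.Negation.Core using (¬_)

module RegularElements (R : CommutativeRing 0ℓ 0ℓ) where
  open CommutativeRing R
  open RingProperties ring using (-‿distribˡ-*; -‿involutive)
  open AbelianGroupProperties +-abelianGroup using (ε⁻¹≈ε)
  open Exponentiation semiring using (_^_)
  open SetoidReasoning setoid

  -- In an integral domain such as ℤ[x,u] this is the same as a ≉ 0#.
  Regular : Carrier → Set
  Regular a = ∀ b → a * b ≈ 0# → b ≈ 0#

  Unit : Carrier → Set
  Unit a = Σ[ c ∈ Carrier ] c * a ≈ 1#

  regular-resp : ∀ {a b} → a ≈ b → Regular a → Regular b
  regular-resp a≈b ra c bc≈0 = ra c (trans (*-congʳ a≈b) bc≈0)

  regular-1 : Regular 1#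
  regular-1 b e = trans (sym (*-identityˡ b)) e

  regular-neg : ∀ {a} → Regular a → Regular (- a)
  regular-neg {a} ra b e = ra b (begin
    a * b            ≈⟨ -‿involutive _ ⟨
    - (- (a * b))    ≈⟨ -‿cong (-‿distribˡ-* a b) ⟩
    - (- a * b)      ≈⟨ -‿cong e ⟩
    - 0#             ≈⟨ ε⁻¹≈ε ⟩
    0#               ∎)

  regular-* : ∀ {a b} → Regular a → Regular b → Regular (a * b)
  regular-* {a} {b} ra rb c e =
    rb c (ra (b * c) (trans (sym (*-assoc a b c)) e))

  regular-^ : ∀ {a} → Regular a → ∀ n → Regular (a ^ n)
  regular-^ ra zero    = regular-1
  regular-^ ra (suc n) = regular-* ra (regular-^ ra n)

  unit-resp : ∀ {a b} → a ≈ b → Unit a → Unit b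
  unit-resp a≈b (c , e) = c , trans (*-congˡ (sym a≈b)) e

  unit-1 : Unit 1#
  unit-1 = 1# , *-identityˡ 1#

  unit-* : ∀ {a b} → Unit a → Unit b → Unit (a * b)
  unit-* {a} {b} (c , ca) (d , db) = (d * c) , (begin
    (d * c) * (a * b)  ≈⟨ *-assoc d c (a * b) ⟩
    d * (c * (a * b))  ≈⟨ *-congˡ (*-assoc c a b) ⟨
    d * ((c * a) * b)  ≈⟨ *-congˡ (trans (*-congʳ ca) (*-identityˡ b)) ⟩
    d * b              ≈⟨ db ⟩
    1#                 ∎)

  unit-^ : ∀ {a} → Unit a → ∀ n → Unit (a ^ n)
  unit-^ ua zero    = unit-1
  unit-^ ua (suc n) = unit-* ua (unit-^ ua n)

module FormalPowerSeries (R : CommutativeRing 0ℓ 0ℓ) where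
  private module R = CommutativeRing R
  open R using (Carrier)
  open RegularElements R using (Unit) renaming (Regular to Regularᴿ)
  open Summation R.semiring using (sum)
  open SetoidReasoning R.setoid
  open SemiringSolver R.commutativeSemiring
    using (solve; _:=_; _:+_; _:*_)

  Series : Set
  Series = ℕ → Carrier

  infix  4 _≈_
  infixl 6 _+_
  infixl 7 _*_
  infix  8 -_

  _≈_ : Series → Series → Set
  f ≈ g = ∀ n → f n R.≈ g n

  _+_ : Series → Series → Series
  (f + g) n = f n R.+ g n

  -_ : Series → Series
  (- f) n = R.- f n

  _*_ : Series → Series → Series
  (f * g) n = sum {suc n} (λ i → f (toℕ i) R.* g (n ∸ toℕ i))

  constant : Carrier → Series
  constant a zero    = a
  constant a (suc n) = R.0#

  0# 1# : Series
  0# n = R.0#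
  1# = constant R.1#

  X : Series
  X zero          = R.0#
  X (suc zero)    = R.1#
  X (suc (suc n)) = R.0#

  shift : Series → Series
  shift f n = f (suc n)

  -- Division by ascending powers; by quotient-* it inverts multiplication
  -- by g whenever g has a unit as constant coefficient.
  quotient : Series → (g : Series) → Unit (g 0) → Series
  quotient f g u zero    = proj₁ u R.* f 0
  quotient f g u (suc n) =
    quotient (λ k → f (suc k) R.- proj₁ u R.* f 0 R.* g (suc k)) g u n

  *-head : ∀ f g → (f * g) 0 R.≈ f 0 R.* g 0
  *-head f g = R.+-identityʳ _

  *-cong : ∀ {f f′ g g′} → f ≈ f′ → g ≈ g′ → f * g ≈ f′ * g′
  *-cong p q zero    = R.+-congʳ (R.*-cong (p 0) (q 0))
  *-cong p q (suc n) =
    R.+-cong (R.*-cong (p 0) (q (suc n))) (*-cong (p ∘ suc) q n)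

  *-distribʳ : ∀ h f g → (f + g) * h ≈ f * h + g * h
  *-distribʳ h f g zero = begin
    (f 0 R.+ g 0) R.* h 0 R.+ R.0#
      ≈⟨ R.+-identityʳ _ ⟩
    (f 0 R.+ g 0) R.* h 0
      ≈⟨ R.distribʳ _ _ _ ⟩
    f 0 R.* h 0 R.+ g 0 R.* h 0
      ≈⟨ R.+-cong (*-head f h) (*-head g h) ⟨
    (f * h) 0 R.+ (g * h) 0 ∎
  *-distribʳ h f g (suc n) = begin
    (f 0 R.+ g 0) R.* h (suc n) R.+ ((shift f + shift g) * h) n
      ≈⟨ R.+-congˡ (*-distribʳ h (shift f) (shift g) n) ⟩
    (f 0 R.+ g 0) R.* h (suc n) R.+ ((shift f * h) n R.+ (shift g * h) n)
      ≈⟨ solve 5 (λ a b c d e → (a :+ b) :* c :+ (d :+ e)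
                              := (a :* c :+ d) :+ (b :* c :+ e)) R.refl
                 (f 0) (g 0) (h (suc n)) ((shift f * h) n) ((shift g * h) n) ⟩
    (f * h) (suc n) R.+ (g * h) (suc n) ∎

  scale-* : ∀ a f g n → ((λ k → a R.* f k) * g) n R.≈ a R.* (f * g) n
  scale-* a f g zero = begin
    a R.* f 0 R.* g 0 R.+ R.0#  ≈⟨ R.+-identityʳ _ ⟩
    a R.* f 0 R.* g 0           ≈⟨ R.*-assoc _ _ _ ⟩
    a R.* (f 0 R.* g 0)         ≈⟨ R.*-congˡ (*-head f g) ⟨
    a R.* (f * g) 0             ∎
  scale-* a f g (suc n) = begin
    a R.* f 0 R.* g (suc n) R.+ ((λ k → a R.* f (suc k)) * g) n
      ≈⟨ R.+-cong (R.*-assoc _ _ _) (scale-* a (shift f) g n) ⟩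
    a R.* (f 0 R.* g (suc n)) R.+ a R.* (shift f * g) n
      ≈⟨ R.distribˡ _ _ _ ⟨
    a R.* (f * g) (suc n) ∎

  *-snoc : ∀ f g n → (f * g) (suc n) R.≈ (f * shift g) n R.+ f (suc n) R.* g 0
  *-snoc f g zero = begin
    f 0 R.* g 1 R.+ (f 1 R.* g 0 R.+ R.0#)
      ≈⟨ R.+-cong (R.sym (R.+-identityʳ _)) (R.+-identityʳ _) ⟩
    (f * shift g) 0 R.+ f 1 R.* g 0 ∎
  *-snoc f g (suc n) = begin
    f 0 R.* g (suc (suc n)) R.+ (shift f * g) (suc n)
      ≈⟨ R.+-congˡ (*-snoc (shift f) g n) ⟩
    f 0 R.* g (suc (suc n)) R.+
      ((shift f * shift g) n R.+ f (suc (suc n)) R.* g 0)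
      ≈⟨ R.+-assoc _ _ _ ⟨
    (f * shift g) (suc n) R.+ f (suc (suc n)) R.* g 0 ∎

  *-comm : ∀ f g → f * g ≈ g * f
  *-comm f g zero    = R.+-congʳ (R.*-comm _ _)
  *-comm f g (suc n) = begin
    f 0 R.* g (suc n) R.+ (shift f * g) n
      ≈⟨ R.+-cong (R.*-comm _ _) (*-comm (shift f) g n) ⟩
    g (suc n) R.* f 0 R.+ (g * shift f) n
      ≈⟨ R.+-comm _ _ ⟩
    (g * shift f) n R.+ g (suc n) R.* f 0
      ≈⟨ *-snoc g f n ⟨
    (g * f) (suc n) ∎

  *-assoc : ∀ f g h → (f * g) * h ≈ f * (g * h)
  *-assoc f g h zero = begin
    ((f * g) * h) 0                ≈⟨ *-head (f * g) h ⟩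
    (f * g) 0 R.* h 0              ≈⟨ R.*-congʳ (*-head f g) ⟩
    f 0 R.* g 0 R.* h 0            ≈⟨ R.*-assoc _ _ _ ⟩
    f 0 R.* (g 0 R.* h 0)          ≈⟨ R.*-congˡ (*-head g h) ⟨
    f 0 R.* (g * h) 0              ≈⟨ *-head f (g * h) ⟨
    (f * (g * h)) 0                ∎
  *-assoc f g h (suc n) = begin
    (f * g) 0 R.* h (suc n) R.+
      (((λ k → f 0 R.* g (suc k)) + shift f * g) * h) n
      ≈⟨ R.+-cong (R.*-congʳ (*-head f g))
                  (*-distribʳ h (λ k → f 0 R.* g (suc k)) (shift f * g) n) ⟩
    f 0 R.* g 0 R.* h (suc n) R.+
      (((λ k → f 0 R.* g (suc k)) * h) n R.+ ((shift f * g) * h) n)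
      ≈⟨ R.+-congˡ (R.+-cong (scale-* (f 0) (shift g) h n)
                             (*-assoc (shift f) g h n)) ⟩
    f 0 R.* g 0 R.* h (suc n) R.+
      (f 0 R.* (shift g * h) n R.+ (shift f * (g * h)) n)
      ≈⟨ solve 5 (λ a b c d e → a :* b :* c :+ (a :* d :+ e)
                              := a :* (b :* c :+ d) :+ e) R.refl
                 (f 0) (g 0) (h (suc n)) ((shift g * h) n)
                 ((shift f * (g * h)) n) ⟩
    (f * (g * h)) (suc n) ∎

  0*-zero : ∀ f → 0# * f ≈ 0#
  0*-zero f zero    = R.trans (R.+-identityʳ _) (R.zeroˡ _)
  0*-zero f (suc n) =
    R.trans (R.+-cong (R.zeroˡ _) (0*-zero f n)) (R.+-identityʳ _)

  constant-* : ∀ a f n → (constant a * f) n R.≈ a R.* f n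
  constant-* a f zero    = R.+-identityʳ _
  constant-* a f (suc n) = R.trans (R.+-congˡ (0*-zero f n)) (R.+-identityʳ _)

  *-identityˡ : ∀ f → 1# * f ≈ f
  *-identityˡ f n = R.trans (constant-* R.1# f n) (R.*-identityˡ _)

  isCommutativeRing : IsCommutativeRing _≈_ _+_ _*_ -_ 0# 1#
  isCommutativeRing = record
    { isRing = record
      { +-isAbelianGroup = record
        { isGroup = record
          { isMonoid = record
            { isSemigroup = record
              { isMagma = record
                { isEquivalence = record
                  { refl  = λ n → R.refl
                  ; sym   = λ p n → R.sym (p n)
                  ; trans = λ p q n → R.trans (p n) (q n)
                  }
                ; ∙-cong = λ p q n → R.+-cong (p n) (q n)
                }
              ; assoc = λ f g h n → R.+-assoc _ _ _
              }
            ; identity = (λ f n → R.+-identityˡ _) , (λ f n → R.+-identityʳ _)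
            }
          ; inverse = (λ f n → R.-‿inverseˡ _) , (λ f n → R.-‿inverseʳ _)
          ; ⁻¹-cong = λ p n → R.-‿cong (p n)
          }
        ; comm = λ f g n → R.+-comm _ _
        }
      ; *-cong = *-cong
      ; *-assoc = *-assoc
      ; *-identity = *-identityˡ , λ f n → R.trans (*-comm f 1# n) (*-identityˡ f n)
      ; distrib = (λ f g h n → R.trans (*-comm f (g + h) n)
                    (R.trans (*-distribʳ f g h n)
                             (R.+-cong (*-comm g f n) (*-comm h f n))))
                , *-distribʳ
      }
    ; *-comm = *-comm
    }

  commutativeRing : CommutativeRing 0ℓ 0ℓ
  commutativeRing = record { isCommutativeRing = isCommutativeRing }

  quotient-* : ∀ f g u → quotient f g u * g ≈ f
  quotient-* f g u@(c , cg≈1) = go f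
    where
    cancel : ∀ a → (c R.* a) R.* g 0 R.≈ a
    cancel a = begin
      c R.* a R.* g 0    ≈⟨ solve 3 (λ x y z → x :* y :* z := x :* z :* y) R.refl
                                    c a (g 0) ⟩
      c R.* g 0 R.* a    ≈⟨ R.*-congʳ cg≈1 ⟩
      R.1# R.* a         ≈⟨ R.*-identityˡ a ⟩
      a                  ∎

    go : ∀ f → quotient f g u * g ≈ f
    go f zero    = R.trans (R.+-identityʳ _) (cancel (f 0))
    go f (suc n) = begin
      c R.* f 0 R.* g (suc n) R.+
        (quotient (λ k → f (suc k) R.- c R.* f 0 R.* g (suc k)) g u * g) n
        ≈⟨ R.+-congˡ (go (λ k → f (suc k) R.- c R.* f 0 R.* g (suc k)) n) ⟩
      c R.* f 0 R.* g (suc n) R.+ (f (suc n) R.- c R.* f 0 R.* g (suc n))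
        ≈⟨ R.+-comm _ _ ⟩
      (f (suc n) R.- c R.* f 0 R.* g (suc n)) R.+ c R.* f 0 R.* g (suc n)
        ≈⟨ R.+-assoc _ _ _ ⟩
      f (suc n) R.+ (R.- (c R.* f 0 R.* g (suc n)) R.+ c R.* f 0 R.* g (suc n))
        ≈⟨ R.+-congˡ (R.-‿inverseˡ _) ⟩
      f (suc n) R.+ R.0#
        ≈⟨ R.+-identityʳ _ ⟩
      f (suc n) ∎

  private module S = CommutativeRing commutativeRing
  open Exponentiation S.semiring using (_^_)
  open RegularElements R using (unit-1; unit-*; unit-resp)

  *-unit-head : ∀ f g → Unit (f 0) → Unit (g 0) → Unit ((f * g) 0)
  *-unit-head f g uf ug = unit-resp (R.sym (*-head f g)) (unit-* uf ug)

  ^-unit-head : ∀ f → Unit (f 0) → ∀ k → Unit ((f ^ k) 0)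
  ^-unit-head f uf zero    = unit-1
  ^-unit-head f uf (suc k) = *-unit-head f (f ^ k) uf (^-unit-head f uf k)

  [1-X]-head : (1# S.- X) 0 R.≈ R.1#
  [1-X]-head = R.trans (R.+-congˡ ε⁻¹≈ε) (R.+-identityʳ R.1#)
    where open AbelianGroupProperties R.+-abelianGroup using (ε⁻¹≈ε)

  [1-X]^-head : ∀ k → ((1# S.- X) ^ k) 0 R.≈ R.1#
  [1-X]^-head zero    = R.refl
  [1-X]^-head (suc k) = begin
    ((1# S.- X) * (1# S.- X) ^ k) 0           ≈⟨ *-head (1# S.- X) ((1# S.- X) ^ k) ⟩
    (1# S.- X) 0 R.* ((1# S.- X) ^ k) 0       ≈⟨ R.*-cong [1-X]-head ([1-X]^-head k) ⟩
    R.1# R.* R.1#                             ≈⟨ R.*-identityˡ R.1# ⟩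
    R.1#                                      ∎

  [1-X]^-unit-head : ∀ k → Unit (((1# S.- X) ^ k) 0)
  [1-X]^-unit-head k = unit-resp (R.sym ([1-X]^-head k)) unit-1

  1-a[1-X]^-unit-head : ∀ a → Unit (R.1# R.- a) →
    ∀ k → Unit ((1# S.- constant a * (1# S.- X) ^ k) 0)
  1-a[1-X]^-unit-head a ua k = unit-resp (R.+-congˡ (R.-‿cong (begin
    a                                         ≈⟨ R.*-identityʳ a ⟨
    a R.* R.1#                                ≈⟨ R.*-congˡ ([1-X]^-head k) ⟨
    a R.* ((1# S.- X) ^ k) 0                  ≈⟨ *-head (constant a) ((1# S.- X) ^ k) ⟨
    (constant a * (1# S.- X) ^ k) 0           ∎))) ua

  open RegularElements commutativeRing using (Regular)

  regular-head : ∀ f → Regularᴿ (f 0) → Regular f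
  regular-head f rf g fg≈0 n = go n g fg≈0
    where
    go : ∀ n g → f * g ≈ 0# → g n R.≈ R.0#
    go zero    g e = rf (g 0) (R.trans (R.sym (*-head f g)) (e 0))
    go (suc n) g e = go n (shift g) λ k → begin
      (f * shift g) k                           ≈⟨ R.+-identityʳ _ ⟨
      (f * shift g) k R.+ R.0#                  ≈⟨ R.+-congˡ (R.zeroʳ _) ⟨
      (f * shift g) k R.+ f (suc k) R.* R.0#    ≈⟨ R.+-congˡ (R.*-congˡ (go 0 g e)) ⟨
      (f * shift g) k R.+ f (suc k) R.* g 0     ≈⟨ *-snoc f g k ⟨
      (f * g) (suc k)                           ≈⟨ e (suc k) ⟩
      R.0#                                      ∎

  regular-X : Regular X
  regular-X g e n = begin
    g n                          ≈⟨ *-identityˡ g n ⟨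
    (1# * g) n                   ≈⟨ *-cong {1#} {shift X} {g} {g} one (λ _ → R.refl) n ⟩
    (shift X * g) n      ≈⟨ R.+-identityˡ _ ⟨
    R.0# R.+ (shift X * g) n
      ≈⟨ R.+-congʳ (R.zeroˡ _) ⟨
    (X * g) (suc n)      ≈⟨ e (suc n) ⟩
    R.0#                         ∎
    where
    one : 1# ≈ shift X
    one zero    = R.refl
    one (suc n) = R.refl

module Polynomials (R : CommutativeRing 0ℓ 0ℓ) where
  private
    module R = CommutativeRing R
    module S = FormalPowerSeries R
    module SR = CommutativeRing S.commutativeRing
  open RegularElements R using () renaming (Regular to Regularᴿ)

  record Polynomial : Set where
    constructor polynomial
    field
      coeff    : ℕ → R.Carrier
      bound    : ℕ
      vanishes : ∀ n → bound ℕ.≤ n → coeff n R.≈ R.0#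

  open Polynomial public

  infix 4 _≈_

  _≈_ : Polynomial → Polynomial → Set
  p ≈ q = coeff p S.≈ coeff q

  private
    *-vanishes : ∀ f g b d → (∀ n → b ℕ.≤ n → f n R.≈ R.0#) →
                 (∀ n → d ℕ.≤ n → g n R.≈ R.0#) →
                 ∀ n → b ℕ.+ d ℕ.≤ n → (f S.* g) n R.≈ R.0#
    *-vanishes f g zero d f0 g0 n _ =
      SR.trans {f S.* g} {S.0# S.* g} {S.0#}
        (S.*-cong {f} {S.0#} {g} {g} (λ k → f0 k ℕ.z≤n) (λ _ → R.refl))
        (S.0*-zero g) n
    *-vanishes f g (suc b) d f0 g0 (suc n) (s≤s le) =
      R.trans
        (R.+-cong
          (R.trans (R.*-congˡ (g0 (suc n)
                     (ℕₚ.m≤n⇒m≤1+n (ℕₚ.≤-trans (ℕₚ.m≤n+m d b) le))))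
                   (R.zeroʳ _))
          (*-vanishes (S.shift f) g b d (λ k le′ → f0 (suc k) (s≤s le′)) g0 n le))
        (R.+-identityʳ _)

  constant : R.Carrier → Polynomial
  constant a = polynomial (S.constant a) 1 λ { (suc n) _ → R.refl }

  X : Polynomial
  X = polynomial S.X 2
    λ { (suc zero) (s≤s ()) ; (suc (suc n)) _ → R.refl }

  commutativeRing : CommutativeRing 0ℓ 0ℓ
  commutativeRing = record
    { Carrier = Polynomial
    ; _≈_     = _≈_
    ; _+_     = λ p q → polynomial (coeff p S.+ coeff q) (bound p ℕ.+ bound q)
        λ n le → R.trans
          (R.+-cong (vanishes p n (ℕₚ.m+n≤o⇒m≤o (bound p) le))
                    (vanishes q n (ℕₚ.m+n≤o⇒n≤o (bound p) le)))
          (R.+-identityʳ _)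
    ; _*_     = λ p q → polynomial (coeff p S.* coeff q) (bound p ℕ.+ bound q)
        (*-vanishes (coeff p) (coeff q) (bound p) (bound q)
                    (vanishes p) (vanishes q))
    ; -_      = λ p → polynomial (S.- coeff p) (bound p)
        λ n le → R.trans (R.-‿cong (vanishes p n le)) ε⁻¹≈ε
    ; 0#      = polynomial S.0# 0 (λ _ _ → R.refl)
    ; 1#      = constant R.1#
    ; isCommutativeRing = record
      { isRing = record
        { +-isAbelianGroup = record
          { isGroup = record
            { isMonoid = record
              { isSemigroup = record
                { isMagma = record
                  { isEquivalence = record
                    { refl  = λ n → R.refl
                    ; sym   = λ p n → R.sym (p n)
                    ; trans = λ p q n → R.trans (p n) (q n)
                    }
                  ; ∙-cong = λ p q n → R.+-cong (p n) (q n)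
                  }
                ; assoc = λ p q r → SR.+-assoc (coeff p) (coeff q) (coeff r)
                }
              ; identity = (λ p → SR.+-identityˡ (coeff p))
                         , (λ p → SR.+-identityʳ (coeff p))
              }
            ; inverse = (λ p → SR.-‿inverseˡ (coeff p))
                      , (λ p → SR.-‿inverseʳ (coeff p))
            ; ⁻¹-cong = λ p n → R.-‿cong (p n)
            }
          ; comm = λ p q → SR.+-comm (coeff p) (coeff q)
          }
        ; *-cong = λ {p} {q} {r} {s} →
            S.*-cong {coeff p} {coeff q} {coeff r} {coeff s}
        ; *-assoc = λ p q r → SR.*-assoc (coeff p) (coeff q) (coeff r)
        ; *-identity = (λ p → SR.*-identityˡ (coeff p))
                     , (λ p → SR.*-identityʳ (coeff p))
        ; distrib = (λ p q r → SR.distribˡ (coeff p) (coeff q) (coeff r))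
                  , (λ p q r → SR.distribʳ (coeff p) (coeff q) (coeff r))
        }
      ; *-comm = λ p q → SR.*-comm (coeff p) (coeff q)
      }
    }
    where open AbelianGroupProperties R.+-abelianGroup using (ε⁻¹≈ε)

  open RegularElements commutativeRing using (Regular)

  regular-head : ∀ p → Regularᴿ (coeff p 0) → Regular p
  regular-head p rp q = S.regular-head (coeff p) rp (coeff q)

  regular-X : Regular X
  regular-X q = S.regular-X (coeff q)

-- The total ring of fractions; for an integral domain, its field of fractions.
module Fractions (R : CommutativeRing 0ℓ 0ℓ) where
  private module R = CommutativeRing R
  open RegularElements R
  open RingProperties R.ring
    using (-‿distribˡ-*; -‿distribʳ-*; x≈y⇒x∙y⁻¹≈ε; x∙y⁻¹≈ε⇒x≈y)
  open SetoidReasoning R.setoid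
  open SemiringSolver R.commutativeSemiring
    using (solve; _:=_; _:+_; _:*_; con)

  record Fraction : Set where
    constructor fraction
    field
      num         : R.Carrier
      den         : R.Carrier
      den-regular : Regular den

  open Fraction public

  infix 4 _≈_

  _≈_ : Fraction → Fraction → Set
  a ≈ b = num a R.* den b R.≈ num b R.* den a

  embed : R.Carrier → Fraction
  embed r = fraction r R.1# regular-1

  private
    cancel : ∀ {c} → Regular c → ∀ {a b} → c R.* a R.≈ c R.* b → a R.≈ b
    cancel {c} rc {a} {b} e = x∙y⁻¹≈ε⇒x≈y a b (rc (a R.- b) (begin
      c R.* (a R.- b)                   ≈⟨ R.distribˡ _ _ _ ⟩
      c R.* a R.+ c R.* (R.- b)         ≈⟨ R.+-congˡ (-‿distribʳ-* c b) ⟨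
      c R.* a R.- c R.* b               ≈⟨ x≈y⇒x∙y⁻¹≈ε e ⟩
      R.0#                              ∎))

    ≈-trans : ∀ {a b c} → a ≈ b → b ≈ c → a ≈ c
    ≈-trans {a} {b} {c} p q = cancel (den-regular b) (begin
      den b R.* (num a R.* den c)
        ≈⟨ solve 3 (λ x y z → x :* (y :* z) := (y :* x) :* z) R.refl _ _ _ ⟩
      num a R.* den b R.* den c
        ≈⟨ R.*-congʳ p ⟩
      num b R.* den a R.* den c
        ≈⟨ solve 3 (λ x y z → x :* y :* z := (x :* z) :* y) R.refl _ _ _ ⟩
      num b R.* den c R.* den a
        ≈⟨ R.*-congʳ q ⟩
      num c R.* den b R.* den a
        ≈⟨ solve 3 (λ x y z → x :* y :* z := y :* (x :* z)) R.refl _ _ _ ⟩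
      den b R.* (num c R.* den a) ∎)

    +-cong : ∀ {a b c d} → a ≈ b → c ≈ d →
             (num a R.* den c R.+ num c R.* den a) R.* (den b R.* den d) R.≈
             (num b R.* den d R.+ num d R.* den b) R.* (den a R.* den c)
    +-cong {a} {b} {c} {d} p q = begin
      (num a R.* den c R.+ num c R.* den a) R.* (den b R.* den d)
        ≈⟨ solve 6 (λ na da nc dc db dd →
              (na :* dc :+ nc :* da) :* (db :* dd) :=
              (na :* db) :* (dc :* dd) :+ (nc :* dd) :* (da :* db))
             R.refl (num a) (den a) (num c) (den c) (den b) (den d) ⟩
      num a R.* den b R.* (den c R.* den d) R.+ num c R.* den d R.* (den a R.* den b)
        ≈⟨ R.+-cong (R.*-congʳ p) (R.*-congʳ q) ⟩
      num b R.* den a R.* (den c R.* den d) R.+ num d R.* den c R.* (den a R.* den b)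
        ≈⟨ solve 6 (λ nb da nd dc db dd →
              (nb :* da) :* (dc :* dd) :+ (nd :* dc) :* (da :* db) :=
              (nb :* dd :+ nd :* db) :* (da :* dc))
             R.refl (num b) (den a) (num d) (den c) (den b) (den d) ⟩
      (num b R.* den d R.+ num d R.* den b) R.* (den a R.* den c) ∎

    -‿cong : ∀ {a b} → a ≈ b → (R.- num a) R.* den b R.≈ (R.- num b) R.* den a
    -‿cong {a} {b} p = begin
      (R.- num a) R.* den b    ≈⟨ -‿distribˡ-* _ _ ⟨
      R.- (num a R.* den b)    ≈⟨ R.-‿cong p ⟩
      R.- (num b R.* den a)    ≈⟨ -‿distribˡ-* _ _ ⟩
      (R.- num b) R.* den a    ∎

    -‿inverse : ∀ a → (num a R.* den a R.+ (R.- num a) R.* den a) R.* R.1# R.≈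
                      R.0# R.* (den a R.* den a)
    -‿inverse a = begin
      (num a R.* den a R.+ (R.- num a) R.* den a) R.* R.1#
        ≈⟨ R.*-identityʳ _ ⟩
      num a R.* den a R.+ (R.- num a) R.* den a
        ≈⟨ R.+-congˡ (-‿distribˡ-* _ _) ⟨
      num a R.* den a R.- num a R.* den a
        ≈⟨ R.-‿inverseʳ _ ⟩
      R.0#
        ≈⟨ R.zeroˡ _ ⟨
      R.0# R.* (den a R.* den a) ∎

  commutativeRing : CommutativeRing 0ℓ 0ℓ
  commutativeRing = record
    { Carrier = Fraction
    ; _≈_     = _≈_
    ; _+_     = λ a b → fraction (num a R.* den b R.+ num b R.* den a)
                          (den a R.* den b)
                          (regular-* (den-regular a) (den-regular b))
    ; _*_     = λ a b → fraction (num a R.* num b) (den a R.* den b)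
                          (regular-* (den-regular a) (den-regular b))
    ; -_      = λ a → fraction (R.- num a) (den a) (den-regular a)
    ; 0#      = embed R.0#
    ; 1#      = embed R.1#
    ; isCommutativeRing = record
      { isRing = record
        { +-isAbelianGroup = record
          { isGroup = record
            { isMonoid = record
              { isSemigroup = record
                { isMagma = record
                  { isEquivalence = record
                    { refl  = R.refl
                    ; sym   = R.sym
                    ; trans = λ {a} {b} {c} → ≈-trans {a} {b} {c}
                    }
                  ; ∙-cong = λ {a} {b} {c} {d} → +-cong {a} {b} {c} {d}
                  }
                ; assoc = λ a b c → solve 6 (λ na da nb db nc dc →
                      ((na :* db :+ nb :* da) :* dc :+ nc :* (da :* db))
                        :* (da :* (db :* dc)) :=
                      (na :* (db :* dc) :+ (nb :* dc :+ nc :* db) :* da)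
                        :* ((da :* db) :* dc))
                    R.refl (num a) (den a) (num b) (den b) (num c) (den c)
                }
              ; identity =
                    (λ a → solve 2 (λ n d →
                       (con 0 :* d :+ n :* con 1) :* d := n :* (con 1 :* d))
                       R.refl (num a) (den a))
                  , (λ a → solve 2 (λ n d →
                       (n :* con 1 :+ con 0 :* d) :* d := n :* (d :* con 1))
                       R.refl (num a) (den a))
              }
            ; inverse =
                (λ a → R.trans (R.*-congʳ (R.+-comm _ _)) (-‿inverse a))
              , -‿inverse
            ; ⁻¹-cong = λ {a} {b} → -‿cong {a} {b}
            }
          ; comm = λ a b → solve 4 (λ na da nb db →
                (na :* db :+ nb :* da) :* (db :* da) :=
                (nb :* da :+ na :* db) :* (da :* db))
              R.refl (num a) (den a) (num b) (den b)
          }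
        ; *-cong = λ {a} {b} {c} {d} p q → begin
            num a R.* num c R.* (den b R.* den d)
              ≈⟨ solve 4 (λ x y z w → x :* y :* (z :* w) := (x :* z) :* (y :* w))
                   R.refl _ _ _ _ ⟩
            num a R.* den b R.* (num c R.* den d)
              ≈⟨ R.*-cong p q ⟩
            num b R.* den a R.* (num d R.* den c)
              ≈⟨ solve 4 (λ x y z w → x :* y :* (z :* w) := (x :* z) :* (y :* w))
                   R.refl _ _ _ _ ⟩
            num b R.* num d R.* (den a R.* den c) ∎
        ; *-assoc = λ a b c → solve 6 (λ na da nb db nc dc →
              ((na :* nb) :* nc) :* (da :* (db :* dc)) :=
              (na :* (nb :* nc)) :* ((da :* db) :* dc))
            R.refl (num a) (den a) (num b) (den b) (num c) (den c)
        ; *-identity =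
              (λ a → solve 2 (λ n d → (con 1 :* n) :* d := n :* (con 1 :* d))
                 R.refl (num a) (den a))
            , (λ a → solve 2 (λ n d → (n :* con 1) :* d := n :* (d :* con 1))
                 R.refl (num a) (den a))
        ; distrib =
              (λ a b c → solve 6 (λ na da nb db nc dc →
                 (na :* (nb :* dc :+ nc :* db)) :* ((da :* db) :* (da :* dc)) :=
                 ((na :* nb) :* (da :* dc) :+ (na :* nc) :* (da :* db))
                   :* (da :* (db :* dc)))
                 R.refl (num a) (den a) (num b) (den b) (num c) (den c))
            , (λ a b c → solve 6 (λ na da nb db nc dc →
                 ((nb :* dc :+ nc :* db) :* na) :* ((db :* da) :* (dc :* da)) :=
                 ((nb :* na) :* (dc :* da) :+ (nc :* na) :* (db :* da))
                   :* ((db :* dc) :* da))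
                 R.refl (num a) (den a) (num b) (den b) (num c) (den c))
        }
      ; *-comm = λ a b → solve 4 (λ na da nb db →
            (na :* nb) :* (db :* da) := (nb :* na) :* (da :* db))
          R.refl (num a) (den a) (num b) (den b)
      }
    }

  private module F = CommutativeRing commutativeRing
  open RegularElements commutativeRing using () renaming (Unit to Unitᶠ)

  unit : ∀ a → Regular (num a) → Unitᶠ a
  unit a ra = fraction (den a) (num a) ra ,
    solve 2 (λ n d → (d :* n) :* con 1 := con 1 :* (n :* d)) R.refl (num a) (den a)

  1-embed-unit : ∀ r → Regular (R.1# R.- r) → Unitᶠ (F.1# F.- embed r)
  1-embed-unit r rr = unit (F.1# F.- embed r)
    (regular-resp (R.+-cong (R.sym (R.*-identityʳ _)) (R.sym (R.*-identityʳ _))) rr)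

module MiddleTerms (R : CommutativeRing 0ℓ 0ℓ)
  (x u [u-1]⁻¹ : CommutativeRing.Carrier R)
  (1-x-unit : RegularElements.Unit R
                (CommutativeRing._-_ R (CommutativeRing.1# R) x))
  (u-unit : RegularElements.Unit R u) where

  private
    module S = FormalPowerSeries R
    module T = CommutativeRing S.commutativeRing
  open Exponentiation T.semiring using (_^_)
  open RegularElements R using (Unit)

  q : T.Carrier
  q = T.1# T.- S.X

  factor : ℕ → T.Carrier
  factor j = T.1# T.- S.constant x T.* q ^ j

  numerator denominator : ℕ → T.Carrier
  numerator   k = S.X T.* q ^ k T.* S.constant [u-1]⁻¹
  denominator k = S.constant u ^ suc k T.* (factor k T.* factor (suc k))

  denominator-unit : ∀ k → Unit (denominator k 0)
  denominator-unit k =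
    S.*-unit-head (S.constant u ^ suc k) (factor k T.* factor (suc k))
      (S.^-unit-head (S.constant u) u-unit (suc k))
      (S.*-unit-head (factor k) (factor (suc k)) (factor-unit k) (factor-unit (suc k)))
    where
    factor-unit : ∀ j → Unit (factor j 0)
    factor-unit = S.1-a[1-X]^-unit-head x 1-x-unit

  -- The summand of index n = k + 1.
  term : ℕ → T.Carrier
  term k = S.quotient (numerator k) (denominator k) (denominator-unit k)

descents : ∀ {n} → Permutation′ n → ℕ
descents {zero}  π = 0
descents {suc n} π =
  length (filter (λ i → (π ⟨$⟩ʳ Fin.suc i) Finₚ.<? (π ⟨$⟩ʳ inject₁ i)) (allFin n))

inverseDescents : ∀ {n} → Permutation′ n → ℕ
inverseDescents π = descents (Perm.flip π)

permutations : ∀ n → List (Permutation′ n)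
permutations zero    = Perm.id ∷ []
permutations (suc n) =
  cartesianProductWith (insert Fin.zero) (allFin (suc n)) (permutations n)

permutationSetoid : ℕ → Setoid 0ℓ 0ℓ
permutationSetoid n = record
  { Carrier = Permutation′ n
  ; _≈_ = Perm._≈_
  ; isEquivalence = record
    { refl  = λ i → ≡.refl
    ; sym   = λ p i → ≡.sym (p i)
    ; trans = λ p q i → ≡.trans (p i) (q i)
    }
  }

-- permutations-complete and permutations-unique: each element of the
-- symmetric group occurs exactly once, up to pointwise equality.
permutations-complete : ∀ n (π : Permutation′ n) →
  SetoidMembership._∈_ (permutationSetoid n) π (permutations n)
permutations-complete zero    π = here λ ()
permutations-complete (suc n) π =
  SetoidMembershipₚ.∈-resp-≈ (permutationSetoid (suc n))
    {permutations (suc n)}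
    {insert Fin.zero (π ⟨$⟩ʳ Fin.zero) (remove Fin.zero π)} {π}
    (Perm.insert-remove Fin.zero π)
    (SetoidMembershipₚ.∈-cartesianProductWith⁺
      (≡.setoid (Fin (suc n))) (permutationSetoid n) (permutationSetoid (suc n))
      {insert Fin.zero}
      (λ { {i} {j} {ρ} {σ} ≡.refl p Fin.zero    → ≡.refl
         ; {i} {j} {ρ} {σ} ≡.refl p (Fin.suc k) → ≡.cong (Fin.punchIn i) (p k) })
      {allFin (suc n)} {permutations n}
      (∈ₚ.∈-allFin (π ⟨$⟩ʳ Fin.zero))
      (permutations-complete n (remove Fin.zero π)))

permutations-unique : ∀ n →
  SetoidUnique.Unique (permutationSetoid n) (permutations n)
permutations-unique zero    = [] AllPairs.∷ AllPairs.[]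
permutations-unique (suc n) =
  SetoidUniqueₚ.cartesianProductWith⁺
    (≡.setoid (Fin (suc n))) (permutationSetoid n) (permutationSetoid (suc n))
    (insert Fin.zero) injective
    (Uniqueₚ.allFin⁺ (suc n)) (permutations-unique n)
  where
  injective : ∀ {i j} {ρ σ : Permutation′ n} →
              insert Fin.zero i ρ Perm.≈ insert Fin.zero j σ →
              i ≡ j × ρ Perm.≈ σ
  injective {i} {j} {ρ} {σ} e with e Fin.zero
  ... | ≡.refl = ≡.refl , λ k → Finₚ.punchIn-injective i _ _ (e (Fin.suc k))

ℤ-ring ℤ[x] ℤ[x,u] : CommutativeRing 0ℓ 0ℓ
ℤ-ring = ℤₚ.+-*-commutativeRing
ℤ[x]   = Polynomials.commutativeRing ℤ-ring
ℤ[x,u] = Polynomials.commutativeRing ℤ[x]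

ℚ⟨x,u⟩ : CommutativeRing 0ℓ 0ℓ
ℚ⟨x,u⟩ = Fractions.commutativeRing ℤ[x,u]

ℤ⟦t⟧ ℚ⟨x,u⟩⟦t⟧ ℤ⟦x⟧ ℤ⟦x,u⟧ : CommutativeRing 0ℓ 0ℓ
ℤ⟦t⟧       = FormalPowerSeries.commutativeRing ℤ-ring
ℚ⟨x,u⟩⟦t⟧  = FormalPowerSeries.commutativeRing ℚ⟨x,u⟩
ℤ⟦x⟧       = FormalPowerSeries.commutativeRing ℤ-ring
ℤ⟦x,u⟧     = FormalPowerSeries.commutativeRing ℤ⟦x⟧

private
  module ℤx   = CommutativeRing ℤ[x]
  module P    = CommutativeRing ℤ[x,u]
  module F    = CommutativeRing ℚ⟨x,u⟩
  module Fr   = Fractions ℤ[x,u]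
  module Px   = Polynomials ℤ-ring
  module Pu   = Polynomials ℤ[x]
  module T    = CommutativeRing ℚ⟨x,u⟩⟦t⟧
  module FT   = FormalPowerSeries ℚ⟨x,u⟩
  module Z    = CommutativeRing ℤ⟦t⟧
  module ZT   = FormalPowerSeries ℤ-ring
  module XU   = CommutativeRing ℤ⟦x,u⟧
  module RegZ = RegularElements ℤ-ring
  module Regx = RegularElements ℤ[x]
  module RegP = RegularElements ℤ[x,u]
  module RegF = RegularElements ℚ⟨x,u⟩
  open Exponentiation P.semiring using () renaming (_^_ to _^ᴾ_)
  open Exponentiation T.semiring using () renaming (_^_ to _^ᵀ_)
  open Exponentiation Z.semiring using () renaming (_^_ to _^ᶻ_)
  open Summation F.semiring using (sum)

xᴾ uᴾ : P.Carrier
xᴾ = Pu.constant Px.X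
uᴾ = Pu.X

1-x-regular : RegP.Regular (P.1# P.- xᴾ)
1-x-regular = Pu.regular-head (P.1# P.- xᴾ)
  (Px.regular-head (ℤx.1# ℤx.- Px.X) RegZ.regular-1)

1-u-regular : RegP.Regular (P.1# P.- uᴾ)
1-u-regular = Pu.regular-head (P.1# P.- uᴾ)
  (Regx.regular-resp {ℤx.1#} {ℤx.1# ℤx.- ℤx.0#}
    (λ { zero → ≡.refl ; (suc n) → ≡.refl }) Regx.regular-1)

u-1-regular : RegP.Regular (uᴾ P.- P.1#)
u-1-regular = Pu.regular-head (uᴾ P.- P.1#)
  (Regx.regular-resp {ℤx.- ℤx.1#} {ℤx.0# ℤx.- ℤx.1#}
    (λ { zero → ≡.refl ; (suc n) → ≡.refl })
    (Regx.regular-neg {ℤx.1#} Regx.regular-1))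

x-1-regular : RegP.Regular (xᴾ P.- P.1#)
x-1-regular = Pu.regular-head (xᴾ P.- P.1#)
  (Px.regular-head (Px.X ℤx.- ℤx.1#) (RegZ.regular-neg {1ℤ} RegZ.regular-1))

-- The numerator Σ_π u^des(π) x^ides(π), with eulerianSeries dividing it by
-- (1 - u)ⁿ⁺¹ (1 - x)ⁿ⁺¹.
eulerian : ℕ → P.Carrier
eulerian n = foldr P._+_ P.0#
  (map (λ π → uᴾ ^ᴾ descents π P.* xᴾ ^ᴾ inverseDescents π) (permutations n))

eulerianSeries : T.Carrier
eulerianSeries n = Fr.fraction (eulerian n)
  ((P.1# P.- uᴾ) ^ᴾ suc n P.* (P.1# P.- xᴾ) ^ᴾ suc n)
  (RegP.regular-* {(P.1# P.- uᴾ) ^ᴾ suc n} {(P.1# P.- xᴾ) ^ᴾ suc n}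
    (RegP.regular-^ {P.1# P.- uᴾ} 1-u-regular (suc n))
    (RegP.regular-^ {P.1# P.- xᴾ} 1-x-regular (suc n)))

1-x-unit : RegF.Unit (F.1# F.- Fr.embed xᴾ)
1-x-unit = Fr.1-embed-unit xᴾ 1-x-regular

u-unit : RegF.Unit (Fr.embed uᴾ)
u-unit = Fr.unit (Fr.embed uᴾ) Pu.regular-X

1/⟨u-1⟩ 1/⟨u-1⟩⟨x-1⟩ : F.Carrier
1/⟨u-1⟩ = Fr.fraction P.1# (uᴾ P.- P.1#) u-1-regular
1/⟨u-1⟩⟨x-1⟩ = Fr.fraction P.1# ((uᴾ P.- P.1#) P.* (xᴾ P.- P.1#))
  (RegP.regular-* {uᴾ P.- P.1#} {xᴾ P.- P.1#} u-1-regular x-1-regular)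

module Middle = MiddleTerms ℚ⟨x,u⟩ (Fr.embed xᴾ) (Fr.embed uᴾ) 1/⟨u-1⟩ 1-x-unit u-unit

constantTerm : T.Carrier
constantTerm = FT.constant 1/⟨u-1⟩⟨x-1⟩

-- r lies in u⁻ᴺ ℚ(x)⟦u⁻¹⟧: for some representative s of r,
-- deg_u (den s) ≥ d ≥ deg_u (num s) + N.
InfinityOrder≥ : ℕ → F.Carrier → Set
InfinityOrder≥ N r = Σ[ s ∈ F.Carrier ] r F.≈ s × (∃[ d ]
  ¬ (Pu.coeff (Fr.den s) d ℤx.≈ ℤx.0#) ×
  (∀ e → d ℕ.< e ℕ.+ N → Pu.coeff (Fr.num s) e ℤx.≈ ℤx.0#))

-- f 0 + f 1 + … converges to s in the u⁻¹-adic topology of ℚ(x)((u⁻¹)).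
SumsInPowersOfu⁻¹ : (ℕ → F.Carrier) → F.Carrier → Set
SumsInPowersOfu⁻¹ f s = ∀ N → ∃[ K₀ ] ∀ K → K₀ ℕ.≤ K →
  InfinityOrder≥ N (s F.- sum {K} (λ k → f (toℕ k)))

-- The first index is the exponent of u, the second that of x.
toℤ⟦x,u⟧ : P.Carrier → XU.Carrier
toℤ⟦x,u⟧ p k n = Px.coeff (Pu.coeff p k) n

-- The power series S in x and u expands r, i.e. den r · S = num r.
HasExpansion : F.Carrier → (ℕ → ℕ → ℤ) → Set
HasExpansion r S = toℤ⟦x,u⟧ (Fr.den r) XU.* S XU.≈ toℤ⟦x,u⟧ (Fr.num r)

1/⟨1-t⟩^_ : ℕ → ℕ → ℤ
1/⟨1-t⟩^ j = ZT.quotient Z.1# ((Z.1# Z.- ZT.X) ^ᶻ j) (ZT.[1-X]^-unit-head j)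

-- The coefficient of tᵐ in the double series; position (k , n) holds the
-- coefficient of uᵏ xⁿ, which is the summand of index (n + 1 , k + 1).
doubleSeries : ℕ → ℕ → ℕ → ℤ
doubleSeries m k n = (1/⟨1-t⟩^ (suc k ℕ.* suc n)) m

open CommutativeRing ℚ⟨x,u⟩⟦t⟧ public
  using () renaming (Carrier to RationalSeries; _≈_ to _≈ᵀ_; _+_ to _+ᵀ_)

{-# OPTIONS --safe #-}

-- Both identities come from counting multisets of m pairs (e , w), listed in
-- lexicographic order.  The second components form a word whose standardization
-- is a permutation π; for a given π the first components are chains that may be
-- constant except at the descents of π, and the sorted words are chains that
-- may be constant except at the descents of π⁻¹.  Chains with prescribed strict
-- steps have the generating function zˢ / (1 - z)ᵐ⁺¹, s being the number of
-- strict steps, which gives the expansion in powers of x and u, because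
-- (1 - t)⁻ᵃᵇ counts multisets of an a × b rectangle.
--
-- The expansion at u = ∞ is obtained from subsets in place of multisets, with
-- strict steps at the ascents of π: (1 - t)ᵃᵇ counts them up to sign.
-- Summed against xᵇ⁻¹ this evaluates Γⱼ = qʲ / (1 - x qʲ), where q = 1 - t, and the
-- summands of the middle series are (Γₙ₋₁ - Γₙ) / ((u - 1) uⁿ).  Its partial
-- sums differ from the eulerian series by an explicit fraction, whose order at
-- u = ∞ is read off from the degrees of its numerator and denominator.

module Submission where

open import Defs
open import Level using (0ℓ)
open import Algebra.Bundles using (CommutativeRing; CommutativeSemiring; RawRing)
import Algebra.Properties.AbelianGroup as AbelianGroupProperties
import Algebra.Properties.CommutativeSemigroup as CommutativeSemigroupProperties
import Algebra.Properties.CommutativeSemiring.Exp as CommutativeExponentiation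
import Algebra.Properties.Group as GroupProperties
import Algebra.Properties.Ring as RingProperties
import Algebra.Properties.Semiring.Exp as Exponentiation
import Algebra.Properties.Semiring.Mult as Multiples
import Algebra.Properties.Semiring.Sum as Summation
import Algebra.Solver.Ring as RingSolver
open import Algebra.Solver.Ring.AlmostCommutativeRing
  using (fromCommutativeRing; _-Raw-AlmostCommutative⟶_)
import Algebra.Solver.Ring.NaturalCoefficients.Default as SemiringSolver
open import Data.Bool.Base using (Bool; true; false; not; if_then_else_)
open import Data.Fin.Base as Fin using (Fin; toℕ; punchIn; inject₁)
open import Data.Fin.Permutation as Perm using (Permutation′; _⟨$⟩ʳ_; _⟨$⟩ˡ_; insert)
import Data.Fin.Properties as Finₚ
open import Data.List.Base
  using (List; []; _∷_; _++_; map; length; replicate; foldr; tabulate; allFin; filter; cartesianProductWith)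
import Data.List.Properties as Listₚ
open import Data.Maybe.Base using (Maybe; just; nothing)
open import Data.Nat.Base as ℕ using (ℕ; zero; suc; z≤n; s≤s)
import Data.Nat.Properties as ℕₚ
open import Data.Product.Base using (Σ-syntax; _×_; _,_; proj₁; proj₂)
open import Function.Base using (_∘_; id; const)
open import Relation.Binary.PropositionalEquality as ≡ using (_≡_)
import Relation.Binary.Reasoning.Setoid as SetoidReasoning
open import Relation.Nullary.Decidable.Core using (yes; no; does)
open import Relation.Nullary.Negation.Core using (¬_)
open import Relation.Unary using (Decidable)

-- The summands of the middle series live over ℚ(x,u), whereas the summation over b takes place in
-- ℤ⟦x⟧, and neither ring maps to the other over ℤ[x]. The coefficient of tᵐ in Γⱼ, however, is a
-- polynomial over (1 - x)ᵐ⁺¹. Substituting (1 - x) t for t and multiplying by 1 - x clears all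
-- denominators at once: the equation Γⱼ = qʲ + x qʲ Γⱼ is checked for the cleared series in ℤ⟦x⟧,
-- where it is an equation between polynomials, and carried to ℚ(x,u), where the substitution is
-- undone. Summation by parts turns the first K summands into Γ₀ / (u - 1) - Σ Γⱼ / uʲ⁺¹ - Γ_K / ((u
-- - 1) uᴷ), with j < K in the sum. Since Γ₀ = 1 / (1 - x), the added constant 1 / ((u - 1)(x - 1))
-- cancels the first term. The strict steps have to be at the ascents because at z = 1/u the
-- fraction zˢ / (1 - z)ᵐ⁺¹, divided by u, becomes uᵐ⁻ˢ / (u - 1)ᵐ⁺¹, whose exponent counts the weak
-- steps.

module ListSums (S : CommutativeSemiring 0ℓ 0ℓ) where
  private module S = CommutativeSemiring S
  open CommutativeSemigroupProperties S.+-commutativeSemigroup using (interchange)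

  ∑ᴸ : ∀ {A : Set} → List A → (A → S.Carrier) → S.Carrier
  ∑ᴸ xs f = foldr S._+_ S.0# (map f xs)

  module _ {A : Set} where

    ∑ᴸ-cong : ∀ (xs : List A) {f g : A → S.Carrier} → (∀ x → f x S.≈ g x) → ∑ᴸ xs f S.≈ ∑ᴸ xs g
    ∑ᴸ-cong []       e = S.refl
    ∑ᴸ-cong (x ∷ xs) e = S.+-cong (e x) (∑ᴸ-cong xs e)

    ∑ᴸ-zero : ∀ (xs : List A) → ∑ᴸ xs (λ _ → S.0#) S.≈ S.0#
    ∑ᴸ-zero []       = S.refl
    ∑ᴸ-zero (x ∷ xs) = S.trans (S.+-identityˡ _) (∑ᴸ-zero xs)

    ∑ᴸ-distrib : ∀ (xs : List A) (f g : A → S.Carrier) →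
      ∑ᴸ xs (λ x → f x S.+ g x) S.≈ ∑ᴸ xs f S.+ ∑ᴸ xs g
    ∑ᴸ-distrib []       f g = S.sym (S.+-identityˡ S.0#)
    ∑ᴸ-distrib (x ∷ xs) f g =
      S.trans (S.+-congˡ (∑ᴸ-distrib xs f g)) (interchange (f x) (g x) _ _)

    *-distribˡ-∑ᴸ : ∀ (xs : List A) a (f : A → S.Carrier) →
      a S.* ∑ᴸ xs f S.≈ ∑ᴸ xs (λ x → a S.* f x)
    *-distribˡ-∑ᴸ []       a f = S.zeroʳ a
    *-distribˡ-∑ᴸ (x ∷ xs) a f =
      S.trans (S.distribˡ a (f x) _) (S.+-congˡ (*-distribˡ-∑ᴸ xs a f))

    ∑ᴸ-++ : ∀ (xs ys : List A) (f : A → S.Carrier) → ∑ᴸ (xs ++ ys) f S.≈ ∑ᴸ xs f S.+ ∑ᴸ ys f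
    ∑ᴸ-++ []       ys f = S.sym (S.+-identityˡ _)
    ∑ᴸ-++ (x ∷ xs) ys f = S.trans (S.+-congˡ (∑ᴸ-++ xs ys f)) (S.sym (S.+-assoc _ _ _))

  ∑ᴸ-swap : ∀ {A B : Set} (xs : List A) (ys : List B) (f : A → B → S.Carrier) →
    ∑ᴸ xs (λ x → ∑ᴸ ys (f x)) S.≈ ∑ᴸ ys (λ y → ∑ᴸ xs (λ x → f x y))
  ∑ᴸ-swap []       ys f = S.sym (∑ᴸ-zero ys)
  ∑ᴸ-swap (x ∷ xs) ys f =
    S.trans (S.+-congˡ (∑ᴸ-swap xs ys f)) (S.sym (∑ᴸ-distrib ys (f x) _))

  ∑ᴸ-map : ∀ {A B : Set} (h : A → B) xs (f : B → S.Carrier) → ∑ᴸ (map h xs) f S.≈ ∑ᴸ xs (f ∘ h)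
  ∑ᴸ-map h []       f = S.refl
  ∑ᴸ-map h (x ∷ xs) f = S.+-congˡ (∑ᴸ-map h xs f)

  ∑ᴸ-cartesianProductWith : ∀ {A B C : Set} (h : A → B → C) xs ys (f : C → S.Carrier) →
    ∑ᴸ (cartesianProductWith h xs ys) f S.≈ ∑ᴸ xs (λ x → ∑ᴸ ys (λ y → f (h x y)))
  ∑ᴸ-cartesianProductWith h []       ys f = S.refl
  ∑ᴸ-cartesianProductWith h (x ∷ xs) ys f =
    S.trans (∑ᴸ-++ (map (h x) ys) _ f)
            (S.+-cong (∑ᴸ-map (h x) ys f) (∑ᴸ-cartesianProductWith h xs ys f))

module Combinatorics where
  open import Data.Nat.Base using (_+_; _*_; _∸_; _<ᵇ_; _≤_; _<_)
  open import Data.Nat.Properties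
  open import Relation.Binary.PropositionalEquality
    using (refl; sym; trans; cong; cong₂; module ≡-Reasoning)
  open CommutativeSemigroupProperties +-commutativeSemigroup using (interchange)
  open ListSums +-*-commutativeSemiring
  open ≡-Reasoning

  -- Finite sums of natural numbers

  ∑ : ℕ → (ℕ → ℕ) → ℕ
  ∑ zero    f = 0
  ∑ (suc n) f = f 0 + ∑ n (f ∘ suc)

  ∑-cong< : ∀ n {f g : ℕ → ℕ} → (∀ {v} → v < n → f v ≡ g v) → ∑ n f ≡ ∑ n g
  ∑-cong< zero    e = refl
  ∑-cong< (suc n) e = cong₂ _+_ (e (s≤s z≤n)) (∑-cong< n (e ∘ s≤s))

  ∑-cong : ∀ n {f g : ℕ → ℕ} → (∀ v → f v ≡ g v) → ∑ n f ≡ ∑ n g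
  ∑-cong n e = ∑-cong< n λ {v} _ → e v

  ∑-zero : ∀ n → ∑ n (const 0) ≡ 0
  ∑-zero zero    = refl
  ∑-zero (suc n) = ∑-zero n

  ∑-distrib : ∀ n (f g : ℕ → ℕ) → ∑ n (λ v → f v + g v) ≡ ∑ n f + ∑ n g
  ∑-distrib zero    f g = refl
  ∑-distrib (suc n) f g =
    trans (cong (f 0 + g 0 +_) (∑-distrib n (f ∘ suc) (g ∘ suc)))
          (interchange (f 0) (g 0) _ _)

  ∑-swap : ∀ m n (f : ℕ → ℕ → ℕ) → ∑ m (λ v → ∑ n (f v)) ≡ ∑ n (λ w → ∑ m (λ v → f v w))
  ∑-swap zero    n f = sym (∑-zero n)
  ∑-swap (suc m) n f =
    trans (cong (∑ n (f 0) +_) (∑-swap m n (f ∘ suc))) (sym (∑-distrib n _ _))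

  *-distribˡ-∑ : ∀ n a (f : ℕ → ℕ) → a * ∑ n f ≡ ∑ n (λ v → a * f v)
  *-distribˡ-∑ zero    a f = *-zeroʳ a
  *-distribˡ-∑ (suc n) a f =
    trans (*-distribˡ-+ a (f 0) _) (cong (a * f 0 +_) (*-distribˡ-∑ n a (f ∘ suc)))

  ∑-snoc : ∀ n (f : ℕ → ℕ) → ∑ (suc n) f ≡ ∑ n f + f n
  ∑-snoc zero    f = +-comm (f 0) 0
  ∑-snoc (suc n) f =
    trans (cong (f 0 +_) (∑-snoc n (f ∘ suc))) (sym (+-assoc (f 0) _ _))

  ∑-+ : ∀ m n (f : ℕ → ℕ) → ∑ (m + n) f ≡ ∑ m f + ∑ n (λ v → f (m + v))
  ∑-+ zero    n f = refl
  ∑-+ (suc m) n f =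
    trans (cong (f 0 +_) (∑-+ m n (f ∘ suc))) (sym (+-assoc (f 0) _ _))

  ∑-blocks : ∀ m n (f : ℕ → ℕ) → ∑ m (λ i → ∑ n (λ j → f (i * n + j))) ≡ ∑ (m * n) f
  ∑-blocks zero    n f = refl
  ∑-blocks (suc m) n f = begin
    ∑ n f + ∑ m (λ i → ∑ n (λ j → f (n + i * n + j)))
      ≡⟨ cong (∑ n f +_) (∑-cong m λ i → ∑-cong n λ j → cong f (+-assoc n (i * n) j)) ⟩
    ∑ n f + ∑ m (λ i → ∑ n (λ j → f (n + (i * n + j))))
      ≡⟨ cong (∑ n f +_) (∑-blocks m n (λ v → f (n + v))) ⟩
    ∑ n f + ∑ (m * n) (λ v → f (n + v))
      ≡⟨ ∑-+ n (m * n) f ⟨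
    ∑ (n + m * n) f ∎

  ∑-reverse : ∀ n (f : ℕ → ℕ) → ∑ n (λ v → f (n ∸ suc v)) ≡ ∑ n f
  ∑-reverse zero    f = refl
  ∑-reverse (suc n) f = begin
    f n + ∑ n (λ v → f (n ∸ suc v))  ≡⟨ cong (f n +_) (∑-reverse n f) ⟩
    f n + ∑ n f                      ≡⟨ +-comm (f n) _ ⟩
    ∑ n f + f n                      ≡⟨ ∑-snoc n f ⟨
    ∑ (suc n) f                      ∎

  ∑-split : ∀ {v r} → v ≤ r → (f g : ℕ → ℕ) →
    ∑ r (λ w → if w <ᵇ v then f w else g w) ≡
    ∑ v f + ∑ r (λ w → if w <ᵇ v then 0 else g w)
  ∑-split z≤n                 f g = refl
  ∑-split {suc v} {suc r} (s≤s v≤r) f g =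
    trans (cong (f 0 +_) (∑-split v≤r (f ∘ suc) (g ∘ suc))) (sym (+-assoc (f 0) _ _))

  ∑-upTo : ∀ {w n} → w < n → (f : ℕ → ℕ) →
    ∑ n (λ v → if w <ᵇ v then 0 else f v) ≡ ∑ (suc w) f
  ∑-upTo {zero} {suc n} (s≤s _) f = cong (f 0 +_) (∑-zero n)
  ∑-upTo {suc w} {suc n} (s≤s w<n) f = cong (f 0 +_) (∑-upTo w<n (f ∘ suc))

  -- Counterpart of `∑-upTo` for the order reversed by v ↦ n ∸ suc v: the values above w are those
  -- whose images lie below n ∸ suc w.
  ∑-above : ∀ {w n} → w < n → (f : ℕ → ℕ) →
    ∑ n (λ v → if not (w <ᵇ v) then 0 else f (n ∸ suc v)) ≡ ∑ (n ∸ suc w) f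
  ∑-above {zero}  {suc n} (s≤s _)   f = ∑-reverse n f
  ∑-above {suc w} {suc n} (s≤s w<n) f = ∑-above w<n f

  -- Chains

  -- A list of steps b₁ … bₙ prescribes chains r ⋛ v₁ ⋛ … ⋛ vₙ, where the i-th
  -- relation is > if bᵢ is true and ≥ otherwise.
  reach : Bool → ℕ → ℕ
  reach true  r = r
  reach false r = suc r

  chainSum : ℕ → List Bool → (List ℕ → ℕ) → ℕ
  chainSum r []      θ = θ []
  chainSum r (b ∷ s) θ = ∑ (reach b r) λ v → chainSum v s (λ vs → θ (v ∷ vs))

  count : ℕ → List Bool → ℕ
  count r s = chainSum r s (const 1)

  ∑-reach : ∀ b r (f : ℕ → ℕ) → ∑ (reach b r) f ≡ ∑ r f + (if b then 0 else f r)
  ∑-reach true  r f = sym (+-identityʳ _)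
  ∑-reach false r f = ∑-snoc r f

  reach-≤ : ∀ b {v r} → v < reach b r → v ≤ r
  reach-≤ true  v<r = <⇒≤ v<r
  reach-≤ false (s≤s v≤r) = v≤r

  ≤-reach : ∀ b r → r ≤ reach b r
  ≤-reach true  r = ≤-refl
  ≤-reach false r = n≤1+n r

  -- All that is kept of a chain once its steps are forgotten; it makes `position-entry` available
  -- under a `chainSum`.
  data Weakly≥ : ℕ → List ℕ → Set where
    []  : ∀ {r} → Weakly≥ r []
    _∷_ : ∀ {r v vs} → v ≤ r → Weakly≥ v vs → Weakly≥ r (v ∷ vs)

  chainSum-cong : ∀ r s {θ η : List ℕ → ℕ} → (∀ {vs} → Weakly≥ r vs → θ vs ≡ η vs) →
    chainSum r s θ ≡ chainSum r s η
  chainSum-cong r []      e = e []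
  chainSum-cong r (b ∷ s) e = ∑-cong< (reach b r) λ {v} v<r →
    chainSum-cong v s λ vs≤v → e (reach-≤ b v<r ∷ vs≤v)

  chainSum-+ : ∀ r s (θ η : List ℕ → ℕ) →
    chainSum r s (λ vs → θ vs + η vs) ≡ chainSum r s θ + chainSum r s η
  chainSum-+ r []      θ η = refl
  chainSum-+ r (b ∷ s) θ η =
    trans (∑-cong (reach b r) λ v → chainSum-+ v s _ _) (∑-distrib (reach b r) _ _)

  chainSum-∑ : ∀ n r s (θ : ℕ → List ℕ → ℕ) →
    chainSum r s (λ vs → ∑ n (λ w → θ w vs)) ≡ ∑ n (λ w → chainSum r s (θ w))
  chainSum-∑ n r []      θ = refl
  chainSum-∑ n r (b ∷ s) θ =
    trans (∑-cong (reach b r) λ v → chainSum-∑ n v s (λ w vs → θ w (v ∷ vs)))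
          (∑-swap (reach b r) n _)

  chainSum-*ˡ : ∀ a r s (θ : List ℕ → ℕ) → chainSum r s (λ vs → a * θ vs) ≡ a * chainSum r s θ
  chainSum-*ˡ a r []      θ = refl
  chainSum-*ˡ a r (b ∷ s) θ =
    trans (∑-cong (reach b r) λ v → chainSum-*ˡ a v s _) (sym (*-distribˡ-∑ (reach b r) a _))

  chainSum-if : ∀ (b : Bool) r s (θ : List ℕ → ℕ) →
    chainSum r s (λ vs → if b then 0 else θ vs) ≡ (if b then 0 else chainSum r s θ)
  chainSum-if false r s θ = refl
  chainSum-if true  r s θ = chainSum-*ˡ 0 r s (const 0)

  -- Both functions return junk values beyond the end of the list.
  insertStep : ℕ → List Bool → List Bool
  insertStep zero    []      = true ∷ []
  -- A new value goes in front of equal ones: strictly below its predecessor, weakly above its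
  -- successor. These two relations imply the one prescribed by b.
  insertStep zero    (b ∷ s) = true ∷ false ∷ s
  insertStep (suc i) []      = []
  insertStep (suc i) (b ∷ s) = b ∷ insertStep i s

  entry : List ℕ → ℕ → ℕ
  entry []       i       = 0
  entry (v ∷ vs) zero    = v
  entry (v ∷ vs) (suc i) = entry vs i

  position : ℕ → List ℕ → ℕ
  position w []       = 0
  position w (v ∷ vs) = if w <ᵇ v then suc (position w vs) else 0

  entry-≤ : ∀ {r vs} → Weakly≥ r vs → ∀ i → entry vs i ≤ r
  entry-≤ []         i       = z≤n
  entry-≤ (v≤r ∷ c)  zero    = v≤r
  entry-≤ (v≤r ∷ c)  (suc i) = ≤-trans (entry-≤ c i) v≤r

  ≥⇒≮ᵇ : ∀ {v w} → v ≤ w → (w <ᵇ v) ≡ false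
  ≥⇒≮ᵇ {w = zero}  z≤n       = refl
  ≥⇒≮ᵇ {w = suc w} z≤n       = refl
  ≥⇒≮ᵇ             (s≤s v≤w) = ≥⇒≮ᵇ v≤w

  <ᵇ-trans-≤ : ∀ w {v v′} → v′ ≤ v → (w <ᵇ v) ≡ false → (w <ᵇ v′) ≡ false
  <ᵇ-trans-≤ w       z≤n       e = ≥⇒≮ᵇ {0} {w} z≤n
  <ᵇ-trans-≤ (suc w) (s≤s v′≤v) e = <ᵇ-trans-≤ w v′≤v e

  -- As the entries weakly decrease, those exceeding w form an initial segment of length
  -- `position w vs`. This converts comparisons of places in the sorted word into comparisons of
  -- letters.
  position-entry : ∀ {r vs} → Weakly≥ r vs → ∀ w j → (j <ᵇ position w vs) ≡ (w <ᵇ entry vs j)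
  position-entry []                          w j = trans (≥⇒≮ᵇ {0} {j} z≤n) (sym (≥⇒≮ᵇ {0} {w} z≤n))
  position-entry (_∷_ {v = v} {vs} v≤r c) w j with w <ᵇ v in e
  position-entry (v≤r ∷ c) w zero    | true  = sym e
  position-entry (v≤r ∷ c) w (suc j) | true  = position-entry c w j
  position-entry (v≤r ∷ c) w zero    | false = sym e
  position-entry (v≤r ∷ c) w (suc j) | false = sym (<ᵇ-trans-≤ w (entry-≤ c j) e)

  if-float : ∀ {A B : Set} (f : A → B) b {x y} → f (if b then x else y) ≡ (if b then f x else f y)
  if-float f true  = refl
  if-float f false = refl

  -- Inserting a value w into a chain with steps s gives a chain with w at
  -- position i and steps insertStep i s, and every such chain arises once.
  chainSum-insert : ∀ r s (χ : ℕ → ℕ → ℕ) →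
    chainSum r s (λ vs → ∑ r (λ w → χ w (position w vs))) ≡
    ∑ (suc (length s)) (λ i → chainSum r (insertStep i s) (λ vs → χ (entry vs i) i))
  chainSum-insert r []      χ = sym (+-identityʳ _)
  chainSum-insert r (b ∷ s) χ = begin
    ∑ R (λ v → chainSum v s (λ vs → ∑ r (λ w → χ w (position w (v ∷ vs)))))
      -- If w < v, the new value comes after v, and the induction hypothesis applies to the rest of
      -- the chain with v as its bound; otherwise it comes first.
      ≡⟨ ∑-cong< R (λ {v} v<R → chainSum-cong v s λ {vs} _ →
           trans (∑-cong r λ w → if-float (χ w) (w <ᵇ v))
                 (∑-split (reach-≤ b v<R) (λ w → χ w (suc (position w vs))) (λ w → χ w 0))) ⟩
    ∑ R (λ v → chainSum v s (λ vs → ∑ v (λ w → χ w (suc (position w vs))) +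
                                     ∑ r (λ w → if w <ᵇ v then 0 else χ w 0)))
      ≡⟨ ∑-cong R (λ v → chainSum-+ v s _ _) ⟩
    ∑ R (λ v → chainSum v s (λ vs → ∑ v (λ w → χ w (suc (position w vs)))) +
               chainSum v s (λ vs → ∑ r (λ w → if w <ᵇ v then 0 else χ w 0)))
      ≡⟨ ∑-cong R (λ v → cong₂ _+_
           (chainSum-insert v s (λ w i → χ w (suc i)))
           (trans (chainSum-∑ r v s (λ w vs → if w <ᵇ v then 0 else χ w 0))
                  (∑-cong r λ w → chainSum-if (w <ᵇ v) v s (λ _ → χ w 0)))) ⟩
    ∑ R (λ v → ∑ (suc (length s)) (λ i → later v i) + ∑ r (λ w → if w <ᵇ v then 0 else first v w))
      ≡⟨ ∑-distrib R _ _ ⟩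
    ∑ R (λ v → ∑ (suc (length s)) (λ i → later v i)) +
    ∑ R (λ v → ∑ r (λ w → if w <ᵇ v then 0 else first v w))
      ≡⟨ cong₂ _+_ (∑-swap R (suc (length s)) later)
                   (∑-swap R r (λ v w → if w <ᵇ v then 0 else first v w)) ⟩
    ∑ (suc (length s)) (λ i → ∑ R (λ v → later v i)) +
    ∑ r (λ w → ∑ R (λ v → if w <ᵇ v then 0 else first v w))
      -- When w comes first, v ≤ w < r gives v < `reach b r` for either value of b.
      ≡⟨ cong (∑ (suc (length s)) (λ i → ∑ R (λ v → later v i)) +_)
           (∑-cong< r λ {w} w<r → ∑-upTo (≤-trans w<r (≤-reach b r)) (λ v → first v w)) ⟩
    ∑ (suc (length s)) (λ i → ∑ R (λ v → later v i)) +
    ∑ r (λ w → ∑ (suc w) (λ v → first v w))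
      ≡⟨ +-comm (∑ (suc (length s)) (λ i → ∑ R (λ v → later v i))) _ ⟩
    ∑ r (λ w → ∑ (suc w) (λ v → first v w)) +
    ∑ (suc (length s)) (λ i → ∑ R (λ v → later v i)) ∎
    where
    R = reach b r
    later : ℕ → ℕ → ℕ
    later v i = chainSum v (insertStep i s) (λ vs → χ (entry vs i) (suc i))
    first : ℕ → ℕ → ℕ
    first v w = chainSum v s (λ _ → χ w 0)

  ∑ᴸ-tabulate : ∀ n (h : Fin n → ℕ) (f : ℕ → ℕ) → (∀ i → h i ≡ f (toℕ i)) →
    ∑ᴸ (allFin n) h ≡ ∑ n f
  ∑ᴸ-tabulate n h f e = trans (cong (foldr _+_ 0) (Listₚ.map-tabulate id h)) (go n h f e)
    where
    go : ∀ n (h : Fin n → ℕ) (f : ℕ → ℕ) → (∀ i → h i ≡ f (toℕ i)) →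
      foldr _+_ 0 (tabulate h) ≡ ∑ n f
    go zero    h f e = refl
    go (suc n) h f e = cong₂ _+_ (e Fin.zero) (go n (h ∘ Fin.suc) (f ∘ suc) (e ∘ Fin.suc))

  ∑-∑ᴸ-swap : ∀ {A : Set} (xs : List A) n (f : A → ℕ → ℕ) →
    ∑ᴸ xs (λ x → ∑ n (f x)) ≡ ∑ n (λ v → ∑ᴸ xs (λ x → f x v))
  ∑-∑ᴸ-swap []       n f = sym (∑-zero n)
  ∑-∑ᴸ-swap (x ∷ xs) n f =
    trans (cong (∑ n (f x) +_) (∑-∑ᴸ-swap xs n f)) (sym (∑-distrib n (f x) _))

  -- Permutations as words

  word : ∀ {n} → Permutation′ n → List ℕ
  word π = tabulate (toℕ ∘ (π ⟨$⟩ʳ_))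

  drops : ℕ → List ℕ → List Bool
  drops x []       = []
  drops x (y ∷ ys) = (y <ᵇ x) ∷ drops y ys

  descentSteps : List ℕ → List Bool
  descentSteps []       = []
  descentSteps (x ∷ xs) = drops x xs

  steps : Bool → (Bool → Bool) → List ℕ → List Bool
  steps b φ []       = []
  steps b φ (x ∷ xs) = b ∷ map φ (drops x xs)

  trues : List Bool → ℕ
  trues []          = 0
  trues (true  ∷ s) = suc (trues s)
  trues (false ∷ s) = trues s

  length-drops : ∀ x xs → length (drops x xs) ≡ length xs
  length-drops x []       = refl
  length-drops x (y ∷ ys) = cong suc (length-drops y ys)

  length-steps : ∀ b φ xs → length (steps b φ xs) ≡ length xs
  length-steps b φ []       = refl
  length-steps b φ (x ∷ xs) = cong suc (trans (Listₚ.length-map φ (drops x xs)) (length-drops x xs))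

  length-word : ∀ {n} (π : Permutation′ n) → length (word π) ≡ n
  length-word π = Listₚ.length-tabulate (toℕ ∘ (π ⟨$⟩ʳ_))

  drops-tabulate-cong : ∀ n (f g : Fin (suc n) → ℕ) →
    (∀ k l → (f l <ᵇ f k) ≡ (g l <ᵇ g k)) →
    drops (f Fin.zero) (tabulate (f ∘ Fin.suc)) ≡ drops (g Fin.zero) (tabulate (g ∘ Fin.suc))
  drops-tabulate-cong zero    f g e = refl
  drops-tabulate-cong (suc n) f g e =
    cong₂ _∷_ (e Fin.zero (Fin.suc Fin.zero))
              (drops-tabulate-cong n (f ∘ Fin.suc) (g ∘ Fin.suc) λ k l → e (Fin.suc k) (Fin.suc l))

  punchIn-<ᵇ : ∀ {n} (i : Fin (suc n)) k l → (toℕ (punchIn i l) <ᵇ toℕ (punchIn i k)) ≡ (toℕ l <ᵇ toℕ k)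
  punchIn-<ᵇ Fin.zero    k           l           = refl
  punchIn-<ᵇ (Fin.suc i) Fin.zero    Fin.zero    = refl
  punchIn-<ᵇ (Fin.suc i) Fin.zero    (Fin.suc l) = refl
  punchIn-<ᵇ (Fin.suc i) (Fin.suc k) Fin.zero    = refl
  punchIn-<ᵇ (Fin.suc i) (Fin.suc k) (Fin.suc l) = punchIn-<ᵇ i k l

  punchIn-<ᵇ-pivot : ∀ {n} (i : Fin (suc n)) k → (toℕ (punchIn i k) <ᵇ toℕ i) ≡ (toℕ k <ᵇ toℕ i)
  punchIn-<ᵇ-pivot Fin.zero    k           = refl
  punchIn-<ᵇ-pivot (Fin.suc i) Fin.zero    = refl
  punchIn-<ᵇ-pivot (Fin.suc i) (Fin.suc k) = punchIn-<ᵇ-pivot i k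

  -- `punchIn i` preserves the order and sends exactly the values below i to values below i, so only
  -- the comparison of the first two letters is new.
  descentSteps-insert : ∀ {n} i (ρ : Permutation′ (suc n)) →
    descentSteps (word (insert Fin.zero i ρ)) ≡
    (entry (word ρ) 0 <ᵇ toℕ i) ∷ descentSteps (word ρ)
  descentSteps-insert {n} i ρ = cong₂ _∷_ (punchIn-<ᵇ-pivot i (ρ ⟨$⟩ʳ Fin.zero))
    (drops-tabulate-cong n (λ k → toℕ (punchIn i (ρ ⟨$⟩ʳ k))) (λ k → toℕ (ρ ⟨$⟩ʳ k))
      λ k l → punchIn-<ᵇ i (ρ ⟨$⟩ʳ k) (ρ ⟨$⟩ʳ l))

  insertMin : ℕ → List ℕ → List ℕ
  insertMin zero    xs       = 0 ∷ map suc xs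
  insertMin (suc i) []       = []
  insertMin (suc i) (x ∷ xs) = suc x ∷ insertMin i xs

  tabulate-insertMin : ∀ {n} (i : Fin (suc n)) (g : Fin (suc n) → ℕ) (h : Fin n → ℕ) →
    g i ≡ 0 → (∀ k → g (punchIn i k) ≡ suc (h k)) → tabulate g ≡ insertMin (toℕ i) (tabulate h)
  tabulate-insertMin Fin.zero g h g0 gs =
    cong₂ _∷_ g0 (trans (Listₚ.tabulate-cong gs) (sym (Listₚ.map-tabulate h suc)))
  tabulate-insertMin {suc n} (Fin.suc i) g h g0 gs =
    cong₂ _∷_ (gs Fin.zero)
              (tabulate-insertMin i (g ∘ Fin.suc) (h ∘ Fin.suc) g0 (gs ∘ Fin.suc))

  -- The extended permutation sends 0 to i and its other arguments are those of ρ moved up by one.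
  -- Hence its inverse takes the value 0 at place i and values of ρ⁻¹ plus one elsewhere.
  word-flip-insert : ∀ {n} i (ρ : Permutation′ n) →
    word (Perm.flip (insert Fin.zero i ρ)) ≡ insertMin (toℕ i) (word (Perm.flip ρ))
  word-flip-insert i ρ = tabulate-insertMin i (λ k → toℕ (insert Fin.zero i ρ ⟨$⟩ˡ k)) _
    (cong toℕ (Perm.inverseˡ (insert Fin.zero i ρ) {Fin.zero}))
    λ k → cong toℕ (trans
      (cong (insert Fin.zero i ρ ⟨$⟩ˡ_)
        (sym (trans (Perm.insert-punchIn Fin.zero i ρ (ρ ⟨$⟩ˡ k)) (cong (punchIn i) (Perm.inverseʳ ρ)))))
      (Perm.inverseˡ (insert Fin.zero i ρ)))

  drops-map-suc : ∀ x xs → drops (suc x) (map suc xs) ≡ drops x xs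
  drops-map-suc x []       = refl
  drops-map-suc x (y ∷ ys) = cong ((y <ᵇ x) ∷_) (drops-map-suc y ys)

  drops-insertMin : ∀ x i xs → drops (suc x) (insertMin i xs) ≡ insertStep i (drops x xs)
  drops-insertMin x zero    []       = refl
  drops-insertMin x zero    (y ∷ ys) = cong (λ s → true ∷ false ∷ s) (drops-map-suc y ys)
  drops-insertMin x (suc i) []       = refl
  drops-insertMin x (suc i) (y ∷ ys) = cong ((y <ᵇ x) ∷_) (drops-insertMin y i ys)

  chainSteps : List ℕ → List Bool
  chainSteps = steps true id

  -- The new minimum is reached by a descent and left by an ascent: the steps `true` and `false`
  -- that a value inserted in front of its equals requires.
  chainSteps-insertMin : ∀ i xs → chainSteps (insertMin i xs) ≡ insertStep i (chainSteps xs)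
  chainSteps-insertMin zero    []       = refl
  chainSteps-insertMin zero    (x ∷ xs) = cong (λ s → true ∷ false ∷ map id s) (drops-map-suc x xs)
  chainSteps-insertMin (suc i) []       = refl
  chainSteps-insertMin (suc i) (x ∷ xs) = cong (true ∷_)
    (trans (Listₚ.map-id _) (trans (drops-insertMin x i xs) (cong (insertStep i) (sym (Listₚ.map-id _)))))

  trues-filter : ∀ {A : Set} {P : A → Set} (P? : Decidable P) n (h : Fin n → A) →
    length (filter P? (tabulate h)) ≡ trues (tabulate (λ i → does (P? (h i))))
  trues-filter P? zero    h = refl
  trues-filter P? (suc n) h with does (P? (h Fin.zero))
  ... | true  = cong suc (trues-filter P? n (h ∘ Fin.suc))
  ... | false = trues-filter P? n (h ∘ Fin.suc)

  drops-tabulate : ∀ n (g : Fin (suc n) → ℕ) →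
    drops (g Fin.zero) (tabulate (g ∘ Fin.suc)) ≡ tabulate (λ i → g (Fin.suc i) <ᵇ g (inject₁ i))
  drops-tabulate zero    g = refl
  drops-tabulate (suc n) g = cong ((g (Fin.suc Fin.zero) <ᵇ g Fin.zero) ∷_) (drops-tabulate n (g ∘ Fin.suc))

  descents-trues : ∀ {n} (π : Permutation′ n) → descents π ≡ trues (descentSteps (word π))
  descents-trues {zero}  π = refl
  descents-trues {suc n} π = trans
    (trues-filter (λ i → (π ⟨$⟩ʳ Fin.suc i) Finₚ.<? (π ⟨$⟩ʳ inject₁ i)) n id)
    (cong trues (sym (drops-tabulate n (toℕ ∘ (π ⟨$⟩ʳ_)))))

  -- A first entry below e is allowed by both kinds of step, the entry e itself only by a weak one.
  -- The latter is expressed by a factor 0 or 1 because that factor becomes the weight θ in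
  -- `∑-standardization`.
  count-∷ : ∀ b e s → count e (b ∷ s) ≡ ∑ e (λ v → count v s) + (if b then 0 else 1) * count e s
  count-∷ b e s = trans (∑-reach b e _) (cong (∑ e (λ v → count v s) +_) (lemma b))
    where
    lemma : ∀ b → (if b then 0 else count e s) ≡ (if b then 0 else 1) * count e s
    lemma true  = refl
    lemma false = sym (+-identityʳ _)

  reach-+ : ∀ b m n → reach b (m + n) ≡ m + reach b n
  reach-+ true  m n = refl
  reach-+ false m n = sym (+-suc m n)

  -- Standardization of words and lexicographic chains

  -- Pairs (e , w) with w < b are ordered lexicographically, w being compared by
  -- its rank; the pair (e , w) then has e * b + rank w predecessors.  With φ = id
  -- the chains of pairs are weakly decreasing, with φ = not strictly.
  module Lexicographic (φ : Bool → Bool) (b : ℕ) (rank : ℕ → ℕ)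
    (∑-rank : ∀ f → ∑ b (f ∘ rank) ≡ ∑ b f)
    (∑-below : ∀ {w} → w < b → ∀ f →
      ∑ b (λ v → if φ (w <ᵇ v) then 0 else f (rank v)) ≡ ∑ (reach (φ false) (rank w)) f) where

    uniform : ℕ → List Bool
    uniform n = replicate n (φ false)

    -- The pairs that may follow (e , w) are e full blocks of b values and the part of block e that
    -- the letter w admits; laid end to end they are an initial segment of the numbers.
    ∑-lexicographic : ∀ {w} → w < b → ∀ e (f : ℕ → ℕ) →
      ∑ e (λ e′ → ∑ b (λ v → 1 * f (e′ * b + rank v))) +
      ∑ b (λ v → (if φ (w <ᵇ v) then 0 else 1) * f (e * b + rank v)) ≡
      ∑ (reach (φ false) (e * b + rank w)) f
    ∑-lexicographic {w} w<b e f = begin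
      ∑ e (λ e′ → ∑ b (λ v → 1 * f (e′ * b + rank v))) +
      ∑ b (λ v → (if φ (w <ᵇ v) then 0 else 1) * f (e * b + rank v))
        ≡⟨ cong₂ _+_
             (∑-cong e λ e′ → trans (∑-cong b λ v → *-identityˡ _) (∑-rank (λ v → f (e′ * b + v))))
             (trans (∑-cong b λ v → bool (φ (w <ᵇ v)) _) (∑-below w<b (λ v → f (e * b + v)))) ⟩
      ∑ e (λ e′ → ∑ b (λ v → f (e′ * b + v))) + ∑ (reach (φ false) (rank w)) (λ v → f (e * b + v))
        ≡⟨ cong (_+ ∑ (reach (φ false) (rank w)) (λ v → f (e * b + v))) (∑-blocks e b f) ⟩
      ∑ (e * b) f + ∑ (reach (φ false) (rank w)) (λ v → f (e * b + v))
        ≡⟨ ∑-+ (e * b) _ f ⟨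
      ∑ (e * b + reach (φ false) (rank w)) f
        ≡⟨ cong (λ r → ∑ r f) (reach-+ (φ false) (e * b) (rank w)) ⟨
      ∑ (reach (φ false) (e * b + rank w)) f ∎
      where
      bool : ∀ c x → (if c then 0 else 1) * x ≡ (if c then 0 else x)
      bool true  x = refl
      bool false x = +-identityʳ x

    private
      tail-steps : ∀ {n} → Permutation′ n → List Bool
      tail-steps ρ = map φ (descentSteps (word ρ))

      inverse-steps : ∀ {n} → Permutation′ n → List Bool
      inverse-steps ρ = chainSteps (word (Perm.flip ρ))

      letterSum : ∀ {n} → Permutation′ n → (ℕ → ℕ) → ℕ
      letterSum ρ θ = chainSum b (inverse-steps ρ) (λ vs → θ (entry vs (entry (word ρ) 0)))

    -- In a word with standardization `insert Fin.zero i ρ` the first letter has sorted place i.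
    -- `chainSum-insert` trades the sum over i for one over that letter w, and `position-entry`
    -- rewrites the descent test ρ₀ < i at the first place as a comparison of w with the next
    -- letter.
    ∑-insertions : ∀ {n} (ρ : Permutation′ (suc n)) e (θ : ℕ → ℕ) →
      ∑ᴸ (allFin (suc (suc n)))
         (λ i → letterSum (insert Fin.zero i ρ) θ * count e (tail-steps (insert Fin.zero i ρ))) ≡
      ∑ b (λ w → θ w * (∑ e (λ e′ → letterSum ρ (const 1) * count e′ (tail-steps ρ)) +
                        letterSum ρ (λ v → if φ (w <ᵇ v) then 0 else 1) * count e (tail-steps ρ)))
    ∑-insertions {n} ρ e θ = begin
      ∑ᴸ (allFin (suc (suc n)))
         (λ i → letterSum (insert Fin.zero i ρ) θ * count e (tail-steps (insert Fin.zero i ρ)))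
        ≡⟨ ∑ᴸ-tabulate (suc (suc n)) _
             (λ i → chainSum b (insertStep i S) (λ vs → χ (entry vs i) i)) summand ⟩
      ∑ (suc (suc n)) (λ i → chainSum b (insertStep i S) (λ vs → χ (entry vs i) i))
        ≡⟨ cong (λ l → ∑ (suc l) (λ i → chainSum b (insertStep i S) (λ vs → χ (entry vs i) i)))
                (trans (length-steps true id (word (Perm.flip ρ))) (length-word (Perm.flip ρ))) ⟨
      ∑ (suc (length S)) (λ i → chainSum b (insertStep i S) (λ vs → χ (entry vs i) i))
        ≡⟨ chainSum-insert b S χ ⟨
      chainSum b S (λ vs → ∑ b (λ w → χ w (position w vs)))
        ≡⟨ chainSum-∑ b b S (λ w vs → χ w (position w vs)) ⟩
      ∑ b (λ w → chainSum b S (λ vs → χ w (position w vs)))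
        ≡⟨ ∑-cong b letter ⟩
      ∑ b (λ w → θ w * (∑ e (λ e′ → letterSum ρ (const 1) * count e′ T) +
                        letterSum ρ (λ v → if φ (w <ᵇ v) then 0 else 1) * count e T)) ∎
      where
      S T : List Bool
      S = inverse-steps ρ
      T = tail-steps ρ
      ρ₀ : ℕ
      ρ₀ = entry (word ρ) 0
      χ : ℕ → ℕ → ℕ
      χ w i = count e (φ (ρ₀ <ᵇ i) ∷ T) * θ w

      summand : ∀ i →
        letterSum (insert Fin.zero i ρ) θ * count e (tail-steps (insert Fin.zero i ρ)) ≡
        chainSum b (insertStep (toℕ i) S) (λ vs → χ (entry vs (toℕ i)) (toℕ i))
      summand i = begin
        letterSum (insert Fin.zero i ρ) θ * count e (tail-steps (insert Fin.zero i ρ))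
          ≡⟨ cong₂ (λ s t → chainSum b s (λ vs → θ (entry vs (toℕ i))) * count e (map φ t))
               (trans (cong chainSteps (word-flip-insert i ρ))
                      (chainSteps-insertMin (toℕ i) (word (Perm.flip ρ))))
               (descentSteps-insert i ρ) ⟩
        chainSum b (insertStep (toℕ i) S) (λ vs → θ (entry vs (toℕ i))) * count e (φ (ρ₀ <ᵇ toℕ i) ∷ T)
          ≡⟨ *-comm _ (count e (φ (ρ₀ <ᵇ toℕ i) ∷ T)) ⟩
        count e (φ (ρ₀ <ᵇ toℕ i) ∷ T) * chainSum b (insertStep (toℕ i) S) (λ vs → θ (entry vs (toℕ i)))
          ≡⟨ chainSum-*ˡ (count e (φ (ρ₀ <ᵇ toℕ i) ∷ T)) b (insertStep (toℕ i) S) _ ⟨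
        chainSum b (insertStep (toℕ i) S) (λ vs → χ (entry vs (toℕ i)) (toℕ i)) ∎

      letter : ∀ w → chainSum b S (λ vs → χ w (position w vs)) ≡
        θ w * (∑ e (λ e′ → letterSum ρ (const 1) * count e′ T) +
               letterSum ρ (λ v → if φ (w <ᵇ v) then 0 else 1) * count e T)
      letter w = begin
        chainSum b S (λ vs → χ w (position w vs))
          ≡⟨ chainSum-cong b S (λ {vs} c → begin
               count e (φ (ρ₀ <ᵇ position w vs) ∷ T) * θ w
                 ≡⟨ cong (λ d → count e (φ d ∷ T) * θ w) (position-entry c w ρ₀) ⟩
               count e (φ (w <ᵇ entry vs ρ₀) ∷ T) * θ w
                 ≡⟨ *-comm _ (θ w) ⟩
               θ w * count e (φ (w <ᵇ entry vs ρ₀) ∷ T)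
                 ≡⟨ cong (θ w *_) (count-∷ (φ (w <ᵇ entry vs ρ₀)) e T) ⟩
               θ w * (∑ e (λ e′ → count e′ T) +
                      (if φ (w <ᵇ entry vs ρ₀) then 0 else 1) * count e T)
                 ≡⟨ cong (θ w *_) (cong₂ _+_ (sym (*-identityʳ _)) (*-comm _ (count e T))) ⟩
               θ w * (∑ e (λ e′ → count e′ T) * 1 +
                      count e T * (if φ (w <ᵇ entry vs ρ₀) then 0 else 1)) ∎) ⟩
        chainSum b S (λ vs → θ w * (∑ e (λ e′ → count e′ T) * 1 +
                                    count e T * (if φ (w <ᵇ entry vs ρ₀) then 0 else 1)))
          ≡⟨ chainSum-*ˡ (θ w) b S (λ vs → below * 1 + count e T * above vs) ⟩
        θ w * chainSum b S (λ vs → ∑ e (λ e′ → count e′ T) * 1 +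
                                   count e T * (if φ (w <ᵇ entry vs ρ₀) then 0 else 1))
          ≡⟨ cong (θ w *_) (trans (chainSum-+ b S (λ vs → below * 1) (λ vs → count e T * above vs)) (cong₂ _+_
               (chainSum-*ˡ below b S (const 1))
               (chainSum-*ˡ (count e T) b S above))) ⟩
        θ w * (∑ e (λ e′ → count e′ T) * letterSum ρ (const 1) +
               count e T * letterSum ρ (λ v → if φ (w <ᵇ v) then 0 else 1))
          ≡⟨ cong (θ w *_) (cong₂ _+_
               (trans (*-comm _ (letterSum ρ (const 1)))
                      (*-distribˡ-∑ e (letterSum ρ (const 1)) (λ e′ → count e′ T)))
               (*-comm (count e T) _)) ⟩
        θ w * (∑ e (λ e′ → letterSum ρ (const 1) * count e′ T) +
               letterSum ρ (λ v → if φ (w <ᵇ v) then 0 else 1) * count e T) ∎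
        where
        below : ℕ
        below = ∑ e (λ e′ → count e′ T)
        above : List ℕ → ℕ
        above vs = if φ (w <ᵇ entry vs ρ₀) then 0 else 1

    -- With the letters 0 , … , b - 1 in decreasing order, the chains with steps
    -- prescribed by ρ⁻¹ are the sorted words whose standardization is ρ, and θ is
    -- applied to the first letter of the unsorted word.
    ∑-standardization : ∀ n e (θ : ℕ → ℕ) →
      ∑ᴸ (permutations (suc n)) (λ ρ → letterSum ρ θ * count e (tail-steps ρ)) ≡
      ∑ b (λ w → θ w * count (e * b + rank w) (uniform n))
    ∑-standardization zero e θ =
      trans (+-identityʳ _) (trans (*-identityʳ _) (∑-cong b λ w → sym (*-identityʳ (θ w))))
    ∑-standardization (suc n) e θ = begin
      ∑ᴸ (permutations (suc (suc n))) (λ π → letterSum π θ * count e (tail-steps π))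
        ≡⟨ ∑ᴸ-cartesianProductWith (insert Fin.zero) (allFin (suc (suc n))) (permutations (suc n)) _ ⟩
      ∑ᴸ (allFin (suc (suc n))) (λ i → ∑ᴸ (permutations (suc n)) (λ ρ →
         letterSum (insert Fin.zero i ρ) θ * count e (tail-steps (insert Fin.zero i ρ))))
        ≡⟨ ∑ᴸ-swap (allFin (suc (suc n))) (permutations (suc n)) _ ⟩
      ∑ᴸ (permutations (suc n)) (λ ρ → ∑ᴸ (allFin (suc (suc n))) (λ i →
         letterSum (insert Fin.zero i ρ) θ * count e (tail-steps (insert Fin.zero i ρ))))
        ≡⟨ ∑ᴸ-cong (permutations (suc n)) (λ ρ → ∑-insertions ρ e θ) ⟩
      ∑ᴸ (permutations (suc n)) (λ ρ → ∑ b (λ w → θ w * (lower ρ + level w ρ)))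
        ≡⟨ ∑-∑ᴸ-swap (permutations (suc n)) b _ ⟩
      ∑ b (λ w → ∑ᴸ (permutations (suc n)) (λ ρ → θ w * (lower ρ + level w ρ)))
        ≡⟨ ∑-cong< b (λ {w} w<b → begin
             ∑ᴸ (permutations (suc n)) (λ ρ → θ w * (lower ρ + level w ρ))
               ≡⟨ *-distribˡ-∑ᴸ (permutations (suc n)) (θ w) _ ⟨
             θ w * ∑ᴸ (permutations (suc n)) (λ ρ → lower ρ + level w ρ)
               ≡⟨ cong (θ w *_) (∑ᴸ-distrib (permutations (suc n)) lower (level w)) ⟩
             θ w * (∑ᴸ (permutations (suc n)) lower + ∑ᴸ (permutations (suc n)) (level w))
               -- The induction hypothesis serves twice: with weight 1 when the next first component
               -- is below e, and with the weight comparing the next letter to w when it equals e.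
               -- The second use is the reason for carrying θ.
               ≡⟨ cong (θ w *_) (cong₂ _+_
                    (trans (∑-∑ᴸ-swap (permutations (suc n)) e _)
                           (∑-cong e λ e′ → ∑-standardization n e′ (const 1)))
                    (∑-standardization n e (λ v → if φ (w <ᵇ v) then 0 else 1))) ⟩
             θ w * (∑ e (λ e′ → ∑ b (λ v → 1 * count (e′ * b + rank v) (uniform n))) +
                    ∑ b (λ v → (if φ (w <ᵇ v) then 0 else 1) * count (e * b + rank v) (uniform n)))
               ≡⟨ cong (θ w *_) (∑-lexicographic w<b e (λ v → count v (uniform n))) ⟩
             θ w * count (e * b + rank w) (uniform (suc n)) ∎) ⟩
      ∑ b (λ w → θ w * count (e * b + rank w) (uniform (suc n))) ∎
      where
      lower : Permutation′ (suc n) → ℕ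
      lower ρ = ∑ e (λ e′ → letterSum ρ (const 1) * count e′ (tail-steps ρ))
      level : ℕ → Permutation′ (suc n) → ℕ
      level w ρ = letterSum ρ (λ v → if φ (w <ᵇ v) then 0 else 1) * count e (tail-steps ρ)

    ∑-count-*-count : ∀ n a →
      ∑ᴸ (permutations n) (λ π → count a (steps true φ (word π)) * count b (chainSteps (word (Perm.flip π)))) ≡
      count (a * b) (steps true φ (replicate n 0))
    ∑-count-*-count zero    a = refl
    ∑-count-*-count (suc n) a = begin
      ∑ᴸ (permutations (suc n)) (λ π → ∑ a (λ e → count e (tail-steps π)) * letterSum π (const 1))
        ≡⟨ ∑ᴸ-cong (permutations (suc n)) (λ π →
             trans (*-comm _ (letterSum π (const 1)))
                   (*-distribˡ-∑ a (letterSum π (const 1)) (λ e → count e (tail-steps π)))) ⟩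
      ∑ᴸ (permutations (suc n)) (λ π → ∑ a (λ e → letterSum π (const 1) * count e (tail-steps π)))
        ≡⟨ ∑-∑ᴸ-swap (permutations (suc n)) a _ ⟩
      ∑ a (λ e → ∑ᴸ (permutations (suc n)) (λ π → letterSum π (const 1) * count e (tail-steps π)))
        ≡⟨ ∑-cong a (λ e → trans (∑-standardization n e (const 1))
             (trans (∑-cong b λ w → *-identityˡ _) (∑-rank (λ v → count (e * b + v) (uniform n))))) ⟩
      ∑ a (λ e → ∑ b (λ w → count (e * b + w) (uniform n)))
        ≡⟨ ∑-blocks a b (λ v → count v (uniform n)) ⟩
      ∑ (a * b) (λ v → count v (uniform n))
        ≡⟨ cong (λ s → ∑ (a * b) (λ v → count v s)) (uniform-steps n 0) ⟩
      ∑ (a * b) (λ v → count v (map φ (drops 0 (replicate n 0)))) ∎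
      where
      uniform-steps : ∀ n x → uniform n ≡ map φ (drops x (replicate n x))
      uniform-steps zero    x = refl
      uniform-steps (suc n) x = cong₂ _∷_ (cong φ (sym (≥⇒≮ᵇ {x} ≤-refl))) (uniform-steps n x)

  ∑-count-weak : ∀ n a b →
    ∑ᴸ (permutations n) (λ π → count a (chainSteps (word π)) * count b (chainSteps (word (Perm.flip π)))) ≡
    count (a * b) (chainSteps (replicate n 0))
  ∑-count-weak n a b = ∑-count-*-count n a
    where open Lexicographic id b id (λ f → refl) ∑-upTo

  -- Equal letters are standardized from left to right as before, so an ascent of π is a weak drop
  -- of the letters and forces the first components to drop. Among pairs with equal first components
  -- the letters therefore rise strictly, and reading them as b ∸ suc w makes the chains of pairs
  -- strictly decreasing.
  ∑-count-strict : ∀ n a b →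
    ∑ᴸ (permutations n) (λ π → count a (steps true not (word π)) * count b (chainSteps (word (Perm.flip π)))) ≡
    count (a * b) (steps true not (replicate n 0))
  ∑-count-strict n a b = ∑-count-*-count n a
    where open Lexicographic not b (λ w → b ∸ suc w) (∑-reverse b) ∑-above

open Combinatorics

-- A ring solver with integer coefficients

-- A coefficient (m , n) stands for the integer m - n.
module IntegerRingSolver (R : CommutativeRing 0ℓ 0ℓ) where
  open CommutativeRing R
  open Multiples semiring using (×-homo-+; ×1-homo-*) renaming (_×_ to _·_)
  open RingProperties ring using (-‿distribˡ-*; -‿distribʳ-*; -‿involutive)
  open AbelianGroupProperties +-abelianGroup using (ε⁻¹≈ε; ⁻¹-∙-comm)
  open GroupProperties +-group using (⁻¹-anti-homo-//)
  open SemiringSolver commutativeSemiring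
    renaming (solve to solveˢ; _:=_ to _:=ˢ_; _:+_ to _:+ˢ_; _:*_ to _:*ˢ_)
    using ()
  open SetoidReasoning setoid

  private
    infixl 6 _⊕_
    infixl 7 _⊗_

    _⊕_ _⊗_ : ℕ × ℕ → ℕ × ℕ → ℕ × ℕ
    (a , b) ⊕ (c , d) = a ℕ.+ c , b ℕ.+ d
    (a , b) ⊗ (c , d) = a ℕ.* c ℕ.+ b ℕ.* d , a ℕ.* d ℕ.+ b ℕ.* c

    differences : RawRing 0ℓ 0ℓ
    differences = record
      { Carrier = ℕ × ℕ
      ; _≈_     = _≡_
      ; _+_     = _⊕_
      ; _*_     = _⊗_
      ; -_      = λ (a , b) → b , a
      ; 0#      = 0 , 0
      ; 1#      = 1 , 0
      }

    nat : ℕ → Carrier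
    nat n = n · 1#

    nat-+ : ∀ m n → nat (m ℕ.+ n) ≈ nat m + nat n
    nat-+ = ×-homo-+ 1#

    nat-*-+-* : ∀ a b c d → nat (a ℕ.* b ℕ.+ c ℕ.* d) ≈ nat a * nat b + nat c * nat d
    nat-*-+-* a b c d =
      trans (nat-+ (a ℕ.* b) (c ℕ.* d)) (+-cong (×1-homo-* a b) (×1-homo-* c d))

    neg-*-neg : ∀ b d → - b * - d ≈ b * d
    neg-*-neg b d = trans (sym (-‿distribˡ-* b (- d)))
      (trans (-‿cong (sym (-‿distribʳ-* b d))) (-‿involutive _))

    difference : ℕ × ℕ → Carrier
    difference (m , n) = nat m - nat n

    difference-0 : difference (0 , 0) ≈ 0#
    difference-0 = -‿inverseʳ 0#

    difference-1 : difference (1 , 0) ≈ 1#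
    difference-1 = trans (+-cong (+-identityʳ 1#) ε⁻¹≈ε) (+-identityʳ 1#)

    -- The first two clauses let the solver's constants 0 and 1 evaluate
    -- definitionally to 0# and 1#.
    ⟦_⟧ : ℕ × ℕ → Carrier
    ⟦ 0 , 0 ⟧ = 0#
    ⟦ 1 , 0 ⟧ = 1#
    ⟦ m , n ⟧ = difference (m , n)

    ⟦⟧≈difference : ∀ p → ⟦ p ⟧ ≈ difference p
    ⟦⟧≈difference (0             , zero)  = sym difference-0
    ⟦⟧≈difference (1             , zero)  = sym difference-1
    ⟦⟧≈difference (suc (suc m)   , zero)  = refl
    ⟦⟧≈difference (0             , suc n) = refl
    ⟦⟧≈difference (1             , suc n) = refl
    ⟦⟧≈difference (suc (suc m)   , suc n) = refl

    +-homo : ∀ p q → difference (p ⊕ q) ≈ difference p + difference q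
    +-homo (a , b) (c , d) = begin
      nat (a ℕ.+ c) - nat (b ℕ.+ d)
        ≈⟨ +-cong (nat-+ a c) (trans (-‿cong (nat-+ b d)) (sym (⁻¹-∙-comm _ _))) ⟩
      nat a + nat c + (- nat b + - nat d)
        ≈⟨ solveˢ 4 (λ a b c d → a :+ˢ c :+ˢ (b :+ˢ d) :=ˢ (a :+ˢ b) :+ˢ (c :+ˢ d)) refl
             (nat a) (- nat b) (nat c) (- nat d) ⟩
      (nat a - nat b) + (nat c - nat d) ∎

    *-homo : ∀ p q → difference (p ⊗ q) ≈ difference p * difference q
    *-homo (a , b) (c , d) = begin
      nat (a ℕ.* c ℕ.+ b ℕ.* d) - nat (a ℕ.* d ℕ.+ b ℕ.* c)
        ≈⟨ +-cong (nat-*-+-* a c b d)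
             (trans (-‿cong (nat-*-+-* a d b c)) (sym (⁻¹-∙-comm _ _))) ⟩
      nat a * nat c + nat b * nat d + (- (nat a * nat d) + - (nat b * nat c))
        ≈⟨ +-cong (+-congˡ (sym (neg-*-neg _ _)))
                  (+-cong (-‿distribʳ-* _ _) (-‿distribˡ-* _ _)) ⟩
      nat a * nat c + - nat b * - nat d + (nat a * - nat d + - nat b * nat c)
        ≈⟨ solveˢ 4 (λ a b c d → a :*ˢ c :+ˢ b :*ˢ d :+ˢ (a :*ˢ d :+ˢ b :*ˢ c) :=ˢ
                                (a :+ˢ b) :*ˢ (c :+ˢ d)) refl
             (nat a) (- nat b) (nat c) (- nat d) ⟩
      (nat a - nat b) * (nat c - nat d) ∎

    morphism : differences -Raw-AlmostCommutative⟶ fromCommutativeRing R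
    morphism = record
      { ⟦_⟧    = ⟦_⟧
      ; +-homo = λ p q → trans (⟦⟧≈difference (p ⊕ q))
          (trans (+-homo p q) (sym (+-cong (⟦⟧≈difference p) (⟦⟧≈difference q))))
      ; *-homo = λ p q → trans (⟦⟧≈difference (p ⊗ q))
          (trans (*-homo p q) (sym (*-cong (⟦⟧≈difference p) (⟦⟧≈difference q))))
      ; -‿homo = λ p@(a , b) → trans (⟦⟧≈difference (b , a))
          (trans (sym (⁻¹-anti-homo-// _ _)) (-‿cong (sym (⟦⟧≈difference p))))
      ; 0-homo = refl
      ; 1-homo = refl
      }

    -- Differences are compared by cross addition in ℕ, since equality in R need not be decidable.
    equal? : ∀ p q → Maybe (⟦ p ⟧ ≈ ⟦ q ⟧)
    equal? (a , b) (c , d) with a ℕ.+ d ℕₚ.≟ c ℕ.+ b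
    ... | no _  = nothing
    ... | yes e = just (trans (⟦⟧≈difference (a , b)) (trans (begin
      nat a - nat b
        ≈⟨ +-identityʳ _ ⟨
      nat a - nat b + 0#
        ≈⟨ +-congˡ (-‿inverseʳ (nat d)) ⟨
      nat a - nat b + (nat d - nat d)
        ≈⟨ solveˢ 4 (λ a b c d → (a :+ˢ b) :+ˢ (c :+ˢ d) :=ˢ (a :+ˢ c) :+ˢ (b :+ˢ d)) refl _ _ _ _ ⟩
      nat a + nat d + (- nat b - nat d)
        ≈⟨ +-congʳ (trans (sym (nat-+ a d)) (trans (reflexive (≡.cong nat e)) (nat-+ c b))) ⟩
      nat c + nat b + (- nat b - nat d)
        ≈⟨ solveˢ 4 (λ a b c d → (a :+ˢ b) :+ˢ (c :+ˢ d) :=ˢ (b :+ˢ c) :+ˢ (a :+ˢ d)) refl _ _ _ _ ⟩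
      nat b - nat b + (nat c - nat d)
        ≈⟨ +-congʳ (-‿inverseʳ (nat b)) ⟩
      0# + (nat c - nat d)
        ≈⟨ +-identityˡ _ ⟩
      nat c - nat d ∎) (sym (⟦⟧≈difference (c , d)))))

  open RingSolver differences (fromCommutativeRing R) morphism equal? public
    using (solve; _:=_; _:+_; _:*_; _:-_; :-_; con)

  :1 : ∀ {n} → RingSolver.Polynomial differences (fromCommutativeRing R) morphism equal? n
  :1 = con (1 , 0)

-- The chains gained by raising the bound are those whose first entry is the new largest value,
-- which is `reach b r`.
count-suc : ∀ r b s → count (suc r) (b ∷ s) ≡ count r (b ∷ s) ℕ.+ count (reach b r) s
count-suc r true  s = ∑-snoc r (λ v → count v s)
count-suc r false s = ∑-snoc (suc r) (λ v → count v s)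

-- Ring homomorphisms

record RingHom (A B : CommutativeRing 0ℓ 0ℓ) : Set where
  private
    module A = CommutativeRing A
    module B = CommutativeRing B
  field
    ⟦_⟧    : A.Carrier → B.Carrier
    ⟦⟧-cong : ∀ {a b} → a A.≈ b → ⟦ a ⟧ B.≈ ⟦ b ⟧
    +-homo : ∀ a b → ⟦ a A.+ b ⟧ B.≈ ⟦ a ⟧ B.+ ⟦ b ⟧
    *-homo : ∀ a b → ⟦ a A.* b ⟧ B.≈ ⟦ a ⟧ B.* ⟦ b ⟧
    1-homo : ⟦ A.1# ⟧ B.≈ B.1#

  0-homo : ⟦ A.0# ⟧ B.≈ B.0#
  0-homo = identityʳ-unique ⟦ A.0# ⟧ ⟦ A.0# ⟧
    (B.trans (B.sym (+-homo A.0# A.0#)) (⟦⟧-cong (A.+-identityˡ A.0#)))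
    where open GroupProperties B.+-group

  -‿homo : ∀ a → ⟦ A.- a ⟧ B.≈ B.- ⟦ a ⟧
  -‿homo a = inverseˡ-unique ⟦ A.- a ⟧ ⟦ a ⟧
    (B.trans (B.sym (+-homo (A.- a) a)) (B.trans (⟦⟧-cong (A.-‿inverseˡ a)) 0-homo))
    where open GroupProperties B.+-group

  sub-homo : ∀ a b → ⟦ a A.- b ⟧ B.≈ ⟦ a ⟧ B.- ⟦ b ⟧
  sub-homo a b = B.trans (+-homo a (A.- b)) (B.+-congˡ (-‿homo b))

  private
    module A^ = Exponentiation A.semiring
    module B^ = Exponentiation B.semiring
    module A· = Multiples A.semiring
    module B· = Multiples B.semiring
    module ΣA = ListSums A.commutativeSemiring
    module ΣB = ListSums B.commutativeSemiring

  ^-homo : ∀ a n → ⟦ a A^.^ n ⟧ B.≈ ⟦ a ⟧ B^.^ n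
  ^-homo a zero    = 1-homo
  ^-homo a (suc n) = B.trans (*-homo a _) (B.*-congˡ (^-homo a n))

  ×1-homo : ∀ n → ⟦ n A·.× A.1# ⟧ B.≈ n B·.× B.1#
  ×1-homo zero    = 0-homo
  ×1-homo (suc n) = B.trans (+-homo _ _) (B.+-cong 1-homo (×1-homo n))

  ∑ᴸ-homo : ∀ {X : Set} (xs : List X) f → ⟦ ΣA.∑ᴸ xs f ⟧ B.≈ ΣB.∑ᴸ xs (λ x → ⟦ f x ⟧)
  ∑ᴸ-homo []       f = 0-homo
  ∑ᴸ-homo (x ∷ xs) f = B.trans (+-homo _ _) (B.+-congˡ (∑ᴸ-homo xs f))

infixr 9 _∘ᴴ_

_∘ᴴ_ : ∀ {A B C} → RingHom B C → RingHom A B → RingHom A C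
_∘ᴴ_ {C = C} g f = record
  { ⟦_⟧     = g.⟦_⟧ ∘ f.⟦_⟧
  ; ⟦⟧-cong = g.⟦⟧-cong ∘ f.⟦⟧-cong
  ; +-homo  = λ a b → C.trans (g.⟦⟧-cong (f.+-homo a b)) (g.+-homo _ _)
  ; *-homo  = λ a b → C.trans (g.⟦⟧-cong (f.*-homo a b)) (g.*-homo _ _)
  ; 1-homo  = C.trans (g.⟦⟧-cong f.1-homo) g.1-homo
  }
  where
  module C = CommutativeRing C
  module g = RingHom g
  module f = RingHom f

module Scalars (R : CommutativeRing 0ℓ 0ℓ) where
  open CommutativeRing R
  open Multiples semiring using (×-homo-+; ×1-homo-*) renaming (_×_ to _·_)
  open Exponentiation semiring using (_^_)
  open ListSums commutativeSemiring public
  private module Σℕ = ListSums ℕₚ.+-*-commutativeSemiring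

  nat : ℕ → Carrier
  nat n = n · 1#

  nat-+ : ∀ m n → nat (m ℕ.+ n) ≈ nat m + nat n
  nat-+ = ×-homo-+ 1#

  nat-* : ∀ m n → nat (m ℕ.* n) ≈ nat m * nat n
  nat-* = ×1-homo-*

  nat-∑ᴸ : ∀ {X : Set} (xs : List X) (f : X → ℕ) → nat (Σℕ.∑ᴸ xs f) ≈ ∑ᴸ xs (nat ∘ f)
  nat-∑ᴸ []       f = refl
  nat-∑ᴸ (x ∷ xs) f = trans (nat-+ (f x) _) (+-congˡ (nat-∑ᴸ xs f))

  sign : ℕ → Carrier
  sign m = (- 1#) ^ m

-- Power series

module SeriesLemmas (R : CommutativeRing 0ℓ 0ℓ) where
  private
    module R = CommutativeRing R
  open FormalPowerSeries R
  private
    module S = CommutativeRing commutativeRing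
    module Rˢ = IntegerRingSolver R
    module Sˢ = IntegerRingSolver commutativeRing
  open Exponentiation R.semiring using () renaming (_^_ to _^ᴿ_)
  open Exponentiation S.semiring using (_^_)
  open CommutativeExponentiation R.commutativeSemiring using () renaming (^-distrib-* to ^ᴿ-distrib-*)
  open GroupProperties R.+-group using (ε⁻¹≈ε)
  open Scalars R

  q : Series
  q = 1# S.- X

  constant-cong : ∀ {a b} → a R.≈ b → constant a ≈ constant b
  constant-cong e zero    = e
  constant-cong e (suc n) = R.refl

  constant-hom : RingHom R commutativeRing
  constant-hom = record
    { ⟦_⟧     = constant
    ; ⟦⟧-cong = constant-cong
    ; +-homo  = λ a b → λ { zero → R.refl ; (suc n) → R.sym (R.+-identityˡ R.0#) }
    ; *-homo  = λ a b n → R.sym (R.trans (constant-* a (constant b) n) (product a b n))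
    ; 1-homo  = λ n → R.refl
    }
    where
    product : ∀ a b n → a R.* constant b n R.≈ constant (a R.* b) n
    product a b zero    = R.refl
    product a b (suc n) = R.zeroʳ a

  *-constant : ∀ f a n → (f * constant a) n R.≈ f n R.* a
  *-constant f a n = R.trans (*-comm f (constant a) n) (R.trans (constant-* a f n) (R.*-comm a (f n)))

  X-*-zero : ∀ f → (X * f) 0 R.≈ R.0#
  X-*-zero f = R.trans (*-head X f) (R.zeroˡ (f 0))

  X-*-suc : ∀ f n → (X * f) (suc n) R.≈ f n
  X-*-suc f n = begin
    R.0# R.* f (suc n) R.+ (shift X * f) n  ≈⟨ R.+-congʳ (R.zeroˡ _) ⟩
    R.0# R.+ (shift X * f) n                ≈⟨ R.+-identityˡ _ ⟩
    (shift X * f) n                         ≈⟨ *-cong {shift X} {1#} {f} {f} one (λ _ → R.refl) n ⟩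
    (1# * f) n                              ≈⟨ *-identityˡ f n ⟩
    f n                                     ∎
    where
    open SetoidReasoning R.setoid
    one : shift X ≈ 1#
    one zero    = R.refl
    one (suc n) = R.refl

  q-* : ∀ f → q * f ≈ f S.- X * f
  q-* f = Sˢ.solve 2 (λ x f → (Sˢ.:1 Sˢ.:- x) Sˢ.:* f Sˢ.:= f Sˢ.:- x Sˢ.:* f) S.refl X f

  q-*-zero : ∀ f → (q * f) 0 R.≈ f 0
  q-*-zero f = R.trans (q-* f 0) (R.trans
    (R.+-congˡ (R.trans (R.-‿cong (X-*-zero f)) ε⁻¹≈ε)) (R.+-identityʳ _))

  q-*-suc : ∀ f n → (q * f) (suc n) R.≈ f (suc n) R.- f n
  q-*-suc f n = R.trans (q-* f (suc n)) (R.+-congˡ (R.-‿cong (X-*-suc f n)))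

  countSeries : List Bool → Series
  countSeries s r = nat (count r s)

  nat-count-suc : ∀ r b s → nat (count (suc r) (b ∷ s)) R.≈
    nat (count r (b ∷ s)) R.+ nat (count (reach b r) s)
  nat-count-suc r b s = R.trans (R.reflexive (≡.cong nat (count-suc r b s)))
    (nat-+ (count r (b ∷ s)) (count (reach b r) s))

  nat-count-difference : ∀ r b s → nat (count (suc r) (b ∷ s)) R.- nat (count r (b ∷ s)) R.≈
    nat (count (reach b r) s)
  nat-count-difference r b s = R.trans (R.+-congʳ (nat-count-suc r b s))
    (Rˢ.solve 2 (λ a b → a Rˢ.:+ b Rˢ.:- a Rˢ.:= b) R.refl
      (nat (count r (b ∷ s))) (nat (count (reach b r) s)))

  q-*-countSeries-false : ∀ s → q * countSeries (false ∷ s) ≈ countSeries s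
  q-*-countSeries-false s zero    = R.trans (q-*-zero (countSeries (false ∷ s)))
    (R.reflexive (≡.cong nat (ℕₚ.+-identityʳ (count 0 s))))
  q-*-countSeries-false s (suc r) = R.trans (q-*-suc (countSeries (false ∷ s)) r) (nat-count-difference r false s)

  q-*-countSeries-true : ∀ s → q * countSeries (true ∷ s) ≈ X * countSeries s
  q-*-countSeries-true s zero    = R.trans (q-*-zero (countSeries (true ∷ s)))
    (R.sym (X-*-zero (countSeries s)))
  q-*-countSeries-true s (suc r) = R.trans (q-*-suc (countSeries (true ∷ s)) r)
    (R.trans (nat-count-difference r true s) (R.sym (X-*-suc (countSeries s) r)))

  -- Multiplication by `q` takes differences in the bound and so strips off the outermost sum; a
  -- strict step leaves a factor `X` behind because its sum starts one bound later.
  q^-*-countSeries : ∀ s → q ^ suc (length s) * countSeries s ≈ X ^ trues s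
  q^-*-countSeries [] = begin
    q * 1# * countSeries []  ≈⟨ S.*-congʳ {countSeries []} (S.*-identityʳ q) ⟩
    q * countSeries []       ≈⟨ one ⟩
    1#                       ∎
    where
    open SetoidReasoning S.setoid
    one : q * countSeries [] ≈ 1#
    one zero    = R.trans (q-*-zero (countSeries [])) (R.+-identityʳ R.1#)
    one (suc n) = R.trans (q-*-suc (countSeries []) n) (R.-‿inverseʳ _)
  q^-*-countSeries (b ∷ s) = begin
    q * q ^ suc (length s) * countSeries (b ∷ s)
      ≈⟨ Sˢ.solve 3 (λ x y z → x Sˢ.:* y Sˢ.:* z Sˢ.:= y Sˢ.:* (x Sˢ.:* z)) S.refl
           q (q ^ suc (length s)) (countSeries (b ∷ s)) ⟩
    q ^ suc (length s) * (q * countSeries (b ∷ s))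
      ≈⟨ step b ⟩
    X ^ trues (b ∷ s) ∎
    where
    open SetoidReasoning S.setoid
    step : ∀ b → q ^ suc (length s) * (q * countSeries (b ∷ s)) ≈ X ^ trues (b ∷ s)
    step false = S.trans (S.*-congˡ {q ^ suc (length s)} (q-*-countSeries-false s)) (q^-*-countSeries s)
    step true  = begin
      q ^ suc (length s) * (q * countSeries (true ∷ s))
        ≈⟨ S.*-congˡ {q ^ suc (length s)} (q-*-countSeries-true s) ⟩
      q ^ suc (length s) * (X * countSeries s)
        ≈⟨ Sˢ.solve 3 (λ x y z → x Sˢ.:* (y Sˢ.:* z) Sˢ.:= y Sˢ.:* (x Sˢ.:* z)) S.refl
             (q ^ suc (length s)) X (countSeries s) ⟩
      X * (q ^ suc (length s) * countSeries s)
        ≈⟨ S.*-congˡ {X} (q^-*-countSeries s) ⟩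
      X * X ^ trues s ∎

  -- The numbers of multisets and of subsets with m elements taken from N. They are read below as
  -- series in m rather than in the bound.
  weakChains strictChains : ℕ → ℕ → ℕ
  weakChains   N m = count N (chainSteps (replicate m 0))
  strictChains N m = count N (steps true not (replicate m 0))

  -- Pascal's rule for multisets: a chain of m + 1 entries below N + 1 either stays below N or
  -- begins with N and continues with any chain of m entries below N + 1.
  q^-weakChains : ∀ N → q ^ N * (λ m → nat (weakChains N m)) ≈ 1#
  q^-weakChains zero = S.trans (S.*-identityˡ (λ m → nat (weakChains 0 m)))
    λ { zero → R.+-identityʳ R.1# ; (suc m) → R.refl }
  q^-weakChains (suc N) = begin
    q * q ^ N * W (suc N)     ≈⟨ Sˢ.solve 3 (λ x y z → x Sˢ.:* y Sˢ.:* z Sˢ.:= y Sˢ.:* (x Sˢ.:* z)) S.refl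
                                   q (q ^ N) (W (suc N)) ⟩
    q ^ N * (q * W (suc N))   ≈⟨ S.*-congˡ {q ^ N} step ⟩
    q ^ N * W N               ≈⟨ q^-weakChains N ⟩
    1#                        ∎
    where
    open SetoidReasoning S.setoid
    W : ℕ → Series
    W N m = nat (weakChains N m)
    tail : ∀ N m → nat (weakChains (suc N) (suc m)) R.- nat (count N (map id (drops 0 (replicate m 0)))) R.≈
                   nat (weakChains N (suc m))
    tail N m = R.trans (R.+-congʳ (nat-count-suc N true (map id (drops 0 (replicate m 0)))))
      (Rˢ.solve 2 (λ a b → a Rˢ.:+ b Rˢ.:- b Rˢ.:= a) R.refl
        (nat (weakChains N (suc m))) (nat (count N (map id (drops 0 (replicate m 0))))))
    step : q * W (suc N) ≈ W N
    step zero          = q-*-zero (W (suc N))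
    step (suc zero)    = R.trans (q-*-suc (W (suc N)) 0) (tail N 0)
    step (suc (suc m)) = R.trans (q-*-suc (W (suc N)) (suc m)) (tail N (suc m))

  q^-coefficient : ∀ N m → (q ^ N) m R.≈ sign m R.* nat (strictChains N m)
  q^-coefficient zero    zero    = R.sym (R.trans (R.*-identityˡ _) (R.+-identityʳ _))
  q^-coefficient zero    (suc m) = R.sym (R.zeroʳ _)
  q^-coefficient (suc N) zero    = R.trans (q-*-zero (q ^ N)) (q^-coefficient N zero)
  q^-coefficient (suc N) (suc m) = begin
    (q * q ^ N) (suc m)
      ≈⟨ q-*-suc (q ^ N) m ⟩
    (q ^ N) (suc m) R.- (q ^ N) m
      ≈⟨ R.+-cong (q^-coefficient N (suc m)) (R.-‿cong (q^-coefficient N m)) ⟩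
    R.- R.1# R.* sign m R.* nat (strictChains N (suc m)) R.- sign m R.* nat (strictChains N m)
      ≈⟨ Rˢ.solve 3 (λ s a b → Rˢ.:- Rˢ.:1 Rˢ.:* s Rˢ.:* a Rˢ.:- s Rˢ.:* b Rˢ.:=
                               Rˢ.:- Rˢ.:1 Rˢ.:* s Rˢ.:* (a Rˢ.:+ b)) R.refl (sign m) _ _ ⟩
    R.- R.1# R.* sign m R.* (nat (strictChains N (suc m)) R.+ nat (strictChains N m))
      ≈⟨ R.*-congˡ (R.sym (pascal m)) ⟩
    R.- R.1# R.* sign m R.* nat (strictChains (suc N) (suc m)) ∎
    where
    open SetoidReasoning R.setoid
    pascal : ∀ m → nat (strictChains (suc N) (suc m)) R.≈
      nat (strictChains N (suc m)) R.+ nat (strictChains N m)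
    pascal zero    = nat-count-suc N true []
    pascal (suc m) = nat-count-suc N true (true ∷ map not (drops 0 (replicate m 0)))

  -- The substitution of a t for the variable t.
  rescale : R.Carrier → Series → Series
  rescale a f n = f n R.* a ^ᴿ n

  rescale-hom : R.Carrier → RingHom commutativeRing commutativeRing
  rescale-hom a = record
    { ⟦_⟧     = rescale a
    ; ⟦⟧-cong = λ e n → R.*-congʳ (e n)
    ; +-homo  = λ f g n → R.distribʳ _ _ _
    ; *-homo  = product
    ; 1-homo  = λ { zero → R.*-identityʳ R.1# ; (suc n) → R.zeroˡ _ }
    }
    where
    open SetoidReasoning R.setoid
    shift-rescale : ∀ f → shift (rescale a f) ≈ λ n → a R.* rescale a (shift f) n
    shift-rescale f n = Rˢ.solve 3 (λ x y z → x Rˢ.:* (y Rˢ.:* z) Rˢ.:= y Rˢ.:* (x Rˢ.:* z))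
      R.refl (f (suc n)) a (a ^ᴿ n)
    product : ∀ f g → rescale a (f * g) ≈ rescale a f * rescale a g
    product f g zero    = begin
      (f * g) 0 R.* R.1#                 ≈⟨ R.*-identityʳ _ ⟩
      (f * g) 0                          ≈⟨ *-head f g ⟩
      f 0 R.* g 0                        ≈⟨ R.*-cong (R.*-identityʳ _) (R.*-identityʳ _) ⟨
      rescale a f 0 R.* rescale a g 0    ≈⟨ *-head (rescale a f) (rescale a g) ⟨
      (rescale a f * rescale a g) 0      ∎
    product f g (suc n) = begin
      (f 0 R.* g (suc n) R.+ (shift f * g) n) R.* (a R.* a ^ᴿ n)
        ≈⟨ Rˢ.solve 5 (λ f g h a p → (f Rˢ.:* g Rˢ.:+ h) Rˢ.:* (a Rˢ.:* p) Rˢ.:=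
             f Rˢ.:* Rˢ.:1 Rˢ.:* (g Rˢ.:* (a Rˢ.:* p)) Rˢ.:+ a Rˢ.:* (h Rˢ.:* p))
             R.refl (f 0) (g (suc n)) ((shift f * g) n) a (a ^ᴿ n) ⟩
      rescale a f 0 R.* rescale a g (suc n) R.+ a R.* rescale a (shift f * g) n
        ≈⟨ R.+-congˡ (R.*-congˡ (product (shift f) g n)) ⟩
      rescale a f 0 R.* rescale a g (suc n) R.+ a R.* (rescale a (shift f) * rescale a g) n
        ≈⟨ R.+-congˡ (R.sym (scale-* a (rescale a (shift f)) (rescale a g) n)) ⟩
      rescale a f 0 R.* rescale a g (suc n) R.+ ((λ k → a R.* rescale a (shift f) k) * rescale a g) n
        ≈⟨ R.+-congˡ (*-cong {shift (rescale a f)} {_} {rescale a g} {rescale a g}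
             (shift-rescale f) (λ _ → R.refl) n) ⟨
      (rescale a f * rescale a g) (suc n) ∎

  rescale-constant : ∀ a b → rescale a (constant b) ≈ constant b
  rescale-constant a b zero    = R.*-identityʳ b
  rescale-constant a b (suc n) = R.zeroˡ _

  rescale-rescale : ∀ {a b} → a R.* b R.≈ R.1# → ∀ f → rescale b (rescale a f) ≈ f
  rescale-rescale {a} {b} ab f n = begin
    f n R.* a ^ᴿ n R.* b ^ᴿ n      ≈⟨ R.*-assoc _ _ _ ⟩
    f n R.* (a ^ᴿ n R.* b ^ᴿ n)    ≈⟨ R.*-congˡ (R.sym (^ᴿ-distrib-* a b n)) ⟩
    f n R.* (a R.* b) ^ᴿ n         ≈⟨ R.*-congˡ (one n) ⟩
    f n R.* R.1#                   ≈⟨ R.*-identityʳ _ ⟩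
    f n                            ∎
    where
    open SetoidReasoning R.setoid
    one : ∀ n → (a R.* b) ^ᴿ n R.≈ R.1#
    one zero    = R.refl
    one (suc n) = R.trans (R.*-cong ab (one n)) (R.*-identityˡ R.1#)

module _ {A B : CommutativeRing 0ℓ 0ℓ} (h : RingHom A B) where
  private
    module B  = CommutativeRing B
    module SA = FormalPowerSeries A
    module SB = FormalPowerSeries B
  open RingHom h

  coefficientwise : RingHom SA.commutativeRing SB.commutativeRing
  coefficientwise = record
    { ⟦_⟧     = ⟦_⟧ ∘_
    ; ⟦⟧-cong = λ e n → ⟦⟧-cong (e n)
    ; +-homo  = λ f g n → +-homo (f n) (g n)
    ; *-homo  = product
    ; 1-homo  = λ { zero → 1-homo ; (suc n) → 0-homo }
    }
    where
    product : ∀ f g n → ⟦ (f SA.* g) n ⟧ B.≈ ((⟦_⟧ ∘ f) SB.* (⟦_⟧ ∘ g)) n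
    product f g zero    = B.trans (+-homo _ _) (B.+-cong (*-homo _ _) 0-homo)
    product f g (suc n) = B.trans (+-homo _ _) (B.+-cong (*-homo _ _) (product (SA.shift f) g n))

  coefficientwise-constant : ∀ a → (⟦_⟧ ∘ SA.constant a) SB.≈ SB.constant ⟦ a ⟧
  coefficientwise-constant a zero    = B.refl
  coefficientwise-constant a (suc n) = 0-homo

  coefficientwise-X : (⟦_⟧ ∘ SA.X) SB.≈ SB.X
  coefficientwise-X zero          = 0-homo
  coefficientwise-X (suc zero)    = 1-homo
  coefficientwise-X (suc (suc n)) = 0-homo

  coefficientwise-q : (⟦_⟧ ∘ SeriesLemmas.q A) SB.≈ SeriesLemmas.q B
  coefficientwise-q = S.trans {⟦_⟧ ∘ SeriesLemmas.q A}
    (H.sub-homo SA.1# SA.X)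
    (S.+-cong H.1-homo (S.-‿cong coefficientwise-X))
    where
    module S = CommutativeRing SB.commutativeRing
    module H = RingHom coefficientwise

-- Generating functions over permutations

count-suc-true : ∀ r φ xs → count (suc r) (steps true φ xs) ≡ count r (steps false φ xs)
count-suc-true r φ []       = ≡.refl
count-suc-true r φ (x ∷ xs) = ≡.refl

trues-steps : ∀ {n} (π : Permutation′ n) → trues (steps false id (word π)) ≡ descents π
trues-steps {zero}  π = ≡.refl
trues-steps {suc n} π = ≡.trans (≡.cong trues (Listₚ.map-id (descentSteps (word π)))) (≡.sym (descents-trues π))

length-steps-word : ∀ b φ {n} (π : Permutation′ n) → length (steps b φ (word π)) ≡ n
length-steps-word b φ π = ≡.trans (length-steps b φ (word π)) (length-word π)

module WordSeries (R : CommutativeRing 0ℓ 0ℓ) where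
  private
    module F = FormalPowerSeries R
    module A = CommutativeRing F.commutativeRing
    module L = SeriesLemmas R
  open Exponentiation A.semiring using () renaming (_^_ to _^ᴬ_)

  -- A weak first step in place of the strict one makes coefficient r count the chains below r + 1.
  -- The series thus begin with bound 1, matching the exponents n - 1 and k - 1 of the double
  -- series, and the first step contributes no power of the variable.
  q^-*-countSeries-word : ∀ {m} (π : Permutation′ m) →
    L.q ^ᴬ suc m A.* L.countSeries (steps false id (word π)) A.≈ F.X ^ᴬ descents π
  q^-*-countSeries-word {m} π =
    A.trans (A.reflexive (≡.cong (λ l → L.q ^ᴬ suc l A.* L.countSeries (steps false id (word π)))
              (≡.sym (length-steps-word false id π))))
    (A.trans (L.q^-*-countSeries (steps false id (word π)))
             (A.reflexive (≡.cong (F.X ^ᴬ_) (trues-steps π))))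

module PermutationSeries (R : CommutativeRing 0ℓ 0ℓ) where
  private
    module R = CommutativeRing R
    module F = FormalPowerSeries R
    module A = CommutativeRing F.commutativeRing
    module L = SeriesLemmas R
    module Aˢ = IntegerRingSolver F.commutativeRing
    module Rᶜ = Scalars R
    module Aᶜ = Scalars F.commutativeRing
    module G = FormalPowerSeries F.commutativeRing
    module B = CommutativeRing G.commutativeRing
    module M = SeriesLemmas F.commutativeRing
    module Bˢ = IntegerRingSolver G.commutativeRing
    module Bᶜ = Scalars G.commutativeRing
    module W  = WordSeries R
    module WM = WordSeries F.commutativeRing
    module K = RingHom (L.constant-hom)
    module N = RingHom (M.constant-hom)
  open Exponentiation A.semiring using () renaming (_^_ to _^ᴬ_)
  open Exponentiation B.semiring using () renaming (_^_ to _^ᴮ_)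

  ∑ᴸ-coefficient : ∀ {X : Set} (xs : List X) (f : X → F.Series) n →
    Aᶜ.∑ᴸ xs f n R.≈ Rᶜ.∑ᴸ xs (λ x → f x n)
  ∑ᴸ-coefficient []       f n = R.refl
  ∑ᴸ-coefficient (x ∷ xs) f n = R.+-congˡ (∑ᴸ-coefficient xs f n)

  nat-* : ∀ c f n → (Aᶜ.nat c F.* f) n R.≈ Rᶜ.nat c R.* f n
  nat-* c f n = R.trans
    (F.*-cong {Aᶜ.nat c} {F.constant (Rᶜ.nat c)} {f} {f} (A.sym (K.×1-homo c)) (λ _ → R.refl) n)
    (F.constant-* (Rᶜ.nat c) f n)

  -- Only the bound of the sorted words becomes an exponent, that of x; the bound j stays a number
  -- because it is the index of Γⱼ.
  strictChains-expansion : ∀ m j →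
    L.q ^ᴬ suc m A.* (λ l → Rᶜ.nat (L.strictChains (j ℕ.* suc l) m)) A.≈
    Aᶜ.∑ᴸ (permutations m) (λ π →
      Aᶜ.nat (count j (steps true not (word π))) A.* F.X ^ᴬ inverseDescents π)
  strictChains-expansion m j = begin
    L.q ^ᴬ suc m A.* (λ l → Rᶜ.nat (L.strictChains (j ℕ.* suc l) m))
      ≈⟨ A.*-congˡ {L.q ^ᴬ suc m} expand ⟩
    L.q ^ᴬ suc m A.* Aᶜ.∑ᴸ (permutations m) (λ π → a π A.* c π)
      ≈⟨ Aᶜ.*-distribˡ-∑ᴸ (permutations m) (L.q ^ᴬ suc m) (λ π → a π A.* c π) ⟩
    Aᶜ.∑ᴸ (permutations m) (λ π → L.q ^ᴬ suc m A.* (a π A.* c π))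
      ≈⟨ Aᶜ.∑ᴸ-cong (permutations m) (λ π → A.trans
           (Aˢ.solve 3 (λ x y z → x Aˢ.:* (y Aˢ.:* z) Aˢ.:= y Aˢ.:* (x Aˢ.:* z)) A.refl
              (L.q ^ᴬ suc m) (a π) (c π))
           (A.*-congˡ {a π} (W.q^-*-countSeries-word (Perm.flip π)))) ⟩
    Aᶜ.∑ᴸ (permutations m) (λ π → a π A.* F.X ^ᴬ inverseDescents π) ∎
    where
    open SetoidReasoning A.setoid
    a c : Permutation′ m → F.Series
    a π = Aᶜ.nat (count j (steps true not (word π)))
    c π = L.countSeries (steps false id (word (Perm.flip π)))

    expand : (λ l → Rᶜ.nat (L.strictChains (j ℕ.* suc l) m)) A.≈
             Aᶜ.∑ᴸ (permutations m) (λ π → a π A.* c π)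
    expand l = R.trans (R.reflexive (≡.cong Rᶜ.nat (≡.sym (∑-count-strict m j (suc l)))))
      (R.trans (Rᶜ.nat-∑ᴸ (permutations m) _)
      (R.trans (Rᶜ.∑ᴸ-cong (permutations m) (λ π → R.trans
        (Rᶜ.nat-* (count j (steps true not (word π))) (count (suc l) (chainSteps (word (Perm.flip π)))))
        (R.trans (R.*-congˡ (R.reflexive (≡.cong Rᶜ.nat
                   (count-suc-true l id (word (Perm.flip π))))))
                 (R.sym (nat-* (count j (steps true not (word π))) (c π) l)))))
      (R.sym (∑ᴸ-coefficient (permutations m) _ l))))

  weakChains-expansion : ∀ m →
    M.q ^ᴮ suc m B.* G.constant (L.q ^ᴬ suc m) B.*
      (λ k l → Rᶜ.nat (L.weakChains (suc k ℕ.* suc l) m)) B.≈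
    Bᶜ.∑ᴸ (permutations m) (λ π →
      G.X ^ᴮ descents π B.* G.constant (F.X ^ᴬ inverseDescents π))
  weakChains-expansion m = begin
    M.q ^ᴮ suc m B.* G.constant (L.q ^ᴬ suc m) B.*
      (λ k l → Rᶜ.nat (L.weakChains (suc k ℕ.* suc l) m))
      ≈⟨ B.*-congˡ {d} expand ⟩
    d B.* Bᶜ.∑ᴸ (permutations m) (λ π → a π B.* G.constant (c π))
      ≈⟨ Bᶜ.*-distribˡ-∑ᴸ (permutations m) d (λ π → a π B.* G.constant (c π)) ⟩
    Bᶜ.∑ᴸ (permutations m) (λ π → d B.* (a π B.* G.constant (c π)))
      ≈⟨ Bᶜ.∑ᴸ-cong (permutations m) (λ π → B.trans
           (Bˢ.solve 4 (λ x y z w → (x Bˢ.:* y) Bˢ.:* (z Bˢ.:* w) Bˢ.:= (x Bˢ.:* z) Bˢ.:* (y Bˢ.:* w))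
              B.refl (M.q ^ᴮ suc m) (G.constant (L.q ^ᴬ suc m)) (a π) (G.constant (c π)))
           (B.*-cong {M.q ^ᴮ suc m B.* a π} (WM.q^-*-countSeries-word π)
             (B.trans (B.sym (N.*-homo (L.q ^ᴬ suc m) (c π)))
                      (N.⟦⟧-cong (W.q^-*-countSeries-word (Perm.flip π)))))) ⟩
    Bᶜ.∑ᴸ (permutations m) (λ π →
      G.X ^ᴮ descents π B.* G.constant (F.X ^ᴬ inverseDescents π)) ∎
    where
    open SetoidReasoning B.setoid
    d : G.Series
    d = M.q ^ᴮ suc m B.* G.constant (L.q ^ᴬ suc m)
    a : Permutation′ m → G.Series
    a π = M.countSeries (steps false id (word π))
    c : Permutation′ m → F.Series
    c π = L.countSeries (steps false id (word (Perm.flip π)))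

    term-coefficient : ∀ π k l → (a π B.* G.constant (c π)) k l R.≈
      Rᶜ.nat (count (suc k) (chainSteps (word π))) R.*
      Rᶜ.nat (count (suc l) (chainSteps (word (Perm.flip π))))
    term-coefficient π k l = R.trans (M.*-constant (a π) (c π) k l)
      (R.trans (nat-* (count k (steps false id (word π))) (c π) l)
        (R.reflexive (≡.cong₂ (λ v w → Rᶜ.nat v R.* Rᶜ.nat w)
          (≡.sym (count-suc-true k id (word π)))
          (≡.sym (count-suc-true l id (word (Perm.flip π)))))))

    expand : (λ k l → Rᶜ.nat (L.weakChains (suc k ℕ.* suc l) m)) B.≈
             Bᶜ.∑ᴸ (permutations m) (λ π → a π B.* G.constant (c π))
    expand k l = R.trans (R.reflexive (≡.cong Rᶜ.nat (≡.sym (∑-count-weak m (suc k) (suc l)))))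
      (R.trans (Rᶜ.nat-∑ᴸ (permutations m) _)
      (R.trans (Rᶜ.∑ᴸ-cong (permutations m) (λ π → R.trans
        (Rᶜ.nat-* (count (suc k) (chainSteps (word π))) (count (suc l) (chainSteps (word (Perm.flip π)))))
        (R.sym (term-coefficient π k l))))
      (R.sym (coefficient (permutations m) k l))))
      where
      coefficient : ∀ xs k l → Bᶜ.∑ᴸ xs (λ π → a π B.* G.constant (c π)) k l R.≈
        Rᶜ.∑ᴸ xs (λ π → (a π B.* G.constant (c π)) k l)
      coefficient []       k l = R.refl
      coefficient (x ∷ xs) k l = R.+-congˡ (coefficient xs k l)

coeff-hom : (R : CommutativeRing 0ℓ 0ℓ) →
  RingHom (Polynomials.commutativeRing R) (FormalPowerSeries.commutativeRing R)
coeff-hom R = record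
  { ⟦_⟧     = Pol.coeff
  ; ⟦⟧-cong = id
  ; +-homo  = λ p q n → R.refl
  ; *-homo  = λ p q n → R.refl
  ; 1-homo  = λ n → R.refl
  }
  where
  module R = CommutativeRing R
  module Pol = Polynomials R

-- The series Γⱼ and its polynomial numerators

-- Y = ∑ₗ xˡ qʲ⁽ˡ⁺¹⁾ as a power series in t over R⟦x⟧, where q = 1 - t.
module GeometricSeries (R : CommutativeRing 0ℓ 0ℓ) where
  private
    module R = CommutativeRing R
    module F = FormalPowerSeries R
    module A = CommutativeRing F.commutativeRing
    module L = SeriesLemmas R
    module G = FormalPowerSeries F.commutativeRing
    module B = CommutativeRing G.commutativeRing
    module M = SeriesLemmas F.commutativeRing
  open Exponentiation A.semiring using (^-homo-*) renaming (_^_ to _^ᴬ_)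
  open Exponentiation B.semiring using () renaming (_^_ to _^ᴮ_)

  Y : ℕ → G.Series
  Y j m l = (L.q ^ᴬ (j ℕ.* suc l)) m

  -- `F` plays two roles, R⟦t⟧ for b and R⟦x⟧ for the coefficients of f. A series in t that is free
  -- of x multiplies the coefficient of each xˡ separately.
  scalars-* : ∀ b (f : G.Series) m l →
    ((F.constant ∘ b) G.* f) m l R.≈ (b F.* (λ i → f i l)) m
  scalars-* b f zero    l = R.trans (G.*-head (F.constant ∘ b) f l)
    (R.trans (F.constant-* (b 0) (f 0) l) (R.sym (F.*-head b (λ i → f i l))))
  scalars-* b f (suc m) l =
    R.+-cong (F.constant-* (b 0) (f (suc m)) l) (scalars-* (F.shift b) f m l)

  q^-constants : ∀ j → M.q ^ᴮ j B.≈ F.constant ∘ (L.q ^ᴬ j)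
  q^-constants j = B.trans
    (Exponentiation.^-congˡ B.semiring j (B.sym (coefficientwise-q L.constant-hom)))
    (B.sym (RingHom.^-homo (coefficientwise L.constant-hom) L.q j))

  q^-*-Y : ∀ j m l → (M.q ^ᴮ j B.* Y j) m l R.≈ Y j m (suc l)
  q^-*-Y j m l = R.trans
    (G.*-cong {M.q ^ᴮ j} {F.constant ∘ (L.q ^ᴬ j)} {Y j} {Y j} (q^-constants j) (λ _ _ → R.refl) m l)
    (R.trans (scalars-* (L.q ^ᴬ j) (Y j) m l)
    (R.trans (A.sym (^-homo-* L.q j (j ℕ.* suc l)) m)
             (R.reflexive (≡.cong (λ N → (L.q ^ᴬ N) m) (≡.sym (ℕₚ.*-suc j (suc l)))))))

  -- Multiplying by qʲ replaces each coefficient by the one of the next power of x; the factor x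
  -- restores the exponents and leaves out only the coefficient qʲ of x⁰. So Y is Γⱼ expanded in
  -- powers of x.
  Y-geometric : ∀ j → Y j B.≈ M.q ^ᴮ j B.+ G.constant F.X B.* (M.q ^ᴮ j B.* Y j)
  Y-geometric j m zero = R.sym (R.trans
    (R.+-cong (q^-constants j m 0)
              (R.trans (G.constant-* F.X (M.q ^ᴮ j B.* Y j) m 0) (L.X-*-zero ((M.q ^ᴮ j B.* Y j) m))))
    (R.trans (R.+-identityʳ _)
             (R.reflexive (≡.cong (λ N → (L.q ^ᴬ N) m) (≡.sym (ℕₚ.*-identityʳ j))))))
  Y-geometric j m (suc l) = R.sym (R.trans
    (R.+-cong (q^-constants j m (suc l))
              (R.trans (G.constant-* F.X (M.q ^ᴮ j B.* Y j) m (suc l)) (L.X-*-suc ((M.q ^ᴮ j B.* Y j) m) l)))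
    (R.trans (R.+-identityˡ _) (q^-*-Y j m l)))

-- γⱼ(t) = (1-x) Y((1-x)t) has polynomial coefficients.
module StrictNumerators (R : CommutativeRing 0ℓ 0ℓ) where
  private
    module R  = CommutativeRing R
    module F  = FormalPowerSeries R
    module A  = CommutativeRing F.commutativeRing
    module L  = SeriesLemmas R
    module Rᶜ = Scalars R
    module Aᶜ = Scalars F.commutativeRing
    module Aˢ = IntegerRingSolver F.commutativeRing
    module G  = FormalPowerSeries F.commutativeRing
    module B  = CommutativeRing G.commutativeRing
    module Bˢ = IntegerRingSolver G.commutativeRing
    module M  = SeriesLemmas F.commutativeRing
    module P  = Polynomials R
    module Q  = CommutativeRing P.commutativeRing
    module Qᶜ = Scalars P.commutativeRing
    module H  = FormalPowerSeries P.commutativeRing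
    module C  = CommutativeRing H.commutativeRing
    module N  = SeriesLemmas P.commutativeRing
    module h  = RingHom (coeff-hom R)
    module hᵗ = RingHom (coefficientwise (coeff-hom R))
    module ρ  = RingHom (M.rescale-hom L.q)
    module K  = RingHom L.constant-hom
  open Exponentiation Q.semiring using () renaming (_^_ to _^ᵠ_)
  open Exponentiation A.semiring using () renaming (_^_ to _^ᴬ_)
  open Exponentiation B.semiring using () renaming (_^_ to _^ᴮ_)
  open Exponentiation C.semiring using () renaming (_^_ to _^ᶜ_)
  open GeometricSeries R

  1-x : Q.Carrier
  1-x = Q.1# Q.- P.X

  numerator : ℕ → ℕ → Q.Carrier
  numerator j m = Qᶜ.∑ᴸ (permutations m) λ π →
    Qᶜ.nat (count j (steps true not (word π))) Q.* P.X ^ᵠ inverseDescents π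

  γ : ℕ → H.Series
  γ j m = Qᶜ.sign m Q.* numerator j m

  -- The coefficient of tᵐ xˡ in Y is a binomial coefficient with the sign (-1)ᵐ, that is, a signed
  -- count of strict chains below j (l + 1). `strictChains-expansion` sums these counts over l to a
  -- polynomial divided by (1 - x)ᵐ⁺¹.
  coeff-γ : ∀ j m → h.⟦ γ j m ⟧ A.≈ L.q ^ᴬ suc m A.* Y j m
  coeff-γ j m = begin
    h.⟦ γ j m ⟧
      ≈⟨ h.*-homo (Qᶜ.sign m) (numerator j m) ⟩
    h.⟦ Qᶜ.sign m ⟧ A.* h.⟦ numerator j m ⟧
      ≈⟨ A.*-cong {h.⟦ Qᶜ.sign m ⟧} coeff-sign (h.∑ᴸ-homo (permutations m) _) ⟩
    Aᶜ.sign m A.* Aᶜ.∑ᴸ (permutations m) (λ π →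
      h.⟦ Qᶜ.nat (count j (steps true not (word π))) Q.* P.X ^ᵠ inverseDescents π ⟧)
      ≈⟨ A.*-congˡ {Aᶜ.sign m} (Aᶜ.∑ᴸ-cong (permutations m) λ π →
           A.*-cong {h.⟦ Qᶜ.nat (count j (steps true not (word π))) ⟧}
             (h.×1-homo (count j (steps true not (word π))))
             (h.^-homo P.X (inverseDescents π))) ⟩
    Aᶜ.sign m A.* Aᶜ.∑ᴸ (permutations m) (λ π →
      Aᶜ.nat (count j (steps true not (word π))) A.* F.X ^ᴬ inverseDescents π)
      ≈⟨ A.*-congˡ {Aᶜ.sign m} (PermutationSeries.strictChains-expansion R m j) ⟨
    Aᶜ.sign m A.* (L.q ^ᴬ suc m A.* S)
      ≈⟨ Aˢ.solve 3 (λ s a b → s Aˢ.:* (a Aˢ.:* b) Aˢ.:= a Aˢ.:* (s Aˢ.:* b)) A.refl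
           (Aᶜ.sign m) (L.q ^ᴬ suc m) S ⟩
    L.q ^ᴬ suc m A.* (Aᶜ.sign m A.* S)
      ≈⟨ A.*-congˡ {L.q ^ᴬ suc m} signed ⟩
    L.q ^ᴬ suc m A.* Y j m ∎
    where
    open SetoidReasoning A.setoid
    S : F.Series
    S l = Rᶜ.nat (L.strictChains (j ℕ.* suc l) m)

    coeff-sign : h.⟦ Qᶜ.sign m ⟧ A.≈ Aᶜ.sign m
    coeff-sign = h.^-homo (Q.- Q.1#) m

    constant-sign : Aᶜ.sign m A.≈ F.constant (Rᶜ.sign m)
    constant-sign = A.sym (A.trans (K.^-homo (R.- R.1#) m)
      (Exponentiation.^-congˡ A.semiring m (A.trans (K.-‿homo R.1#) (A.-‿cong K.1-homo))))

    signed : Aᶜ.sign m A.* S A.≈ Y j m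
    signed l = R.trans (F.*-cong {Aᶜ.sign m} {F.constant (Rᶜ.sign m)} {S} {S} constant-sign (λ _ → R.refl) l)
      (R.trans (F.constant-* (Rᶜ.sign m) S l) (R.sym (L.q^-coefficient (j ℕ.* suc l) m)))

  private
    x̂ q̂ : G.Series
    x̂ = G.constant F.X
    q̂ = G.constant L.q

  series-γ : ∀ j → hᵗ.⟦ γ j ⟧ B.≈ q̂ B.* M.rescale L.q (Y j)
  series-γ j m = begin
    h.⟦ γ j m ⟧                        ≈⟨ coeff-γ j m ⟩
    L.q A.* L.q ^ᴬ m A.* Y j m         ≈⟨ Aˢ.solve 3 (λ a b c → a Aˢ.:* b Aˢ.:* c Aˢ.:= a Aˢ.:* (c Aˢ.:* b))
                                            A.refl L.q (L.q ^ᴬ m) (Y j m) ⟩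
    L.q A.* M.rescale L.q (Y j) m      ≈⟨ G.constant-* L.q (M.rescale L.q (Y j)) m ⟨
    (q̂ B.* M.rescale L.q (Y j)) m      ∎
    where open SetoidReasoning A.setoid

  rescale-Y : ∀ j → M.rescale L.q (Y j) B.≈
    M.rescale L.q M.q ^ᴮ j B.+ x̂ B.* (M.rescale L.q M.q ^ᴮ j B.* M.rescale L.q (Y j))
  rescale-Y j = begin
    ρ.⟦ Y j ⟧
      ≈⟨ ρ.⟦⟧-cong (Y-geometric j) ⟩
    ρ.⟦ M.q ^ᴮ j B.+ x̂ B.* (M.q ^ᴮ j B.* Y j) ⟧
      ≈⟨ ρ.+-homo (M.q ^ᴮ j) (x̂ B.* (M.q ^ᴮ j B.* Y j)) ⟩
    ρ.⟦ M.q ^ᴮ j ⟧ B.+ ρ.⟦ x̂ B.* (M.q ^ᴮ j B.* Y j) ⟧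
      ≈⟨ B.+-cong (ρ.^-homo M.q j) (B.trans (ρ.*-homo x̂ (M.q ^ᴮ j B.* Y j))
           (B.*-cong {ρ.⟦ x̂ ⟧} (M.rescale-constant L.q F.X)
             (B.trans (ρ.*-homo (M.q ^ᴮ j) (Y j))
                      (B.*-congʳ {ρ.⟦ Y j ⟧} (ρ.^-homo M.q j))))) ⟩
    ρ.⟦ M.q ⟧ ^ᴮ j B.+ x̂ B.* (ρ.⟦ M.q ⟧ ^ᴮ j B.* ρ.⟦ Y j ⟧) ∎
    where open SetoidReasoning B.setoid

  series-rescale-q : hᵗ.⟦ N.rescale 1-x N.q ⟧ B.≈ M.rescale L.q M.q
  series-rescale-q m = A.trans {h.⟦ N.rescale 1-x N.q m ⟧}
    (h.*-homo (N.q m) (1-x ^ᵠ m))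
    (A.*-cong {h.⟦ N.q m ⟧} (coefficientwise-q (coeff-hom R) m) (h.^-homo 1-x m))

  -- Coefficientwise, equality of polynomials is equality of power series.
  γ-geometric : ∀ j → γ j C.≈
    H.constant 1-x C.* N.rescale 1-x N.q ^ᶜ j C.+ H.constant P.X C.* (N.rescale 1-x N.q ^ᶜ j C.* γ j)
  γ-geometric j = begin
    hᵗ.⟦ γ j ⟧
      ≈⟨ series-γ j ⟩
    q̂ B.* y
      ≈⟨ B.*-congˡ {q̂} (rescale-Y j) ⟩
    q̂ B.* (p B.+ x̂ B.* (p B.* y))
      ≈⟨ Bˢ.solve 4 (λ q x p y → q Bˢ.:* (p Bˢ.:+ x Bˢ.:* (p Bˢ.:* y)) Bˢ.:=
                                 q Bˢ.:* p Bˢ.:+ x Bˢ.:* (p Bˢ.:* (q Bˢ.:* y))) B.refl q̂ x̂ p y ⟩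
    q̂ B.* p B.+ x̂ B.* (p B.* (q̂ B.* y))
      ≈⟨ B.+-cong
           (B.*-cong {q̂} (B.sym {hᵗ.⟦ H.constant 1-x ⟧} (coefficientwise-constant (coeff-hom R) 1-x)) p≈)
           (B.*-cong {x̂} (B.sym {hᵗ.⟦ H.constant P.X ⟧} (coefficientwise-constant (coeff-hom R) P.X))
             (B.*-cong {p} p≈ (B.sym {hᵗ.⟦ γ j ⟧} (series-γ j)))) ⟩
    hᵗ.⟦ H.constant 1-x ⟧ B.* hᵗ.⟦ Q^j ⟧ B.+ hᵗ.⟦ H.constant P.X ⟧ B.* (hᵗ.⟦ Q^j ⟧ B.* hᵗ.⟦ γ j ⟧)
      ≈⟨ B.+-cong (hᵗ.*-homo (H.constant 1-x) Q^j)
           (B.trans {hᵗ.⟦ H.constant P.X C.* (Q^j C.* γ j) ⟧}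
             (hᵗ.*-homo (H.constant P.X) (Q^j C.* γ j))
             (B.*-congˡ {hᵗ.⟦ H.constant P.X ⟧} (hᵗ.*-homo Q^j (γ j)))) ⟨
    hᵗ.⟦ H.constant 1-x C.* Q^j ⟧ B.+ hᵗ.⟦ H.constant P.X C.* (Q^j C.* γ j) ⟧
      ≈⟨ hᵗ.+-homo (H.constant 1-x C.* Q^j) (H.constant P.X C.* (Q^j C.* γ j)) ⟨
    hᵗ.⟦ H.constant 1-x C.* Q^j C.+ H.constant P.X C.* (Q^j C.* γ j) ⟧ ∎
    where
    open SetoidReasoning B.setoid
    y p : G.Series
    y = M.rescale L.q (Y j)
    p = M.rescale L.q M.q ^ᴮ j
    Q^j : H.Series
    Q^j = N.rescale 1-x N.q ^ᶜ j
    p≈ : p B.≈ hᵗ.⟦ Q^j ⟧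
    p≈ = B.sym {hᵗ.⟦ Q^j ⟧} (B.trans {hᵗ.⟦ Q^j ⟧} (hᵗ.^-homo (N.rescale 1-x N.q) j)
      (Exponentiation.^-congˡ B.semiring j series-rescale-q))

module _ {A B : CommutativeRing 0ℓ 0ℓ} (h : RingHom A B) where
  private
    module A  = CommutativeRing A
    module B  = CommutativeRing B
    module FA = FormalPowerSeries A
    module FB = FormalPowerSeries B
    module SA = CommutativeRing FA.commutativeRing
    module SB = CommutativeRing FB.commutativeRing
    module LA = SeriesLemmas A
    module LB = SeriesLemmas B
    module Sˢ = IntegerRingSolver FB.commutativeRing
    module h  = RingHom h
  open Exponentiation A.semiring using () renaming (_^_ to _^ᴬ_)
  open Exponentiation B.semiring using () renaming (_^_ to _^ᴮ_)
  open Exponentiation SA.semiring using () renaming (_^_ to _^ˢᴬ_)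
  open Exponentiation SB.semiring using () renaming (_^_ to _^ˢᴮ_)

  -- The series κ f(κ t), which for κ = 1/a undoes the passage from f to a f(a t).
  unscale : B.Carrier → FA.Series → FB.Series
  unscale κ f m = h.⟦ f m ⟧ B.* κ ^ᴮ suc m

  -- Substituting κ t for t turns the rescaled `q` back into 1 - t, and the outer factor κ cancels
  -- the a in front of the first term.
  unscale-geometric : ∀ {a κ} → h.⟦ a ⟧ B.* κ B.≈ B.1# → ∀ x j f →
    f SA.≈ FA.constant a SA.* LA.rescale a LA.q ^ˢᴬ j SA.+
           FA.constant x SA.* (LA.rescale a LA.q ^ˢᴬ j SA.* f) →
    unscale κ f SB.≈ LB.q ^ˢᴮ j SB.+ FB.constant h.⟦ x ⟧ SB.* (LB.q ^ˢᴮ j SB.* unscale κ f)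
  unscale-geometric {a} {κ} aκ x j f e = begin
    unscale κ f
      ≈⟨ unscale-rescale ⟩
    κ̂ SB.* ψ f
      ≈⟨ SB.*-congˡ {κ̂} (SB.trans (Ψ.⟦⟧-cong e) expand) ⟩
    κ̂ SB.* (FB.constant h.⟦ a ⟧ SB.* p SB.+ FB.constant h.⟦ x ⟧ SB.* (p SB.* ψ f))
      ≈⟨ Sˢ.solve 5 (λ k a p x f → k Sˢ.:* (a Sˢ.:* p Sˢ.:+ x Sˢ.:* (p Sˢ.:* f)) Sˢ.:=
           a Sˢ.:* k Sˢ.:* p Sˢ.:+ x Sˢ.:* (p Sˢ.:* (k Sˢ.:* f))) SB.refl
           κ̂ (FB.constant h.⟦ a ⟧) p (FB.constant h.⟦ x ⟧) (ψ f) ⟩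
    FB.constant h.⟦ a ⟧ SB.* κ̂ SB.* p SB.+ FB.constant h.⟦ x ⟧ SB.* (p SB.* (κ̂ SB.* ψ f))
      ≈⟨ SB.+-cong (SB.trans (SB.*-congʳ {p} one) (SB.*-identityˡ p))
           (SB.*-congˡ {FB.constant h.⟦ x ⟧} (SB.*-congˡ {p} (SB.sym unscale-rescale))) ⟩
    p SB.+ FB.constant h.⟦ x ⟧ SB.* (p SB.* unscale κ f) ∎
    where
    open SetoidReasoning SB.setoid
    κ̂ p : FB.Series
    κ̂ = FB.constant κ
    p = LB.q ^ˢᴮ j
    module Ψ = RingHom (LB.rescale-hom κ ∘ᴴ coefficientwise h)
    ψ : FA.Series → FB.Series
    ψ = Ψ.⟦_⟧
    Q^j : FA.Series
    Q^j = LA.rescale a LA.q ^ˢᴬ j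

    one : FB.constant h.⟦ a ⟧ SB.* κ̂ SB.≈ SB.1#
    one = SB.trans (SB.sym (RingHom.*-homo LB.constant-hom h.⟦ a ⟧ κ)) (LB.constant-cong aκ)

    unscale-rescale : unscale κ f SB.≈ κ̂ SB.* ψ f
    unscale-rescale m = B.trans (IntegerRingSolver.solve B 3
      (λ f k p → f :* (k :* p) := k :* (f :* p)) B.refl h.⟦ f m ⟧ κ (κ ^ᴮ m))
      (B.sym (FB.constant-* κ (ψ f) m))
      where open IntegerRingSolver B

    ψ-constant : ∀ b → ψ (FA.constant b) SB.≈ FB.constant h.⟦ b ⟧
    ψ-constant b = SB.trans (RingHom.⟦⟧-cong (LB.rescale-hom κ) (coefficientwise-constant h b))
      (LB.rescale-constant κ h.⟦ b ⟧)

    ψ-q : ψ (LA.rescale a LA.q) SB.≈ LB.q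
    ψ-q = SB.trans
      (RingHom.⟦⟧-cong (LB.rescale-hom κ) (λ m → B.trans (h.*-homo (LA.q m) (a ^ᴬ m))
        (B.*-cong (coefficientwise-q h m) (h.^-homo a m))))
      (LB.rescale-rescale aκ LB.q)

    ψ-Q^j : ψ Q^j SB.≈ p
    ψ-Q^j = SB.trans (Ψ.^-homo (LA.rescale a LA.q) j) (Exponentiation.^-congˡ SB.semiring j ψ-q)

    expand : ψ (FA.constant a SA.* Q^j SA.+ FA.constant x SA.* (Q^j SA.* f)) SB.≈
      FB.constant h.⟦ a ⟧ SB.* p SB.+ FB.constant h.⟦ x ⟧ SB.* (p SB.* ψ f)
    expand = SB.trans (Ψ.+-homo (FA.constant a SA.* Q^j) (FA.constant x SA.* (Q^j SA.* f)))
      (SB.+-cong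
        (SB.trans (Ψ.*-homo (FA.constant a) Q^j)
          (SB.*-cong {ψ (FA.constant a)} (ψ-constant a) ψ-Q^j))
        (SB.trans (Ψ.*-homo (FA.constant x) (Q^j SA.* f))
          (SB.*-cong {ψ (FA.constant x)} (ψ-constant x)
            (SB.trans (Ψ.*-homo Q^j f) (SB.*-congʳ {ψ f} ψ-Q^j)))))

-- Telescoping of the middle series

Inverse : (R : CommutativeRing 0ℓ 0ℓ) (a b : CommutativeRing.Carrier R) → Set
Inverse R a b = a * b ≈ 1#
  where open CommutativeRing R

module _ (R : CommutativeRing 0ℓ 0ℓ) where
  open CommutativeRing R
  open Exponentiation semiring using (_^_)
  open SetoidReasoning setoid

  inverse-^ : ∀ {a b} → b * a ≈ 1# → ∀ n → b ^ n * a ^ n ≈ 1#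
  inverse-^ {a} {b} ba zero    = *-identityˡ 1#
  inverse-^ {a} {b} ba (suc n) = begin
    b * b ^ n * (a * a ^ n)    ≈⟨ solve 4 (λ b B a A → b :* B :* (a :* A) := (b :* a) :* (B :* A)) refl _ _ _ _ ⟩
    b * a * (b ^ n * a ^ n)    ≈⟨ *-cong ba (inverse-^ ba n) ⟩
    1# * 1#                    ≈⟨ *-identityˡ 1# ⟩
    1#                         ∎
    where open IntegerRingSolver R

  inverse-unique : ∀ {a b c} → b * a ≈ 1# → a * c ≈ 1# → b ≈ c
  inverse-unique {a} {b} {c} ba ac = begin
    b            ≈⟨ *-identityʳ b ⟨
    b * 1#       ≈⟨ *-congˡ ac ⟨
    b * (a * c)  ≈⟨ *-assoc b a c ⟨
    b * a * c    ≈⟨ *-congʳ ba ⟩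
    1# * c       ≈⟨ *-identityˡ c ⟩
    c            ∎

  cancel-inverse : ∀ {a b c d} → c * d ≈ 1# → a * d ≈ b * d → a ≈ b
  cancel-inverse {a} {b} {c} {d} cd e = begin
    a              ≈⟨ *-identityʳ a ⟨
    a * 1#         ≈⟨ *-congˡ cd ⟨
    a * (c * d)    ≈⟨ solve 3 (λ a c d → a :* (c :* d) := a :* d :* c) refl a c d ⟩
    a * d * c      ≈⟨ *-congʳ e ⟩
    b * d * c      ≈⟨ solve 3 (λ a c d → a :* d :* c := a :* (c :* d)) refl b c d ⟩
    b * (c * d)    ≈⟨ *-congˡ cd ⟩
    b * 1#         ≈⟨ *-identityʳ b ⟩
    b              ∎
    where open IntegerRingSolver R

-- With Γⱼ = qʲ / (1 - x qʲ), the summand of index n is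
-- (Γₙ₋₁ - Γₙ) / ((u - 1) uⁿ), so that the series almost telescopes.
module MiddleTelescoping (R : CommutativeRing 0ℓ 0ℓ)
  (x u [u-1]⁻¹ : CommutativeRing.Carrier R)
  (1-x-unit : RegularElements.Unit R
                (CommutativeRing._-_ R (CommutativeRing.1# R) x))
  (u-unit : RegularElements.Unit R u) where
  private
    module R = CommutativeRing R
    module F = FormalPowerSeries R
    module T = CommutativeRing F.commutativeRing
    module L = SeriesLemmas R
    module K = RingHom L.constant-hom
  open MiddleTerms R x u [u-1]⁻¹ 1-x-unit u-unit
  open Exponentiation T.semiring using (_^_)
  open Exponentiation R.semiring using () renaming (_^_ to _^ᴿ_)
  open IntegerRingSolver F.commutativeRing
  open SetoidReasoning T.setoid

  private
    v : R.Carrier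
    v = proj₁ u-unit

  factor-* : ∀ j {Γ} → Γ T.≈ q ^ j T.+ F.constant x T.* (q ^ j T.* Γ) → factor j T.* Γ T.≈ q ^ j
  factor-* j {Γ} e = begin
    factor j T.* Γ
      ≈⟨ solve 3 (λ x q g → (:1 :- x :* q) :* g := g :- x :* (q :* g)) T.refl (F.constant x) (q ^ j) Γ ⟩
    Γ T.- xqΓ
      ≈⟨ T.+-congʳ e ⟩
    q ^ j T.+ xqΓ T.- xqΓ
      ≈⟨ solve 2 (λ a b → a :+ b :- b := a) T.refl (q ^ j) xqΓ ⟩
    q ^ j ∎
    where
    xqΓ : F.Series
    xqΓ = F.constant x T.* (q ^ j T.* Γ)

  term-difference : ∀ (Γ : ℕ → F.Series) →
    (∀ j → Γ j T.≈ q ^ j T.+ F.constant x T.* (q ^ j T.* Γ j)) →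
    ∀ k m → term k m R.≈ [u-1]⁻¹ R.* v ^ᴿ suc k R.* (Γ k m R.- Γ (suc k) m)
  term-difference Γ e k m = R.trans (term≈ m) (F.constant-* ([u-1]⁻¹ R.* v ^ᴿ suc k) Δ m)
    where
    ω V Δ D C : F.Series
    ω = F.constant [u-1]⁻¹
    V = F.constant (v ^ᴿ suc k)
    Δ = Γ k T.- Γ (suc k)
    D = denominator k
    C = F.constant ([u-1]⁻¹ R.* v ^ᴿ suc k) T.* Δ

    VU : V T.* F.constant u ^ suc k T.≈ T.1#
    VU = T.trans (T.*-congˡ {V} (T.sym (K.^-homo u (suc k))))
      (T.trans (T.sym (K.*-homo (v ^ᴿ suc k) (u ^ᴿ suc k)))
               (L.constant-cong (inverse-^ R (proj₂ u-unit) (suc k))))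

    C*D : C T.* D T.≈ numerator k
    C*D = begin
      C T.* (F.constant u ^ suc k T.* (factor k T.* factor (suc k)))
        ≈⟨ T.*-congʳ {D} (T.*-congʳ {Δ} (K.*-homo [u-1]⁻¹ (v ^ᴿ suc k))) ⟩
      ω T.* V T.* Δ T.* (F.constant u ^ suc k T.* (factor k T.* factor (suc k)))
        ≈⟨ solve 7 (λ o v g g′ u f f′ → o :* v :* (g :- g′) :* (u :* (f :* f′)) :=
             o :* (v :* u) :* (f :* g :* f′ :- f′ :* g′ :* f)) T.refl
             ω V (Γ k) (Γ (suc k)) (F.constant u ^ suc k) (factor k) (factor (suc k)) ⟩
      ω T.* (V T.* F.constant u ^ suc k) T.*
        (factor k T.* Γ k T.* factor (suc k) T.- factor (suc k) T.* Γ (suc k) T.* factor k)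
        ≈⟨ T.*-cong {ω T.* (V T.* F.constant u ^ suc k)} (T.*-congˡ {ω} VU)
             (T.+-cong (T.*-congʳ {factor (suc k)} (factor-* k (e k)))
               (T.-‿cong (T.*-congʳ {factor k} (factor-* (suc k) (e (suc k)))))) ⟩
      ω T.* T.1# T.* (q ^ k T.* factor (suc k) T.- q ^ suc k T.* factor k)
        -- The terms with x cancel, and qᵏ - qᵏ⁺¹ = t qᵏ yields the numerator of the summand.
        ≈⟨ solve 4 (λ o t x p → o :* :1 :*
             (p :* (:1 :- x :* ((:1 :- t) :* p)) :- (:1 :- t) :* p :* (:1 :- x :* p)) := t :* p :* o)
             T.refl ω F.X (F.constant x) (q ^ k) ⟩
      numerator k ∎

    term≈ : term k T.≈ C
    term≈ = cancel-inverse F.commutativeRing {c = F.quotient T.1# D (denominator-unit k)}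
      (F.quotient-* T.1# D (denominator-unit k))
      (T.trans (F.quotient-* (numerator k) D (denominator-unit k)) (T.sym C*D))

-- The remainder of the middle series after K terms

falses : List Bool → ℕ
falses []          = 0
falses (true  ∷ s) = falses s
falses (false ∷ s) = suc (falses s)

falses-map-not : ∀ s → falses (map not s) ≡ trues s
falses-map-not []          = ≡.refl
falses-map-not (true  ∷ s) = ≡.cong suc (falses-map-not s)
falses-map-not (false ∷ s) = falses-map-not s

falses-steps : ∀ {n} (π : Permutation′ n) → falses (steps true not (word π)) ≡ descents π
falses-steps {zero}  π = ≡.refl
falses-steps {suc n} π = ≡.trans (falses-map-not (descentSteps (word π))) (≡.sym (descents-trues π))

-- remainder K s is the polynomial with
--   u ^ falses s / (1 - u) ^ suc n + (-1)ⁿ ∑_{j<K} count j s / u ^ suc j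
--     + (-1)ⁿ count K s / ((u - 1) u ^ K) = remainder K s / (u ^ K (1 - u) ^ suc n),
-- where n = length s.
module Remainders (P : CommutativeRing 0ℓ 0ℓ) (u : CommutativeRing.Carrier P) where
  open CommutativeRing P
  open Exponentiation semiring using (_^_)
  open Scalars P
  open IntegerRingSolver P
  open SetoidReasoning setoid
  open SeriesLemmas P using (nat-count-difference)
  open RegularElements P using (Regular; regular-*; regular-^)

  remainder lower : ℕ → List Bool → Carrier
  -- All counts are 1, and the third term is exactly what completes the finite geometric sum.
  remainder K       []          = 0#
  remainder K       (false ∷ s) = lower K s
  -- `count 0 (true ∷ s)` is 0, so only the first of the three terms is present.
  remainder zero    (true  ∷ s) = u ^ falses s
  -- A leading strict step shifts the bound: `count (suc K) (true ∷ s)` equals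
  -- `count K (false ∷ s)`.
  remainder (suc K) (true  ∷ s) = lower K s
  lower K s = u * remainder K s + (u - 1#) ^ length s * nat (count K s)

  remainder-zero : ∀ s → remainder 0 s + (u - 1#) ^ length s * nat (count 0 s) ≈ u ^ falses s
  remainder-zero []          = solve 0 (con (0 , 0) :+ :1 :* (:1 :+ con (0 , 0)) := :1) refl
  remainder-zero (true  ∷ s) = trans (+-congˡ (zeroʳ _)) (+-identityʳ _)
  remainder-zero (false ∷ s) = begin
    u * remainder 0 s + (u - 1#) ^ length s * nat (count 0 s) +
      (u - 1#) * (u - 1#) ^ length s * nat (count 0 s ℕ.+ 0)
      ≈⟨ +-congˡ (*-congˡ (reflexive (≡.cong nat (ℕₚ.+-identityʳ (count 0 s))))) ⟩
    u * remainder 0 s + (u - 1#) ^ length s * nat (count 0 s) +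
      (u - 1#) * (u - 1#) ^ length s * nat (count 0 s)
      ≈⟨ solve 4 (λ u r p c → u :* r :+ p :* c :+ (u :- :1) :* p :* c := u :* (r :+ p :* c)) refl
           u (remainder 0 s) ((u - 1#) ^ length s) (nat (count 0 s)) ⟩
    u * (remainder 0 s + (u - 1#) ^ length s * nat (count 0 s))
      ≈⟨ *-congˡ (remainder-zero s) ⟩
    u * u ^ falses s ∎

  private
    from-difference : ∀ {r d p a b c} → b - a ≈ c → r ≈ d - p * c → r ≈ d + p * (a - b)
    from-difference {r} {d} {p} {a} {b} {c} e f = begin
      r                    ≈⟨ f ⟩
      d - p * c            ≈⟨ +-congˡ (-‿cong (*-congˡ e)) ⟨
      d - p * (b - a)      ≈⟨ solve 4 (λ d p a b → d :- p :* (b :- a) := d :+ p :* (a :- b)) refl d p a b ⟩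
      d + p * (a - b)      ∎

  -- From K to K + 1 the expression that defines the remainder gains, up to sign, count K s / uᴷ⁺¹
  -- and exchanges one boundary term for the next; the total change is a multiple of the difference
  -- of two counts. Induction on s, alternating with `lower-suc`, keeps the argument free of
  -- fractions.
  remainder-suc : ∀ K s → remainder (suc K) s ≈
    u * remainder K s + (u - 1#) ^ length s * (nat (count K s) - nat (count (suc K) s))
  lower-suc : ∀ K s → lower (suc K) s ≈
    u * lower K s - (u - 1#) * (u - 1#) ^ length s * nat (count (suc K) s)

  lower-suc K s = begin
    u * remainder (suc K) s + p * c′
      ≈⟨ +-congʳ (*-congˡ (remainder-suc K s)) ⟩
    u * (u * remainder K s + p * (c - c′)) + p * c′
      ≈⟨ solve 5 (λ u r p c c′ → u :* (u :* r :+ p :* (c :- c′)) :+ p :* c′ :=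
                                 u :* (u :* r :+ p :* c) :- (u :- :1) :* p :* c′)
           refl u (remainder K s) p c c′ ⟩
    u * lower K s - (u - 1#) * p * c′ ∎
    where
    p c c′ : Carrier
    p  = (u - 1#) ^ length s
    c  = nat (count K s)
    c′ = nat (count (suc K) s)

  remainder-suc K       []          =
    solve 1 (λ u → con (0 , 0) := u :* con (0 , 0) :+ :1 :* ((:1 :+ con (0 , 0)) :- (:1 :+ con (0 , 0)))) refl u
  remainder-suc K       (false ∷ s) =
    from-difference (nat-count-difference K false s) (lower-suc K s)
  remainder-suc (suc K) (true  ∷ s) =
    from-difference (nat-count-difference (suc K) true s) (lower-suc K s)
  remainder-suc zero    (true  ∷ s) = from-difference (nat-count-difference 0 true s) (begin
    u * r + p * c
      ≈⟨ solve 4 (λ u r p c → u :* r :+ p :* c := u :* (r :+ p :* c) :- (u :- :1) :* p :* c) refl u r p c ⟩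
    u * (r + p * c) - (u - 1#) * p * c
      ≈⟨ +-congʳ (*-congˡ (remainder-zero s)) ⟩
    u * u ^ falses s - (u - 1#) * p * c ∎)
    where
    r p c : Carrier
    r = remainder 0 s
    p = (u - 1#) ^ length s
    c = nat (count 0 s)

  module _ (x : Carrier) (m : ℕ) where
    private
      st : Permutation′ m → List Bool
      st π = steps true not (word π)

      X : Permutation′ m → Carrier
      X π = x ^ inverseDescents π

    remainderSum strictSum : ℕ → Carrier
    remainderSum K = ∑ᴸ (permutations m) (λ π → remainder K (st π) * X π)
    strictSum    K = ∑ᴸ (permutations m) (λ π → nat (count K (st π)) * X π)

    remainderDenominator : ℕ → Carrier
    remainderDenominator K = (1# - x) ^ suc m * (u ^ K * (1# - u) ^ suc m)

    remainderDenominator-regular : Regular (1# - x) → Regular u → Regular (1# - u) →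
      ∀ K → Regular (remainderDenominator K)
    remainderDenominator-regular r s t K =
      regular-* (regular-^ r (suc m)) (regular-* (regular-^ s K) (regular-^ t (suc m)))

    private
      p : Carrier
      p = (u - 1#) ^ m

      length≈ : ∀ π → (u - 1#) ^ length (st π) ≈ p
      length≈ π = reflexive (≡.cong ((u - 1#) ^_) (length-steps-word true not π))

    remainderSum-zero : remainderSum 0 + p * strictSum 0 ≈
      ∑ᴸ (permutations m) (λ π → u ^ descents π * X π)
    remainderSum-zero = begin
      remainderSum 0 + p * strictSum 0
        ≈⟨ +-congˡ (*-distribˡ-∑ᴸ (permutations m) p _) ⟩
      remainderSum 0 + ∑ᴸ (permutations m) (λ π → p * (nat (count 0 (st π)) * X π))
        ≈⟨ ∑ᴸ-distrib (permutations m) _ _ ⟨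
      ∑ᴸ (permutations m) (λ π → remainder 0 (st π) * X π + p * (nat (count 0 (st π)) * X π))
        ≈⟨ ∑ᴸ-cong (permutations m) (λ π → begin
             remainder 0 (st π) * X π + p * (nat (count 0 (st π)) * X π)
               ≈⟨ solve 4 (λ r x p c → r :* x :+ p :* (c :* x) := (r :+ p :* c) :* x) refl
                    (remainder 0 (st π)) (X π) p (nat (count 0 (st π))) ⟩
             (remainder 0 (st π) + p * nat (count 0 (st π))) * X π
               ≈⟨ *-congʳ (trans (+-congˡ (*-congʳ (sym (length≈ π)))) (remainder-zero (st π))) ⟩
             u ^ falses (st π) * X π
               ≈⟨ *-congʳ (reflexive (≡.cong (u ^_) (falses-steps π))) ⟩
             u ^ descents π * X π ∎) ⟩
      ∑ᴸ (permutations m) (λ π → u ^ descents π * X π) ∎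

    remainderSum-suc : ∀ K → remainderSum (suc K) ≈
      u * remainderSum K + p * (strictSum K - strictSum (suc K))
    remainderSum-suc K = begin
      remainderSum (suc K)
        ≈⟨ solve 2 (λ a b → a := a :+ b :- b) refl (remainderSum (suc K)) (p * strictSum (suc K)) ⟩
      remainderSum (suc K) + p * strictSum (suc K) - p * strictSum (suc K)
        ≈⟨ +-congʳ (begin
             remainderSum (suc K) + p * strictSum (suc K)
               ≈⟨ +-congˡ (*-distribˡ-∑ᴸ (permutations m) p _) ⟩
             remainderSum (suc K) + ∑ᴸ (permutations m) (λ π → p * (c (suc K) π * X π))
               ≈⟨ ∑ᴸ-distrib (permutations m) _ _ ⟨
             ∑ᴸ (permutations m) (λ π → remainder (suc K) (st π) * X π + p * (c (suc K) π * X π))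
               ≈⟨ ∑ᴸ-cong (permutations m) summand ⟩
             ∑ᴸ (permutations m) (λ π → u * (remainder K (st π) * X π) + p * (c K π * X π))
               ≈⟨ ∑ᴸ-distrib (permutations m) _ _ ⟩
             ∑ᴸ (permutations m) (λ π → u * (remainder K (st π) * X π)) +
             ∑ᴸ (permutations m) (λ π → p * (c K π * X π))
               ≈⟨ +-cong (*-distribˡ-∑ᴸ (permutations m) u _) (*-distribˡ-∑ᴸ (permutations m) p _) ⟨
             u * remainderSum K + p * strictSum K ∎) ⟩
      u * remainderSum K + p * strictSum K - p * strictSum (suc K)
        ≈⟨ solve 4 (λ a p s s′ → a :+ p :* s :- p :* s′ := a :+ p :* (s :- s′)) refl
             (u * remainderSum K) p (strictSum K) (strictSum (suc K)) ⟩
      u * remainderSum K + p * (strictSum K - strictSum (suc K)) ∎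
      where
      c : ℕ → Permutation′ m → Carrier
      c K π = nat (count K (st π))

      summand : ∀ π → remainder (suc K) (st π) * X π + p * (c (suc K) π * X π) ≈
        u * (remainder K (st π) * X π) + p * (c K π * X π)
      summand π = begin
        remainder (suc K) (st π) * X π + p * (c (suc K) π * X π)
          ≈⟨ +-congʳ (*-congʳ (trans (remainder-suc K (st π)) (+-congˡ (*-congʳ (length≈ π))))) ⟩
        (u * remainder K (st π) + p * (c K π - c (suc K) π)) * X π + p * (c (suc K) π * X π)
          ≈⟨ solve 6 (λ u r p c c′ x → (u :* r :+ p :* (c :- c′)) :* x :+ p :* (c′ :* x) :=
                                       u :* (r :* x) :+ p :* (c :* x)) refl
               u (remainder K (st π)) p (c K π) (c (suc K) π) (X π) ⟩
        u * (remainder K (st π) * X π) + p * (c K π * X π) ∎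

-- Degrees in u

-- Degree≤ d p: the degree of p in u is at most d.  RegularDegree d p: the degree
-- is d, and the leading coefficient is regular.
record DegreeFiltration (P : CommutativeRing 0ℓ 0ℓ) (x u : CommutativeRing.Carrier P) : Set₁ where
  open CommutativeRing P
  field
    Degree≤      : ℕ → Carrier → Set
    degree-≤     : ∀ {d d′ p} → d ℕ.≤ d′ → Degree≤ d p → Degree≤ d′ p
    degree-resp  : ∀ {d p q} → p ≈ q → Degree≤ d p → Degree≤ d q
    degree-0     : ∀ {d} → Degree≤ d 0#
    degree-1     : ∀ {d} → Degree≤ d 1#
    degree-+     : ∀ {d p q} → Degree≤ d p → Degree≤ d q → Degree≤ d (p + q)
    degree-neg   : ∀ {d p} → Degree≤ d p → Degree≤ d (- p)
    degree-x*    : ∀ {d p} → Degree≤ d p → Degree≤ d (x * p)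
    degree-u*    : ∀ {d p} → Degree≤ d p → Degree≤ (suc d) (u * p)

    RegularDegree        : ℕ → Carrier → Set
    regularDegree-resp   : ∀ {d p q} → p ≈ q → RegularDegree d p → RegularDegree d q
    regularDegree-1      : RegularDegree 0 1#
    regularDegree-u*     : ∀ {d p} → RegularDegree d p → RegularDegree (suc d) (u * p)
    regularDegree-[1-u]* : ∀ {d p} → RegularDegree d p → RegularDegree (suc d) ((1# - u) * p)
    regularDegree-[1-x]* : ∀ {d p} → RegularDegree d p → RegularDegree d ((1# - x) * p)

  open Exponentiation semiring using (_^_)
  open Scalars P
  open Remainders P u
  open IntegerRingSolver P

  degree-*-nat : ∀ {d p} → Degree≤ d p → ∀ c → Degree≤ d (p * nat c)
  degree-*-nat {p = p} dp zero    = degree-resp (sym (zeroʳ p)) degree-0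
  degree-*-nat {p = p} dp (suc c) = degree-resp
    (solve 2 (λ p c → p :+ p :* c := p :* (:1 :+ c)) refl p (nat c))
    (degree-+ dp (degree-*-nat dp c))

  degree-[u-1]^ : ∀ n → Degree≤ n ((u - 1#) ^ n)
  degree-[u-1]^ zero    = degree-1
  degree-[u-1]^ (suc n) = degree-resp
    (solve 2 (λ u p → u :* p :- p := (u :- :1) :* p) refl u ((u - 1#) ^ n))
    (degree-+ (degree-u* (degree-[u-1]^ n)) (degree-neg (degree-≤ (ℕₚ.n≤1+n n) (degree-[u-1]^ n))))

  degree-*-x^ : ∀ n {d p} → Degree≤ d p → Degree≤ d (p * x ^ n)
  degree-*-x^ zero    {p = p} dp = degree-resp (sym (*-identityʳ p)) dp
  degree-*-x^ (suc n) {p = p} dp = degree-resp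
    (solve 3 (λ a p b → a :* (p :* b) := p :* (a :* b)) refl x p (x ^ n))
    (degree-x* (degree-*-x^ n dp))

  degree-∑ᴸ : ∀ {A : Set} {d} (xs : List A) {f : A → Carrier} →
    (∀ x → Degree≤ d (f x)) → Degree≤ d (∑ᴸ xs f)
  degree-∑ᴸ []       df = degree-0
  degree-∑ᴸ (x ∷ xs) df = degree-+ (df x) (degree-∑ᴸ xs df)

  degree-u^falses : ∀ s → Degree≤ (length s) (u ^ falses s)
  degree-u^falses []          = degree-1
  degree-u^falses (true  ∷ s) = degree-≤ (ℕₚ.n≤1+n _) (degree-u^falses s)
  degree-u^falses (false ∷ s) = degree-u* (degree-u^falses s)

  -- Each step of the list raises the degree by at most one, whatever K is. The bound is independent
  -- of K, so the power uᴷ in the denominator translates fully into order at u = ∞.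
  degree-remainder : ∀ K s → Degree≤ (length s) (remainder K s)
  degree-lower     : ∀ K s → Degree≤ (suc (length s)) (lower K s)
  degree-remainder K       []          = degree-0
  degree-remainder K       (false ∷ s) = degree-lower K s
  degree-remainder zero    (true  ∷ s) = degree-≤ (ℕₚ.n≤1+n _) (degree-u^falses s)
  degree-remainder (suc K) (true  ∷ s) = degree-lower K s
  degree-lower K s = degree-+ (degree-u* (degree-remainder K s))
    (degree-≤ (ℕₚ.n≤1+n (length s)) (degree-*-nat (degree-[u-1]^ (length s)) (count K s)))

  degree-remainderSum : ∀ m K → Degree≤ m (remainderSum x m K)
  degree-remainderSum m K = degree-∑ᴸ (permutations m) λ π →
    degree-*-x^ (inverseDescents π)
      (≡.subst (λ n → Degree≤ n (remainder K (steps true not (word π))))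
        (length-steps-word true not π) (degree-remainder K (steps true not (word π))))

  -- δ is the degree of a: 0 for 1 - x, and 1 for u and 1 - u.
  regularDegree-^* : ∀ {a} δ → (∀ {d p} → RegularDegree d p → RegularDegree (δ ℕ.+ d) (a * p)) →
    ∀ n {d p} → RegularDegree d p → RegularDegree (n ℕ.* δ ℕ.+ d) (a ^ n * p)
  regularDegree-^* δ step zero    {p = p} r = regularDegree-resp (sym (*-identityˡ p)) r
  regularDegree-^* {a} δ step (suc n) {d} {p} r = regularDegree-resp (sym (*-assoc a (a ^ n) p))
    (≡.subst (λ k → RegularDegree k (a * (a ^ n * p))) (≡.sym (ℕₚ.+-assoc δ (n ℕ.* δ) d))
      (step (regularDegree-^* δ step n r)))

  regularDegree-remainderDenominator : ∀ m K →
    RegularDegree (K ℕ.+ suc m) (remainderDenominator x m K)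
  regularDegree-remainderDenominator m K =
    ≡.subst (λ k → RegularDegree k (remainderDenominator x m K))
      (≡.cong₂ ℕ._+_ (ℕₚ.*-zeroʳ (suc m))
        (≡.cong₂ ℕ._+_ (ℕₚ.*-identityʳ K)
          (≡.trans (ℕₚ.+-identityʳ (suc m ℕ.* 1)) (ℕₚ.*-identityʳ (suc m)))))
      (regularDegree-^* 0 regularDegree-[1-x]* (suc m)
        (regularDegree-^* 1 regularDegree-u* K
          (regularDegree-resp (*-identityʳ ((1# - u) ^ suc m))
            (regularDegree-^* 1 regularDegree-[1-u]* (suc m) regularDegree-1))))

module PolynomialDegrees (R : CommutativeRing 0ℓ 0ℓ) where
  private
    module R  = CommutativeRing R
    module F  = FormalPowerSeries R
    module L  = SeriesLemmas R
    module Pᴿ = Polynomials R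
    module P  = CommutativeRing Pᴿ.commutativeRing
    module S  = CommutativeRing F.commutativeRing
  open Pᴿ using (coeff)
  open RegularElements R
  open AbelianGroupProperties R.+-abelianGroup using (ε⁻¹≈ε)

  Degree≤ : ℕ → P.Carrier → Set
  Degree≤ d p = ∀ e → d ℕ.< e → coeff p e R.≈ R.0#

  RegularDegree : ℕ → P.Carrier → Set
  RegularDegree d p = Regular (coeff p d) × Degree≤ d p

  coeff-[1-X]* : ∀ p d → coeff ((P.1# P.- Pᴿ.X) P.* p) (suc d) R.≈ coeff p (suc d) R.- coeff p d
  coeff-[1-X]* p = L.q-*-suc (coeff p)

  coeff-[1-constant]* : ∀ a p d → coeff ((P.1# P.- Pᴿ.constant a) P.* p) d R.≈ (R.1# R.- a) R.* coeff p d
  coeff-[1-constant]* a p d = R.trans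
    (F.*-cong {S.1# S.- F.constant a} {F.constant (R.1# R.- a)} {coeff p} {coeff p}
      (S.sym (S.trans (K.sub-homo R.1# a) (S.+-congʳ {S.- F.constant a} K.1-homo))) (λ _ → R.refl) d)
    (F.constant-* (R.1# R.- a) (coeff p) d)
    where module K = RingHom L.constant-hom

  -- The factors u and 1 - u have leading coefficients 1 and -1; the constant factor 1 - a is its
  -- own leading coefficient, whence the assumption on it.
  filtration : ∀ {a} → Regular (R.1# R.- a) → DegreeFiltration Pᴿ.commutativeRing (Pᴿ.constant a) Pᴿ.X
  filtration {a} r1-a = record
    { Degree≤     = Degree≤
    ; degree-≤    = λ le dp e lt → dp e (ℕₚ.≤-<-trans le lt)
    ; degree-resp = λ p≈q dp e lt → R.trans (R.sym (p≈q e)) (dp e lt)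
    ; degree-0    = λ e lt → R.refl
    ; degree-1    = λ { (suc e) lt → R.refl }
    ; degree-+    = λ dp dq e lt → R.trans (R.+-cong (dp e lt) (dq e lt)) (R.+-identityʳ R.0#)
    ; degree-neg  = λ dp e lt → R.trans (R.-‿cong (dp e lt)) ε⁻¹≈ε
    ; degree-x*   = λ {d} {p} dp e lt →
        R.trans (F.constant-* a (coeff p) e) (R.trans (R.*-congˡ (dp e lt)) (R.zeroʳ a))
    ; degree-u*   = λ {d} {p} dp → X* {d} {p} dp
    ; RegularDegree        = RegularDegree
    ; regularDegree-resp   = λ {d} p≈q (r , dp) →
        regular-resp (p≈q d) r , λ e lt → R.trans (R.sym (p≈q e)) (dp e lt)
    ; regularDegree-1      = regular-1 , λ { (suc e) lt → R.refl }
    ; regularDegree-u*     = λ {d} {p} (r , dp) →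
        regular-resp (R.sym (L.X-*-suc (coeff p) d)) r , X* {d} {p} dp
    ; regularDegree-[1-u]* = λ {d} {p} (r , dp) →
          regular-resp (R.sym (R.trans (coeff-[1-X]* p d)
            (R.trans (R.+-congʳ (dp (suc d) ℕₚ.≤-refl)) (R.+-identityˡ _)))) (regular-neg r)
        , λ { (suc e) (s≤s lt) → R.trans (coeff-[1-X]* p e)
            (R.trans (R.+-cong (dp (suc e) (ℕₚ.m≤n⇒m≤1+n lt)) (R.-‿cong (dp e lt))) (R.-‿inverseʳ R.0#)) }
    ; regularDegree-[1-x]* = λ {d} {p} (r , dp) →
          regular-resp (R.sym (coeff-[1-constant]* a p d)) (regular-* r1-a r)
        , λ e lt → R.trans (coeff-[1-constant]* a p e) (R.trans (R.*-congˡ (dp e lt)) (R.zeroʳ _))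
    }
    where
    X* : ∀ {d p} → Degree≤ d p → Degree≤ (suc d) (Pᴿ.X P.* p)
    X* {p = p} dp (suc e) (s≤s lt) = R.trans (L.X-*-suc (coeff p) e) (dp e lt)

-- Fractions and the recurrence of the remainder

polynomial-constant-hom : (R : CommutativeRing 0ℓ 0ℓ) → RingHom R (Polynomials.commutativeRing R)
polynomial-constant-hom R = record
  { ⟦_⟧     = Pol.constant
  ; ⟦⟧-cong = K.⟦⟧-cong
  ; +-homo  = K.+-homo
  ; *-homo  = K.*-homo
  ; 1-homo  = K.1-homo
  }
  where
  module K   = RingHom (SeriesLemmas.constant-hom R)
  module Pol = Polynomials R

module EmbedLemmas (R : CommutativeRing 0ℓ 0ℓ) where
  private
    module R = CommutativeRing R
    module Fr = Fractions R
    module F = CommutativeRing Fr.commutativeRing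
    module Rˢ = IntegerRingSolver R
  open RegularElements R
  open Rˢ

  embed-hom : RingHom R Fr.commutativeRing
  embed-hom = record
    { ⟦_⟧     = Fr.embed
    ; ⟦⟧-cong = R.*-congʳ
    ; +-homo  = λ a b → solve 2 (λ a b → (a :+ b) :* (:1 :* :1) := (a :* :1 :+ b :* :1) :* :1) R.refl a b
    ; *-homo  = λ a b → solve 2 (λ a b → (a :* b) :* (:1 :* :1) := (a :* b) :* :1) R.refl a b
    ; 1-homo  = R.refl
    }

  fraction-* : ∀ n d (rd : Regular d) → Fr.fraction n d rd F.* Fr.embed d F.≈ Fr.embed n
  fraction-* n d rd = solve 2 (λ n d → (n :* d) :* :1 := n :* (d :* :1)) R.refl n d

  -- Any inverse of the denominator may represent the fraction, so later identities can be proved in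
  -- an abstract ring with chosen inverses of u, u - 1 and 1 - x.
  fraction≈ : ∀ n d (rd : Regular d) {i} → i F.* Fr.embed d F.≈ F.1# →
    Fr.fraction n d rd F.≈ Fr.embed n F.* i
  fraction≈ n d rd {i} e = cancel-inverse Fr.commutativeRing {Fr.fraction n d rd} {Fr.embed n F.* i} {i} {Fr.embed d} e
    (F.trans {Fr.fraction n d rd F.* Fr.embed d} {Fr.embed n} {Fr.embed n F.* i F.* Fr.embed d}
      (fraction-* n d rd)
      (F.sym {Fr.embed n F.* i F.* Fr.embed d} {Fr.embed n}
        (F.trans {Fr.embed n F.* i F.* Fr.embed d} {Fr.embed n F.* (i F.* Fr.embed d)} {Fr.embed n}
          (F.*-assoc (Fr.embed n) i (Fr.embed d))
          (F.trans {Fr.embed n F.* (i F.* Fr.embed d)} {Fr.embed n F.* F.1#} {Fr.embed n}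
            (F.*-congˡ {Fr.embed n} {i F.* Fr.embed d} {F.1#} e)
            (F.*-identityʳ (Fr.embed n))))))

-- ω, v and κ stand for 1/(u - 1), 1/u and 1/(1 - x).
module RemainderRecurrence (P F : CommutativeRing 0ℓ 0ℓ) (ε : RingHom P F)
  (u x : CommutativeRing.Carrier P) (v ω κ : CommutativeRing.Carrier F)
  (vu : Inverse F v (RingHom.⟦_⟧ ε u))
  (ωu : Inverse F ω (CommutativeRing._-_ F (RingHom.⟦_⟧ ε u) (CommutativeRing.1# F))) where

  open CommutativeRing F
  open RingHom ε
  private
    module P  = CommutativeRing P
    module Pᶜ = Scalars P
  open Exponentiation semiring using (_^_)
  open CommutativeExponentiation commutativeSemiring using (^-distrib-*)
  open Exponentiation P.semiring using () renaming (_^_ to _^ᴾ_)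
  open Remainders P u using (remainderSum; strictSum; remainderSum-zero; remainderSum-suc)
  open Scalars F using (sign)
  open IntegerRingSolver F
  open SetoidReasoning setoid

  w U : Carrier
  w = - ω
  U = ⟦ u ⟧

  inverseDenominator : ℕ → ℕ → Carrier
  inverseDenominator K m = v ^ K * (w ^ suc m * κ ^ suc m)

  -- `strictFraction m K` is the coefficient of tᵐ in Γ_K, and `remainderFraction m K` is what the
  -- constant and the first K summands leave of the eulerian coefficient.
  remainderFraction strictFraction : ℕ → ℕ → Carrier
  remainderFraction m K = ⟦ remainderSum x m K ⟧ * inverseDenominator K m
  strictFraction    m K = sign m * ⟦ strictSum x m K ⟧ * κ ^ suc m

  [u-1]^-homo : ∀ m → ⟦ (u P.- P.1#) ^ᴾ m ⟧ ≈ (U - 1#) ^ m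
  [u-1]^-homo m = trans (^-homo (u P.- P.1#) m)
    (Exponentiation.^-congˡ semiring m (trans (sub-homo u P.1#) (+-congˡ (-‿cong 1-homo))))

  -- The origin of the sign (-1)ᵐ: the recurrences of the remainder carry powers of u - 1, its
  -- denominator powers of 1 - u.
  [u-1]^-*-w^ : ∀ m → (U - 1#) ^ m * w ^ m ≈ sign m
  [u-1]^-*-w^ m = trans (sym (^-distrib-* (U - 1#) w m)) (Exponentiation.^-congˡ semiring m (begin
    (U - 1#) * - ω     ≈⟨ solve 2 (λ a o → a :* :- o := :- (o :* a)) refl (U - 1#) ω ⟩
    - (ω * (U - 1#))   ≈⟨ -‿cong ωu ⟩
    - 1#               ∎))

  remainderFraction-zero : ∀ m →
    ⟦ Pᶜ.∑ᴸ (permutations m) (λ π → u ^ᴾ descents π P.* x ^ᴾ inverseDescents π) ⟧ *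
      (w ^ suc m * κ ^ suc m) ≈
    remainderFraction m 0 + w * strictFraction m 0
  remainderFraction-zero m = begin
    ⟦ Pᶜ.∑ᴸ (permutations m) (λ π → u ^ᴾ descents π P.* x ^ᴾ inverseDescents π) ⟧ * (w ^ suc m * κ ^ suc m)
      ≈⟨ *-congʳ (⟦⟧-cong (remainderSum-zero x m)) ⟨
    ⟦ remainderSum x m 0 P.+ (u P.- P.1#) ^ᴾ m P.* strictSum x m 0 ⟧ * (w ^ suc m * κ ^ suc m)
      ≈⟨ *-congʳ (trans (+-homo _ _) (+-congˡ (trans (*-homo _ _) (*-congʳ ([u-1]^-homo m))))) ⟩
    (r + p * s) * (w * w ^ m * k)
      ≈⟨ solve 6 (λ r p s w W k → (r :+ p :* s) :* (w :* W :* k) :=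
           r :* (:1 :* (w :* W :* k)) :+ w :* (p :* W :* s :* k)) refl r p s w (w ^ m) k ⟩
    remainderFraction m 0 + w * (p * w ^ m * s * k)
      ≈⟨ +-congˡ (*-congˡ (*-congʳ (*-congʳ ([u-1]^-*-w^ m)))) ⟩
    remainderFraction m 0 + w * strictFraction m 0 ∎
    where
    r p s k : Carrier
    r = ⟦ remainderSum x m 0 ⟧
    p = (U - 1#) ^ m
    s = ⟦ strictSum x m 0 ⟧
    k = κ ^ suc m

  -- By `term-difference` the quantity subtracted is the summand at K, which is what
  -- `remainder-of-sum` asks for.
  remainderFraction-suc : ∀ m K → remainderFraction m (suc K) ≈
    remainderFraction m K - ω * v ^ suc K * (strictFraction m K - strictFraction m (suc K))
  remainderFraction-suc m K = begin
    ⟦ remainderSum x m (suc K) ⟧ * inverseDenominator (suc K) m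
      ≈⟨ *-congʳ (trans (⟦⟧-cong (remainderSum-suc x m K))
           (trans (+-homo _ _) (+-cong (*-homo _ _) (trans (*-homo _ _)
             (*-cong ([u-1]^-homo m) (sub-homo _ _)))))) ⟩
    (U * r + p * (s - s′)) * (v * V * (w * w ^ m * k))
      ≈⟨ solve 10 (λ U r p s s′ v V o W k →
           (U :* r :+ p :* (s :- s′)) :* (v :* V :* (:- o :* W :* k)) :=
           v :* U :* (r :* (V :* (:- o :* W :* k))) :-
             o :* (v :* V) :* (p :* W :* s :* k :- p :* W :* s′ :* k))
           refl U r p s s′ v V ω (w ^ m) k ⟩
    v * U * remainderFraction m K - ω * v ^ suc K * (p * w ^ m * s * k - p * w ^ m * s′ * k)
      ≈⟨ +-cong (trans (*-congʳ vu) (*-identityˡ _))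
           (-‿cong (*-congˡ (+-cong (*-congʳ (*-congʳ ([u-1]^-*-w^ m)))
                                    (-‿cong (*-congʳ (*-congʳ ([u-1]^-*-w^ m))))))) ⟩
    remainderFraction m K - ω * v ^ suc K * (strictFraction m K - strictFraction m (suc K)) ∎
    where
    r p s s′ V k : Carrier
    r  = ⟦ remainderSum x m K ⟧
    p  = (U - 1#) ^ m
    s  = ⟦ strictSum x m K ⟧
    s′ = ⟦ strictSum x m (suc K) ⟧
    V  = v ^ K
    k  = κ ^ suc m

module _ (R : CommutativeRing 0ℓ 0ℓ) where
  open CommutativeRing R
  open Summation semiring using (sum; sum-init-last; sum-cong-≋)
  open SetoidReasoning setoid

  sum-snoc : ∀ K (f : ℕ → Carrier) → sum {suc K} (f ∘ toℕ) ≈ sum {K} (f ∘ toℕ) + f K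
  sum-snoc K f = trans (sum-init-last {K} (f ∘ toℕ)) (+-cong
    (sum-cong-≋ {K} (λ i → reflexive (≡.cong f (Finₚ.toℕ-inject₁ i))))
    (reflexive (≡.cong f (Finₚ.toℕ-fromℕ K))))

  remainder-of-sum : ∀ s (f r : ℕ → Carrier) → s ≈ r 0 → (∀ K → r (suc K) ≈ r K - f K) →
    ∀ K → s - sum {K} (f ∘ toℕ) ≈ r K
  remainder-of-sum s f r z e zero    = trans (solve 1 (λ s → s :- con (0 , 0) := s) refl s) z
    where open IntegerRingSolver R
  remainder-of-sum s f r z e (suc K) = begin
    s - sum {suc K} (f ∘ toℕ)
      ≈⟨ +-congˡ (-‿cong (sum-snoc K f)) ⟩
    s - (sum {K} (f ∘ toℕ) + f K)
      ≈⟨ solve 3 (λ s a b → s :- (a :+ b) := s :- a :- b) refl s (sum {K} (f ∘ toℕ)) (f K) ⟩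
    s - sum {K} (f ∘ toℕ) - f K
      ≈⟨ +-congʳ (remainder-of-sum s f r z e K) ⟩
    r K - f K
      ≈⟨ e K ⟨
    r (suc K) ∎
    where open IntegerRingSolver R

-- The three rings stay abstract, and division enters only through inverses, so that no numerator or
-- denominator of `ℚ⟨x,u⟩` unfolds in these identities.
module MiddleRemainder (R P F : CommutativeRing 0ℓ 0ℓ)
  (c : RingHom (Polynomials.commutativeRing R) P) (ε : RingHom P F)
  (x u : CommutativeRing.Carrier P)
  (cX≈x : CommutativeRing._≈_ P (RingHom.⟦_⟧ c (Polynomials.X R)) x)
  (x̂ û ω : CommutativeRing.Carrier F)
  (x≈x̂ : CommutativeRing._≈_ F (RingHom.⟦_⟧ ε x) x̂)
  (u≈û : CommutativeRing._≈_ F (RingHom.⟦_⟧ ε u) û)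
  (1-x-unit : RegularElements.Unit F (CommutativeRing._-_ F (CommutativeRing.1# F) x̂))
  (u-unit : RegularElements.Unit F û)
  (ωu : Inverse F ω (CommutativeRing._-_ F (RingHom.⟦_⟧ ε u) (CommutativeRing.1# F))) where

  open CommutativeRing F
  open RingHom ε

  private
    module P   = CommutativeRing P
    module Pol = Polynomials R
    module Q   = CommutativeRing Pol.commutativeRing
    module N   = StrictNumerators R
    module T   = CommutativeRing (FormalPowerSeries.commutativeRing F)
    module FT  = FormalPowerSeries F
    module c   = RingHom c
    module ι   = RingHom (ε ∘ᴴ c)
    module Qᶜ  = Scalars Pol.commutativeRing
    module Pᶜ  = Scalars P
    module Fᶜ  = Scalars F

    κ v : Carrier
    κ = proj₁ 1-x-unit
    v = proj₁ u-unit

    1-x̂ : ⟦ P.1# P.- x ⟧ ≈ 1# - x̂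
    1-x̂ = trans (sub-homo P.1# x) (+-cong 1-homo (-‿cong x≈x̂))

    vu : v * ⟦ u ⟧ ≈ 1#
    vu = trans (*-congˡ u≈û) (proj₂ u-unit)

  open Exponentiation semiring using (_^_)
  open Exponentiation P.semiring using () renaming (_^_ to _^ᴾ_)
  open Exponentiation T.semiring using () renaming (_^_ to _^ᵀ_)
  open Remainders P u using (strictSum; remainderSum; remainderDenominator)
  open MiddleTerms F x̂ û ω 1-x-unit u-unit using (q; term)
  open MiddleTelescoping F x̂ û ω 1-x-unit u-unit using (term-difference)
  open RemainderRecurrence P F ε u x v ω κ vu ωu public
  open Summation semiring using (sum; sum-cong-≋)
  open IntegerRingSolver F
  open SetoidReasoning setoid

  w[1-u] : w * ⟦ P.1# P.- u ⟧ ≈ 1#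
  w[1-u] = begin
    - ω * ⟦ P.1# P.- u ⟧     ≈⟨ *-congˡ (trans (sub-homo P.1# u) (+-congʳ 1-homo)) ⟩
    - ω * (1# - ⟦ u ⟧)       ≈⟨ solve 2 (λ o u → :- o :* (:1 :- u) := o :* (u :- :1)) refl ω ⟦ u ⟧ ⟩
    ω * (⟦ u ⟧ - 1#)         ≈⟨ ωu ⟩
    1#                       ∎

  κ[1-x] : κ * ⟦ P.1# P.- x ⟧ ≈ 1#
  κ[1-x] = trans (*-congˡ 1-x̂) (proj₂ 1-x-unit)

  private
    Γ : ℕ → FT.Series
    Γ j = unscale (ε ∘ᴴ c) κ (N.γ j)

    cX≈x̂ : ι.⟦ Pol.X ⟧ ≈ x̂
    cX≈x̂ = trans (⟦⟧-cong cX≈x) x≈x̂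

    Γ-geometric : ∀ j → Γ j T.≈ q ^ᵀ j T.+ FT.constant x̂ T.* (q ^ᵀ j T.* Γ j)
    Γ-geometric j = T.trans
      (unscale-geometric (ε ∘ᴴ c)
        (trans (*-comm _ κ) (trans (*-congˡ (trans (ι.sub-homo Q.1# Pol.X)
          (+-cong ι.1-homo (-‿cong cX≈x̂)))) (proj₂ 1-x-unit)))
        Pol.X j (N.γ j) (N.γ-geometric j))
      (T.+-congˡ (T.*-congʳ {q ^ᵀ j T.* Γ j} (SeriesLemmas.constant-cong F cX≈x̂)))

    c-numerator : ∀ j m → c.⟦ N.numerator j m ⟧ P.≈ strictSum x m j
    c-numerator j m = P.trans (c.∑ᴸ-homo (permutations m) _) (Pᶜ.∑ᴸ-cong (permutations m) λ π →
      P.trans (c.*-homo _ _)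
        (P.*-cong (c.×1-homo (count j (steps true not (word π)))) 
          (P.trans (c.^-homo Pol.X (inverseDescents π))
                   (Exponentiation.^-congˡ P.semiring (inverseDescents π) cX≈x))))

    Γ-strictFraction : ∀ j m → Γ j m ≈ strictFraction m j
    Γ-strictFraction j m = *-congʳ (trans (ι.*-homo (Qᶜ.sign m) (N.numerator j m)) (*-cong
      (trans (ι.^-homo (Q.- Q.1#) m)
        (Exponentiation.^-congˡ semiring m (trans (ι.-‿homo Q.1#) (-‿cong ι.1-homo))))
      (⟦⟧-cong (c-numerator j m))))

    -- No nonempty chain lies strictly below 0, so Γ₀ is the constant 1 / (1 - x); divided by 1 - u
    -- it is the constant added to the middle series.
    w-strictFraction-zero : ∀ m → w * strictFraction m 0 ≈ FT.constant (w * κ) m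
    w-strictFraction-zero zero = begin
      w * (1# * ⟦ strictSum x 0 0 ⟧ * (κ * 1#))
        ≈⟨ *-congˡ (*-congʳ (*-congˡ (trans (⟦⟧-cong one) 1-homo))) ⟩
      w * (1# * 1# * (κ * 1#))
        ≈⟨ solve 2 (λ w k → w :* (:1 :* :1 :* (k :* :1)) := w :* k) refl w κ ⟩
      w * κ ∎
      where
      one : strictSum x 0 0 P.≈ P.1#
      one = P.trans (P.+-identityʳ _) (P.trans (P.*-identityʳ _) (P.+-identityʳ P.1#))
    w-strictFraction-zero (suc m) = begin
      w * (Fᶜ.sign (suc m) * ⟦ strictSum x (suc m) 0 ⟧ * κ ^ suc (suc m))
        ≈⟨ *-congˡ (*-congʳ (*-congˡ (trans (⟦⟧-cong zeros) 0-homo))) ⟩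
      w * (Fᶜ.sign (suc m) * 0# * κ ^ suc (suc m))
        ≈⟨ solve 3 (λ w s k → w :* (s :* con (0 , 0) :* k) := con (0 , 0)) refl
             w (Fᶜ.sign (suc m)) (κ ^ suc (suc m)) ⟩
      0# ∎
      where
      zeros : strictSum x (suc m) 0 P.≈ P.0#
      zeros = P.trans (Pᶜ.∑ᴸ-cong (permutations (suc m)) (λ π → P.zeroˡ _)) (Pᶜ.∑ᴸ-zero (permutations (suc m)))

  middle-remainder : ∀ m {e c} →
    e ≈ ⟦ Pᶜ.∑ᴸ (permutations m) (λ π → u ^ᴾ descents π P.* x ^ᴾ inverseDescents π) ⟧ *
        (w ^ suc m * κ ^ suc m) →
    c ≈ FT.constant (w * κ) m →
    ∀ K → e - c - sum {K} (λ k → term (toℕ k) m) ≈ remainderFraction m K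
  middle-remainder m {e} {c} e≈ c≈ = remainder-of-sum F (e - c) (λ k → term k m) (remainderFraction m)
    (begin
      e - c
        ≈⟨ +-cong (trans e≈ (remainderFraction-zero m))
             (-‿cong (trans c≈ (sym (w-strictFraction-zero m)))) ⟩
      remainderFraction m 0 + w * strictFraction m 0 - w * strictFraction m 0
        ≈⟨ solve 2 (λ a b → a :+ b :- b := a) refl (remainderFraction m 0) (w * strictFraction m 0) ⟩
      remainderFraction m 0 ∎)
    λ K → trans (remainderFraction-suc m K) (+-congˡ (-‿cong (sym (trans
      (term-difference Γ Γ-geometric K m)
      (*-congˡ (+-cong (Γ-strictFraction K m) (-‿cong (Γ-strictFraction (suc K) m))))))))

  inverseDenominator-* : ∀ K m → inverseDenominator K m *
    ⟦ (P.1# P.- x) ^ᴾ suc m P.* (u ^ᴾ K P.* (P.1# P.- u) ^ᴾ suc m) ⟧ ≈ 1#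
  inverseDenominator-* K m = begin
    v ^ K * (w ^ suc m * κ ^ suc m) *
      ⟦ (P.1# P.- x) ^ᴾ suc m P.* (u ^ᴾ K P.* (P.1# P.- u) ^ᴾ suc m) ⟧
      ≈⟨ *-congˡ (trans (*-homo _ _) (*-cong (^-homo (P.1# P.- x) (suc m))
           (trans (*-homo _ _) (*-cong (^-homo u K) (^-homo (P.1# P.- u) (suc m)))))) ⟩
    v ^ K * (w ^ suc m * κ ^ suc m) *
      (⟦ P.1# P.- x ⟧ ^ suc m * (⟦ u ⟧ ^ K * ⟦ P.1# P.- u ⟧ ^ suc m))
      ≈⟨ solve 6 (λ v w k x u y → v :* (w :* k) :* (x :* (u :* y)) := (v :* u) :* ((w :* y) :* (k :* x)))
           refl (v ^ K) (w ^ suc m) (κ ^ suc m) (⟦ P.1# P.- x ⟧ ^ suc m) (⟦ u ⟧ ^ K) (⟦ P.1# P.- u ⟧ ^ suc m) ⟩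
    (v ^ K * ⟦ u ⟧ ^ K) * ((w ^ suc m * ⟦ P.1# P.- u ⟧ ^ suc m) * (κ ^ suc m * ⟦ P.1# P.- x ⟧ ^ suc m))
      ≈⟨ *-cong (inverse-^ F vu K)
           (*-cong (inverse-^ F w[1-u] (suc m)) (inverse-^ F κ[1-x] (suc m))) ⟩
    1# * (1# * 1#)
      ≈⟨ trans (*-identityˡ _) (*-identityˡ _) ⟩
    1# ∎

  inverseDenominator-zero-* : ∀ m → w ^ suc m * κ ^ suc m *
    ⟦ (P.1# P.- u) ^ᴾ suc m P.* (P.1# P.- x) ^ᴾ suc m ⟧ ≈ 1#
  inverseDenominator-zero-* m = begin
    w ^ suc m * κ ^ suc m * ⟦ (P.1# P.- u) ^ᴾ suc m P.* (P.1# P.- x) ^ᴾ suc m ⟧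
      ≈⟨ *-congˡ (trans (*-homo _ _) (*-cong (^-homo (P.1# P.- u) (suc m)) (^-homo (P.1# P.- x) (suc m)))) ⟩
    w ^ suc m * κ ^ suc m * (⟦ P.1# P.- u ⟧ ^ suc m * ⟦ P.1# P.- x ⟧ ^ suc m)
      ≈⟨ solve 4 (λ w k u x → w :* k :* (u :* x) := (w :* u) :* (k :* x))
           refl (w ^ suc m) (κ ^ suc m) (⟦ P.1# P.- u ⟧ ^ suc m) (⟦ P.1# P.- x ⟧ ^ suc m) ⟩
    (w ^ suc m * ⟦ P.1# P.- u ⟧ ^ suc m) * (κ ^ suc m * ⟦ P.1# P.- x ⟧ ^ suc m)
      ≈⟨ *-cong (inverse-^ F w[1-u] (suc m)) (inverse-^ F κ[1-x] (suc m)) ⟩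
    1# * 1#
      ≈⟨ *-identityˡ 1# ⟩
    1# ∎

  wκ-* : w * κ * ⟦ (u P.- P.1#) P.* (x P.- P.1#) ⟧ ≈ 1#
  wκ-* = begin
    - ω * κ * ⟦ (u P.- P.1#) P.* (x P.- P.1#) ⟧
      ≈⟨ *-congˡ (trans (*-homo _ _) (*-cong (trans (sub-homo u P.1#) (+-congˡ (-‿cong 1-homo)))
                                             (trans (sub-homo x P.1#) (+-cong x≈x̂ (-‿cong 1-homo))))) ⟩
    - ω * κ * ((⟦ u ⟧ - 1#) * (x̂ - 1#))
      ≈⟨ solve 4 (λ o k u x → :- o :* k :* ((u :- :1) :* (x :- :1)) :=
                              (o :* (u :- :1)) :* (k :* (:1 :- x))) refl ω κ ⟦ u ⟧ x̂ ⟩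
    (ω * (⟦ u ⟧ - 1#)) * (κ * (1# - x̂))
      ≈⟨ *-cong ωu (proj₂ 1-x-unit) ⟩
    1# * 1#
      ≈⟨ *-identityˡ 1# ⟩
    1# ∎

  middle : Carrier → Carrier → Carrier
  middle e k = e - k

  module _ (num den : Carrier → P.Carrier)
    (fraction≈ : ∀ f {i} → i * ⟦ den f ⟧ ≈ 1# → f ≈ ⟦ num f ⟧ * i) where

    -- These are the coefficients of tᵐ: f of the summands of the middle series
    -- and s of its sum, k of the constant, e of the eulerian series.
    record IsMiddle (m : ℕ) (f : ℕ → Carrier) (s e k : Carrier) : Set where
      field
        s-middle   : s ≡ middle e k
        constant   : Carrier
        num-e      : num e ≡ Pᶜ.∑ᴸ (permutations m) (λ π → u ^ᴾ descents π P.* x ^ᴾ inverseDescents π)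
        den-e      : den e ≡ (P.1# P.- u) ^ᴾ suc m P.* (P.1# P.- x) ^ᴾ suc m
        num-c      : num constant ≡ P.1#
        den-c      : den constant ≡ (u P.- P.1#) P.* (x P.- P.1#)
        k-constant : k ≡ FT.constant constant m
        f-term     : ∀ i → f i ≡ term i m

    fraction-remainder : (r : ℕ → ℕ → Carrier) →
      (∀ m K → num (r m K) ≡ remainderSum x m K) →
      (∀ m K → den (r m K) ≡ remainderDenominator x m K) →
      ∀ m f s e k → IsMiddle m f s e k → ∀ K → s - sum {K} (λ i → f (toℕ i)) ≈ r m K
    fraction-remainder r num-r den-r m f s e k M K = begin
      s - sum {K} (λ i → f (toℕ i))
        ≈⟨ +-congʳ (reflexive s-middle) ⟩
      e - k - sum {K} (λ i → f (toℕ i))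
        ≈⟨ +-congˡ (-‿cong (sum-cong-≋ {K} (λ i → reflexive (f-term (toℕ i))))) ⟩
      e - k - sum {K} (λ i → term (toℕ i) m)
        ≈⟨ middle-remainder m e≈ (trans (reflexive k-constant) (SeriesLemmas.constant-cong F c≈ m)) K ⟩
      remainderFraction m K
        ≈⟨ trans (fraction≈ (r m K) (trans (*-congˡ (reflexive (≡.cong ⟦_⟧ (den-r m K)))) (inverseDenominator-* K m)))
                 (*-congʳ (reflexive (≡.cong ⟦_⟧ (num-r m K)))) ⟨
      r m K ∎
      where
      open IsMiddle M

      e≈ : e ≈ ⟦ Pᶜ.∑ᴸ (permutations m) (λ π → u ^ᴾ descents π P.* x ^ᴾ inverseDescents π) ⟧ *
               (w ^ suc m * κ ^ suc m)
      e≈ = trans (fraction≈ e (trans (*-congˡ (reflexive (≡.cong ⟦_⟧ den-e))) (inverseDenominator-zero-* m)))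
                 (*-congʳ (reflexive (≡.cong ⟦_⟧ num-e)))

      c≈ : constant ≈ w * κ
      c≈ = trans (fraction≈ constant (trans (*-congˡ (reflexive (≡.cong ⟦_⟧ den-c))) wκ-*))
        (trans (*-congʳ (trans (reflexive (≡.cong ⟦_⟧ num-c)) 1-homo)) (*-identityˡ (w * κ)))

    sum-+-constant : ∀ {m f s e k} → IsMiddle m f s e k → s + k ≈ e
    sum-+-constant {s = s} {e} {k} M = begin
      s + k          ≈⟨ +-congʳ (reflexive (IsMiddle.s-middle M)) ⟩
      e - k + k      ≈⟨ solve 2 (λ e k → e :- k :+ k := e) refl e k ⟩
      e              ∎

private
  module Pˣ  = Polynomials ℤ-ring
  module Pᵘ  = Polynomials ℤ[x]
  module ℤx  = CommutativeRing ℤ[x]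
  module P   = CommutativeRing ℤ[x,u]
  module Fr  = Fractions ℤ[x,u]
  module F   = CommutativeRing ℚ⟨x,u⟩
  module Z   = CommutativeRing ℤ⟦t⟧
  module ZT  = FormalPowerSeries ℤ-ring
  module ZX  = CommutativeRing ℤ⟦x⟧
  module Sᵘ  = FormalPowerSeries ℤ⟦x⟧
  module XU  = CommutativeRing ℤ⟦x,u⟧
  module Lˣ  = SeriesLemmas ℤ-ring
  module Lᵘ  = SeriesLemmas ℤ⟦x⟧
  module Cᶻ  = Scalars ℤ-ring
  module Cˣᵘ = Scalars ℤ⟦x,u⟧
  module E   = EmbedLemmas ℤ[x,u]
  module ε   = RingHom E.embed-hom
  module Regx = RegularElements ℤ[x]
  module RegZ = RegularElements ℤ-ring
  open Exponentiation P.semiring using () renaming (_^_ to _^ᴾ_)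
  open Exponentiation ZX.semiring using () renaming (_^_ to _^ˣ_)
  open Exponentiation XU.semiring using () renaming (_^_ to _^ˣᵘ_)
  open Exponentiation Z.semiring using () renaming (_^_ to _^ᶻ_)
  open Summation F.semiring using (sum)

-- The expansion in powers of x and u

-- The function underlying this homomorphism is `toℤ⟦x,u⟧`, so its laws apply directly to
-- `HasExpansion`.
series-hom : RingHom ℤ[x,u] ℤ⟦x,u⟧
series-hom = coefficientwise (coeff-hom ℤ-ring) ∘ᴴ coeff-hom ℤ[x]

private module τ = RingHom series-hom

series-uᴾ : τ.⟦ uᴾ ⟧ XU.≈ Sᵘ.X
series-uᴾ = coefficientwise-X (coeff-hom ℤ-ring)

series-xᴾ : τ.⟦ xᴾ ⟧ XU.≈ Sᵘ.constant ZT.X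
series-xᴾ = coefficientwise-constant (coeff-hom ℤ-ring) Pˣ.X

series-1-u : τ.⟦ P.1# P.- uᴾ ⟧ XU.≈ Lᵘ.q
series-1-u = XU.trans {τ.⟦ P.1# P.- uᴾ ⟧} (τ.sub-homo P.1# uᴾ)
  (XU.+-cong {τ.⟦ P.1# ⟧} τ.1-homo (XU.-‿cong {τ.⟦ uᴾ ⟧} {Sᵘ.X} series-uᴾ))

series-1-x : τ.⟦ P.1# P.- xᴾ ⟧ XU.≈ Sᵘ.constant Lˣ.q
series-1-x = XU.trans {τ.⟦ P.1# P.- xᴾ ⟧} (τ.sub-homo P.1# xᴾ)
  (XU.trans {τ.⟦ P.1# ⟧ XU.- τ.⟦ xᴾ ⟧}
    (XU.+-cong {τ.⟦ P.1# ⟧} τ.1-homo (XU.-‿cong {τ.⟦ xᴾ ⟧} {Sᵘ.constant ZT.X} series-xᴾ))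
    (XU.sym {Sᵘ.constant Lˣ.q} (RingHom.sub-homo Lᵘ.constant-hom Z.1# ZT.X)))

-- For fixed k and n both sides, as series in t, are inverse to the same power of 1 - t.
doubleSeries-weakChains : ∀ m k n →
  doubleSeries m k n ≡ Cᶻ.nat (Lˣ.weakChains (suc k ℕ.* suc n) m)
doubleSeries-weakChains m k n = inverse-unique ℤ⟦t⟧ {Lˣ.q ^ᶻ N} {1/⟨1-t⟩^ N}
  (ZT.quotient-* Z.1# (Lˣ.q ^ᶻ N) (ZT.[1-X]^-unit-head N)) (Lˣ.q^-weakChains N) m
  where
  N : ℕ
  N = suc k ℕ.* suc n

eulerianSeries-expansion : ∀ m → HasExpansion (eulerianSeries m) (doubleSeries m)
eulerianSeries-expansion m = begin
  τ.⟦ (P.1# P.- uᴾ) ^ᴾ suc m P.* (P.1# P.- xᴾ) ^ᴾ suc m ⟧ XU.* doubleSeries m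
    ≈⟨ XU.*-cong {τ.⟦ (P.1# P.- uᴾ) ^ᴾ suc m P.* (P.1# P.- xᴾ) ^ᴾ suc m ⟧} {d} {doubleSeries m} {W}
         denominator (λ k n → doubleSeries-weakChains m k n) ⟩
  d XU.* W
    ≈⟨ PermutationSeries.weakChains-expansion ℤ-ring m ⟩
  Cˣᵘ.∑ᴸ (permutations m) (λ π →
    Sᵘ.X ^ˣᵘ descents π XU.* Sᵘ.constant (ZT.X ^ˣ inverseDescents π))
    ≈⟨ Cˣᵘ.∑ᴸ-cong (permutations m) (λ π → XU.*-cong
         {Sᵘ.X ^ˣᵘ descents π} {τ.⟦ uᴾ ^ᴾ descents π ⟧}
         (power {uᴾ} {Sᵘ.X} series-uᴾ (descents π))
         (XU.trans {Sᵘ.constant (ZT.X ^ˣ inverseDescents π)}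
           (RingHom.^-homo Lᵘ.constant-hom ZT.X (inverseDescents π))
           (power {xᴾ} {Sᵘ.constant ZT.X} series-xᴾ (inverseDescents π)))) ⟩
  Cˣᵘ.∑ᴸ (permutations m) (λ π → τ.⟦ uᴾ ^ᴾ descents π ⟧ XU.* τ.⟦ xᴾ ^ᴾ inverseDescents π ⟧)
    ≈⟨ Cˣᵘ.∑ᴸ-cong (permutations m) (λ π →
         XU.sym {τ.⟦ uᴾ ^ᴾ descents π P.* xᴾ ^ᴾ inverseDescents π ⟧}
           (τ.*-homo (uᴾ ^ᴾ descents π) (xᴾ ^ᴾ inverseDescents π))) ⟩
  Cˣᵘ.∑ᴸ (permutations m) (λ π → τ.⟦ uᴾ ^ᴾ descents π P.* xᴾ ^ᴾ inverseDescents π ⟧)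
    ≈⟨ τ.∑ᴸ-homo (permutations m) (λ π → uᴾ ^ᴾ descents π P.* xᴾ ^ᴾ inverseDescents π) ⟨
  τ.⟦ eulerian m ⟧ ∎
  where
  open SetoidReasoning XU.setoid
  d W : XU.Carrier
  d = Lᵘ.q ^ˣᵘ suc m XU.* Sᵘ.constant (Lˣ.q ^ˣ suc m)
  W = λ k n → Cᶻ.nat (Lˣ.weakChains (suc k ℕ.* suc n) m)

  ^ˣᵘ-cong : ∀ {f g} → f XU.≈ g → ∀ n → f ^ˣᵘ n XU.≈ g ^ˣᵘ n
  ^ˣᵘ-cong {f} {g} e n = Exponentiation.^-congˡ XU.semiring n {f} {g} e

  power : ∀ {p f} → τ.⟦ p ⟧ XU.≈ f → ∀ n → f ^ˣᵘ n XU.≈ τ.⟦ p ^ᴾ n ⟧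
  power {p} {f} e n = XU.sym {τ.⟦ p ^ᴾ n ⟧} (XU.trans {τ.⟦ p ^ᴾ n ⟧}
    (τ.^-homo p n) (^ˣᵘ-cong {τ.⟦ p ⟧} {f} e n))

  denominator : τ.⟦ (P.1# P.- uᴾ) ^ᴾ suc m P.* (P.1# P.- xᴾ) ^ᴾ suc m ⟧ XU.≈ d
  denominator = XU.trans {τ.⟦ (P.1# P.- uᴾ) ^ᴾ suc m P.* (P.1# P.- xᴾ) ^ᴾ suc m ⟧}
    (τ.*-homo ((P.1# P.- uᴾ) ^ᴾ suc m) ((P.1# P.- xᴾ) ^ᴾ suc m))
    (XU.*-cong {τ.⟦ (P.1# P.- uᴾ) ^ᴾ suc m ⟧} {Lᵘ.q ^ˣᵘ suc m}
      (XU.sym {Lᵘ.q ^ˣᵘ suc m} (power {P.1# P.- uᴾ} {Lᵘ.q} series-1-u (suc m)))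
      (XU.sym {Sᵘ.constant (Lˣ.q ^ˣ suc m)} (XU.trans {Sᵘ.constant (Lˣ.q ^ˣ suc m)}
        (RingHom.^-homo Lᵘ.constant-hom Lˣ.q (suc m))
        (power {P.1# P.- xᴾ} {Sᵘ.constant Lˣ.q} series-1-x (suc m)))))

-- The expansion at u = ∞

1/⟨u-1⟩-inverse : 1/⟨u-1⟩ F.* (Fr.embed uᴾ F.- F.1#) F.≈ F.1#
1/⟨u-1⟩-inverse = F.trans {1/⟨u-1⟩ F.* (Fr.embed uᴾ F.- F.1#)} {1/⟨u-1⟩ F.* Fr.embed (uᴾ P.- P.1#)} {F.1#}
  (F.*-congˡ {1/⟨u-1⟩} {Fr.embed uᴾ F.- F.1#} {Fr.embed (uᴾ P.- P.1#)}
    (F.sym {Fr.embed (uᴾ P.- P.1#)} {Fr.embed uᴾ F.- F.1#} (ε.sub-homo uᴾ P.1#)))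
  (E.fraction-* P.1# (uᴾ P.- P.1#) u-1-regular)

module Rem = Remainders ℤ[x,u] uᴾ

module MiddleSum = MiddleRemainder ℤ-ring ℤ[x,u] ℚ⟨x,u⟩ (polynomial-constant-hom ℤ[x]) E.embed-hom xᴾ uᴾ (P.refl {xᴾ})
  (Fr.embed xᴾ) (Fr.embed uᴾ) 1/⟨u-1⟩ (F.refl {Fr.embed xᴾ}) (F.refl {Fr.embed uᴾ}) 1-x-unit u-unit
  1/⟨u-1⟩-inverse

fraction≈ : ∀ f {i} → i F.* ε.⟦ Fr.den f ⟧ F.≈ F.1# → f F.≈ ε.⟦ Fr.num f ⟧ F.* i
fraction≈ f {i} = E.fraction≈ (Fr.num f) (Fr.den f) (Fr.den-regular f) {i}

remainder : ℕ → ℕ → F.Carrier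
remainder m K = Fr.fraction (Rem.remainderSum xᴾ m K) (Rem.remainderDenominator xᴾ m K)
  (Rem.remainderDenominator-regular xᴾ m 1-x-regular Pᵘ.regular-X 1-u-regular K)

IsMiddle : ℕ → (ℕ → F.Carrier) → F.Carrier → F.Carrier → F.Carrier → Set
IsMiddle = MiddleSum.IsMiddle Fr.num Fr.den fraction≈

middle-remainder : ∀ m f s e k → IsMiddle m f s e k →
  ∀ K → s F.- sum {K} (λ i → f (toℕ i)) F.≈ remainder m K
middle-remainder = MiddleSum.fraction-remainder Fr.num Fr.den fraction≈ remainder
  (λ m K → ≡.refl) (λ m K → ≡.refl)

1-X-regular : Regx.Regular (ℤx.1# ℤx.- Pˣ.X)
1-X-regular = Pˣ.regular-head (ℤx.1# ℤx.- Pˣ.X) RegZ.regular-1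

filtration : DegreeFiltration ℤ[x,u] xᴾ uᴾ
filtration = PolynomialDegrees.filtration ℤ[x] {Pˣ.X} 1-X-regular

-- A regular element equal to 0 would annihilate 1, and 1 differs from 0 in its coefficient at 0.
regular⇒≉0 : ∀ {a} → Regx.Regular a → ¬ (a ℤx.≈ ℤx.0#)
regular⇒≉0 {a} r a≈0 with () ← r ℤx.1# (ℤx.trans {a ℤx.* ℤx.1#} {a} {ℤx.0#} (ℤx.*-identityʳ a) a≈0) 0

-- The sum is chosen as the difference for which the first identity holds; the content lies in
-- proving that the summands converge to it.
middleSeries : RationalSeries
middleSeries m = MiddleSum.middle (eulerianSeries m) (constantTerm m)

isMiddle : ∀ m → IsMiddle m (λ k → Middle.term k m) (middleSeries m) (eulerianSeries m) (constantTerm m)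
isMiddle m = record
  { s-middle   = ≡.refl
  ; constant   = 1/⟨u-1⟩⟨x-1⟩
  ; num-e      = ≡.refl
  ; den-e      = ≡.refl
  ; num-c      = ≡.refl
  ; den-c      = ≡.refl
  ; k-constant = ≡.refl
  ; f-term     = λ i → ≡.refl
  }

-- Here K + suc m is the degree of the denominator of the remainder, and m bounds the degree of its
-- numerator.
exponent-bound : ∀ {N K m i} → N ℕ.≤ K → K ℕ.+ suc m ℕ.< i ℕ.+ N → m ℕ.< i
exponent-bound {N} {K} {m} {i} N≤K lt = ℕₚ.+-cancelˡ-< K m i (begin-strict
  K ℕ.+ m      <⟨ ℕₚ.+-monoʳ-< K ℕₚ.≤-refl ⟩
  K ℕ.+ suc m  <⟨ lt ⟩
  i ℕ.+ N      ≤⟨ ℕₚ.+-monoʳ-≤ i N≤K ⟩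
  i ℕ.+ K      ≡⟨ ℕₚ.+-comm i K ⟩
  K ℕ.+ i      ∎)
  where open ℕₚ.≤-Reasoning

private module D = DegreeFiltration filtration

sumsInPowersOfu⁻¹ : ∀ m f s → (∀ K → s F.- sum {K} (λ i → f (toℕ i)) F.≈ remainder m K) → SumsInPowersOfu⁻¹ f s
-- N itself serves as K₀, since the remainder after K terms has order at least K at u = ∞. The
-- denominator's leading coefficient is regular, hence nonzero.
sumsInPowersOfu⁻¹ m f s h N = N , λ K N≤K → remainder m K , h K , K ℕ.+ suc m ,
  regular⇒≉0 {Pᵘ.coeff (Rem.remainderDenominator xᴾ m K) (K ℕ.+ suc m)}
    (proj₁ (D.regularDegree-remainderDenominator m K)) ,
  λ i lt → D.degree-remainderSum m K i (exponent-bound N≤K lt)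

middle-+-constant : ∀ m f s e k → IsMiddle m f s e k → s F.+ k F.≈ e
middle-+-constant m f s e k = MiddleSum.sum-+-constant Fr.num Fr.den fraction≈ {m} {f} {s} {e} {k}

-- Stated for arbitrary series: comparing types that mention the concrete ones
-- would unfold all their numerators and denominators.
middle-and-expansion : (t : ℕ → RationalSeries) (M e c : RationalSeries) →
  (∀ m → IsMiddle m (λ k → t k m) (M m) (e m) (c m)) →
  (∀ m → HasExpansion (e m) (doubleSeries m)) →
    Σ[ M ∈ RationalSeries ] Σ[ L ∈ RationalSeries ]
      (∀ m → SumsInPowersOfu⁻¹ (λ k → t k m) (M m)) ×
      (∀ m → HasExpansion (L m) (doubleSeries m)) ×
      e ≈ᵀ (M +ᵀ c) ×
      (M +ᵀ c) ≈ᵀ L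
middle-and-expansion t M e c isM expansion =
  M , e ,
  (λ m → sumsInPowersOfu⁻¹ m (λ k → t k m) (M m) (middle-remainder m (λ k → t k m) (M m) (e m) (c m) (isM m))) ,
  expansion ,
  (λ m → F.sym {M m F.+ c m} {e m} (middle-+-constant m (λ k → t k m) (M m) (e m) (c m) (isM m))) ,
  (λ m → middle-+-constant m (λ k → t k m) (M m) (e m) (c m) (isM m))

corollary3 :
    Σ[ M ∈ RationalSeries ] Σ[ L ∈ RationalSeries ]
      (∀ m → SumsInPowersOfu⁻¹ (λ k → Middle.term k m) (M m)) ×
      (∀ m → HasExpansion (L m) (doubleSeries m)) ×
      eulerianSeries ≈ᵀ (M +ᵀ constantTerm) ×
      (M +ᵀ constantTerm) ≈ᵀ L
corollary3 = middle-and-expansion Middle.term middleSeries eulerianSeries constantTerm isMiddle eulerianSeries-expansion
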